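{- Let $n\ge 1$ and let $J\subseteq\{1,\dots,n-1\}$. For each positive divisor $d$ of $n$, let $J^d$ be the set of elements of $J$ divisible by $d$, write $J^d=\{j^d_1<j^d_2<\cdots<j^d_{|J^d|}\}$, and put $j^d_0=0$ and $j^d_{|J^d|+1}=n$. Then the number of $n$-cycles in $S_n$ with descent set $J$ is $$\frac1n\sum_{d\mid n}\mu(d)\,(-1)^{|J|-|J^d|}\,\det\left(\binom{\frac nd-\frac{j^d_l}{d}}{\frac{j^d_{m+1}}{d}-\frac{j^d_l}{d}}\right)_{0\le l,m\le |J^d|},$$ where $\mu$ is the Möbius function.
   Context: A permutation $\pi\in S_n$ has a descent at position $i$ ($1\le i\le n-1$) if $\pi(i)>\pi(i+1)$. In this statement "descent set $J$" means that the set of descent positions in $\{1,\dots,n-1\}$ is $J$ (the position $n$ is not counted). An $n$-cycle is a permutation in $S_n$ consisting of a single cycle of length $n$. Binomial coefficients $\binom{x}{y}$ with $y<0$ are $0$. -}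

module Defs where

open import Data.Bool.Base using (if_then_else_)
open import Data.Fin.Base as Fin using (Fin; toℕ; inject₁; punchIn)
open import Data.Fin.Permutation using (Permutation′; _⟨$⟩ʳ_; _≈_)
open import Data.Fin.Subset using (Subset; _∈_)
open import Data.Fin.Subset.Properties using (_∈?_)
open import Data.Integer.Base as ℤ using (ℤ; +_; -[1+_]; 0ℤ; 1ℤ; -1ℤ; _⊖_)
open import Data.Integer.Properties using (+-0-commutativeMonoid)
open import Data.List.Base using (List; filter; map; length; upTo; allFin; foldr)
open import Data.List.Relation.Unary.Unique.DecPropositional using (unique?)
open import Data.Nat.Base using (ℕ; zero; suc; _∸_; _/_; NonZero)
open import Data.Nat.Combinatorics using (_C_)
open import Data.Nat.Divisibility using (_∣?_)
open import Data.Nat.DivMod using (_mod_)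
open import Data.Nat.Primality.Factorisation using (factorise; factors)
open import Data.Nat.Properties using (_≟_)
open import Data.Product.Base using (Σ-syntax; _×_; proj₁)
open import Data.Vec.Base using (Vec; _∷_; _∷ʳ_; fromList; lookup)
open import Function.Base using (_∘_)
open import Function.Bundles using (Inverse; _⇔_)
open import Level using (0ℓ)
open import Relation.Binary.Bundles using (Setoid)
open import Relation.Binary.PropositionalEquality using (_≡_; refl; sym; trans; setoid)
open import Relation.Nullary using (does)
import Algebra.Properties.CommutativeMonoid.Sum as Sum

-- π = (c₀ c₁ … cₙ₋₁) in cycle notation, where c lists every point exactly once.
IsNCycle : ∀ {n} .{{_ : NonZero n}} → Permutation′ n → Set
IsNCycle {n} π =
  Σ[ c ∈ Permutation′ n ] ∀ (i : Fin n) → π ⟨$⟩ʳ (c ⟨$⟩ʳ i) ≡ c ⟨$⟩ʳ (suc (toℕ i) mod n)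

-- For n = suc m, the index i : Fin m stands for the position suc (toℕ i) in
-- {1, …, n - 1}; a Subset m is thereby a subset of {1, …, n - 1}.
IsDescent : ∀ {m} → Permutation′ (suc m) → Fin m → Set
IsDescent π i = (π ⟨$⟩ʳ inject₁ i) Fin.> (π ⟨$⟩ʳ Fin.suc i)

HasDescentSet : ∀ {m} → Permutation′ (suc m) → Subset m → Set
HasDescentSet π J = ∀ i → i ∈ J ⇔ IsDescent π i

-- Two elements are equal when the underlying permutations agree pointwise,
-- so the choice of cycle notation is not counted.
NCyclesWithDescentSet : ∀ {m} → Subset m → Setoid 0ℓ 0ℓ
NCyclesWithDescentSet {m} J = record
  { Carrier       = Σ[ π ∈ Permutation′ (suc m) ] (IsNCycle π × HasDescentSet π J)
  ; _≈_           = λ x y → proj₁ x ≈ proj₁ y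
  ; isEquivalence = record
    { refl  = λ _ → refl
    ; sym   = λ p i → sym (p i)
    ; trans = λ p q i → trans (p i) (q i)
    }
  }

HasCardinality : Setoid 0ℓ 0ℓ → ℕ → Set
HasCardinality S N = Inverse S (setoid (Fin N))

μ : (d : ℕ) → .{{NonZero d}} → ℤ
μ d = if does (unique? _≟_ ps) then -1ℤ ℤ.^ length ps else 0ℤ
  where
  ps : List ℕ
  ps = factors (factorise d)

-- All positive divisors of n are at most n, as n is nonzero.
sumOverDivisors : (n : ℕ) → .{{NonZero n}} → ((d : ℕ) → .{{NonZero d}} → ℤ) → ℤ
sumOverDivisors n f =
  foldr ℤ._+_ 0ℤ (map (λ e → f (suc e)) (filter (λ e → suc e ∣? n) (upTo n)))

binomial : ℕ → ℤ → ℤ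
binomial x (+ y)    = + (x C y)
binomial x -[1+ _ ] = 0ℤ

-- Laplace expansion along the first column.
det : ∀ {k} → (Fin k → Fin k → ℤ) → ℤ
det {zero}  M = 1ℤ
det {suc k} M = sum λ i →
  -1ℤ ℤ.^ toℕ i ℤ.* M i Fin.zero ℤ.* det (λ a b → M (punchIn i a) (Fin.suc b))
  where open Sum +-0-commutativeMonoid using (sum)

elements : ∀ {m} → Subset m → List ℕ
elements {m} J = map (suc ∘ toℕ) (filter (_∈? J) (allFin m))

-- J^d, in increasing order.
multiples : ∀ {m} → Subset m → ℕ → List ℕ
multiples J d = filter (d ∣?_) (elements J)

-- (j₀, j₁, …, jₖ, jₖ₊₁) with j₀ = 0, jₖ₊₁ = n and k = |J^d|.
endpoints : ∀ {m} (J : Subset m) (d : ℕ) → Vec ℕ (suc (suc (length (multiples J d))))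
endpoints {m} J d = 0 ∷ (fromList (multiples J d) ∷ʳ suc m)

-- When d divides n, all divisions are exact; the upper binomial argument never
-- truncates since j_l ≤ n, while the lower one may be a negative integer.
descentMatrix : ∀ {m} (J : Subset m) (d : ℕ) .{{_ : NonZero d}} →
  (l r : Fin (suc (length (multiples J d)))) → ℤ
descentMatrix {m} J d l r =
  binomial (suc m / d ∸ j (inject₁ l) / d) ((j (Fin.suc r) / d) ⊖ (j (inject₁ l) / d))
  where
  j : Fin (suc (suc (length (multiples J d)))) → ℕ
  j = lookup (endpoints J d)

{-# OPTIONS --safe #-}

-- An n-cycle has n notations (c₀ c₁ … cₙ₋₁), so n times the number of cycles counts
-- notations c. By inclusion–exclusion over the sublists K of J, it suffices to count
-- those whose cycle has all its descents in K. Such a K cuts the points into blocks;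
-- replacing each point of c by its block is a bijection onto the primitive words in
-- which every letter occurs as often as its block has elements (Gessel and Reutenauer).
-- Möbius inversion turns primitive words into d-th powers of words of length n / d, for
-- d ∣ n; these are counted by a multinomial coefficient if d divides every element of K,
-- and there are none otherwise. For fixed d, the alternating sum of the multinomial
-- coefficients satisfies the recursion that the Laplace expansion gives the determinant.

module Submission where

open import Defs
import Data.Nat.Properties as ℕₚ
import Data.Integer.Properties as ℤₚ
open import Algebra.Properties.CommutativeMonoid.Sum ℤₚ.+-0-commutativeMonoid using (sum; sum-cong-≗)
open import Data.Bool.Base using (if_then_else_)
open import Data.Empty using (⊥; ⊥-elim)
open import Data.Fin.Base as Fin using (Fin; zero; suc; toℕ; fromℕ<; inject₁; punchIn)
open import Data.Fin.Permutation as Perm using (Permutation′; permutation; _⟨$⟩ʳ_; _⟨$⟩ˡ_)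
open import Data.Fin.Properties as Finₚ using (toℕ<n; toℕ-injective; toℕ-fromℕ<; toℕ-inject₁; all?; any?)
open import Data.Fin.Subset as Sub using (Subset; ∣_∣; inside; outside)
open import Data.Fin.Subset.Properties as Subₚ using (drop-there)
open import Data.Integer.Base using (ℤ; +_; 0ℤ; 1ℤ; -1ℤ; _+_; _*_; -_; _^_; _⊖_)
open import Data.Integer.Tactic.RingSolver using (solve-∀)
open import Data.List.Base as List using (List; []; _∷_; _++_; foldr; map; filter; length; upTo; allFin; cartesianProductWith)
open import Data.List.Membership.DecPropositional ℕₚ._≟_ using (_∈?_)
open import Data.List.Membership.Propositional using (_∈_; _∉_)
import Data.List.Membership.Propositional.Properties as ∈ₚ
import Data.List.Properties as Listₚ
open import Data.List.Relation.Binary.Permutation.Propositional using (_↭_; ↭⇒↭ₛ; ↭-sym)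
open import Data.List.Relation.Binary.Permutation.Propositional.Properties using (↭-length)
import Data.List.Relation.Binary.Permutation.Setoid.Properties as ↭ₛ
open import Data.List.Relation.Unary.All as All using (All; []; _∷_)
import Data.List.Relation.Unary.All.Properties as Allₚ
open import Data.List.Relation.Unary.AllPairs as AllPairs using (AllPairs; []; _∷_)
import Data.List.Relation.Unary.AllPairs.Properties as AllPairsₚ
open import Data.List.Relation.Unary.Any using (here; there)
import Data.List.Relation.Unary.Any as Any
import Data.List.Relation.Unary.Any.Properties as Anyₚ
open import Data.List.Relation.Unary.Unique.DecPropositional ℕₚ._≟_ using (unique?)
open import Data.List.Relation.Unary.Unique.Propositional using (Unique)
import Data.List.Relation.Unary.Unique.Propositional.Properties as Uniqueₚ
open import Data.Nat.Base as ℕ using (ℕ; zero; suc; _∸_; _<_; _≤_; z≤n; s≤s; NonZero; pred)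
open import Data.Nat.Combinatorics using (_C_; nCn≡1; nCk+nC[k+1]≡[n+1]C[k+1])
open import Data.Nat.Coprimality using (Coprime; coprime-divisor)
import Data.Nat.DivMod as DivMod
open import Data.Nat.DivMod using (_mod_; _%_; m%n<n; m<n⇒m%n≡m; %-distribˡ-+; m%n%n≡m%n; [m+n]%n≡m%n)
open import Data.Nat.Divisibility as ∣ₚ using (_∣_; _∣?_; divides; ∣⇒≤)
open import Data.Nat.Induction using (<-rec)
open import Data.Nat.ListAction using (product)
open import Data.Nat.ListAction.Properties using (∈⇒∣product)
open import Data.Nat.Primality using (Prime; prime⇒nonZero; prime⇒irreducible; ¬prime[1])
open import Data.Nat.Primality.Factorisation using (PrimeFactorisation; factorise; factors; factorisationUnique; factorisationHasAllPrimeFactors)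
open import Data.Product.Base using (∃; ∃-syntax; Σ-syntax; _×_; _,_; proj₁; proj₂)
open import Data.Rational.Base using (_/_)
import Data.Rational.Properties as ℚₚ
import Data.Rational.Unnormalised.Base as ℚᵘ
open import Data.Sum.Base using (_⊎_; inj₁; inj₂)
open import Data.Unit.Base using (tt)
open import Data.Vec.Base as Vec using (Vec; []; _∷_; lookup; tabulate)
import Data.Vec.Properties as Vecₚ
open import Function.Base using (_∘_; id; case_of_)
open import Function.Bundles using (mk⇔; Equivalence)
open import Relation.Binary.Definitions using (DecidableEquality; tri<; tri≈; tri>)
open import Relation.Binary.PropositionalEquality hiding ([_])
open import Relation.Nullary using (¬_; Dec; yes; no; does; contradiction)
open import Relation.Nullary.Decidable using (_×-dec_; _⊎-dec_; _→-dec_; ¬?; dec-true; dec-false)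

-- Notations are plain words of length `n`, not words up to rotation: rotation acts freely on them,
-- so the factor `n` appears only at the end and no necklaces are needed. A cycle with all its
-- descents in `K` increases on every block, so comparing two points of one block amounts to
-- comparing their images, and so on along the cycle; a point is therefore determined by the
-- sequence of blocks that its orbit visits. Primitivity says that no two of these sequences
-- coincide. The block sizes are the gaps between successive cuts, and a d-th power uses each letter
-- a multiple of `d` times; this forces every cut to be a multiple of `d`. An element of `J` that is
-- no such multiple can only be left out of `K`, at the cost of a factor -1, and these factors make
-- up the sign in front of the determinant. All counts are sums of indicators in `ℤ` over complete
-- lists, so that signs, exchanges of sums and Möbius inversion become plain algebra.

-- Indicators and finite sums

bit : {P : Set} → Dec P → ℕ
bit p = if does p then 1 else 0

⟦_⟧ : {P : Set} → Dec P → ℤ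
⟦ p ⟧ = + bit p

bit-cong : {P Q : Set} (p : Dec P) (q : Dec Q) → (P → Q) → (Q → P) → bit p ≡ bit q
bit-cong (yes _) (yes _) _ _ = refl
bit-cong (no _)  (no _)  _ _ = refl
bit-cong (yes p) (no ¬q) f _ = contradiction (f p) ¬q
bit-cong (no ¬p) (yes q) _ g = contradiction (g q) ¬p

⟦⟧-cong : {P Q : Set} (p : Dec P) (q : Dec Q) → (P → Q) → (Q → P) → ⟦ p ⟧ ≡ ⟦ q ⟧
⟦⟧-cong p q f g = cong +_ (bit-cong p q f g)

⟦⟧-yes : {P : Set} (p : Dec P) → P → ⟦ p ⟧ ≡ 1ℤ
⟦⟧-yes (yes _) _ = refl
⟦⟧-yes (no ¬p) p = contradiction p ¬p

⟦⟧-no : {P : Set} (p : Dec P) → ¬ P → ⟦ p ⟧ ≡ 0ℤ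
⟦⟧-no (yes p) ¬p = contradiction p ¬p
⟦⟧-no (no _)  _  = refl

⟦⟧-× : {P Q : Set} (p : Dec P) (q : Dec Q) → ⟦ p ×-dec q ⟧ ≡ ⟦ p ⟧ * ⟦ q ⟧
⟦⟧-× (yes _) (yes _) = refl
⟦⟧-× (yes _) (no _)  = refl
⟦⟧-× (no _)  (yes _) = refl
⟦⟧-× (no _)  (no _)  = refl

-- An indicator guards its cofactor: inside a sum, the property may be assumed while the other
-- factor is rewritten.
⟦⟧-*-cong : {P : Set} (p : Dec P) {x y : ℤ} → (P → x ≡ y) → ⟦ p ⟧ * x ≡ ⟦ p ⟧ * y
⟦⟧-*-cong (yes p) eq = cong (1ℤ *_) (eq p)
⟦⟧-*-cong (no _)  _  = refl

⟦⟧-split : {P : Set} (p : Dec P) (x : ℤ) → x ≡ ⟦ p ⟧ * x + ⟦ ¬? p ⟧ * x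
⟦⟧-split (yes _) = solve-∀
⟦⟧-split (no _)  = solve-∀

private variable
  A B : Set

∑ : List A → (A → ℤ) → ℤ
∑ xs f = foldr (λ x s → f x + s) 0ℤ xs

∑-cong-∈ : (xs : List A) {f g : A → ℤ} → (∀ x → x ∈ xs → f x ≡ g x) → ∑ xs f ≡ ∑ xs g
∑-cong-∈ []       eq = refl
∑-cong-∈ (x ∷ xs) eq = cong₂ _+_ (eq x (here refl)) (∑-cong-∈ xs (λ y → eq y ∘ there))

∑-cong : (xs : List A) {f g : A → ℤ} → (∀ x → f x ≡ g x) → ∑ xs f ≡ ∑ xs g
∑-cong xs eq = ∑-cong-∈ xs (λ x _ → eq x)

∑-zero : (xs : List A) {f : A → ℤ} → (∀ x → x ∈ xs → f x ≡ 0ℤ) → ∑ xs f ≡ 0ℤ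
∑-zero []       eq = refl
∑-zero (x ∷ xs) eq = cong₂ _+_ (eq x (here refl)) (∑-zero xs (λ y → eq y ∘ there))

∑-+ : (xs : List A) (f g : A → ℤ) → ∑ xs (λ x → f x + g x) ≡ ∑ xs f + ∑ xs g
∑-+ []       f g = refl
∑-+ (x ∷ xs) f g = trans (cong (λ s → f x + g x + s) (∑-+ xs f g)) (interchange (f x) (g x) _ _)
  where
  interchange : ∀ a b c d → a + b + (c + d) ≡ a + c + (b + d)
  interchange = solve-∀

∑-* : (xs : List A) (c : ℤ) (f : A → ℤ) → c * ∑ xs f ≡ ∑ xs (λ x → c * f x)
∑-* []       c f = ℤₚ.*-zeroʳ c
∑-* (x ∷ xs) c f = trans (ℤₚ.*-distribˡ-+ c (f x) (∑ xs f)) (cong (λ s → c * f x + s) (∑-* xs c f))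

∑-const : (xs : List A) (c : ℤ) → ∑ xs (λ _ → c) ≡ + length xs * c
∑-const []       c = refl
∑-const (x ∷ xs) c = trans (cong (λ s → c + s) (∑-const xs c)) (sym (ℤₚ.suc-* (+ length xs) c))

∑-swap : (xs : List A) (ys : List B) (f : A → B → ℤ) →
         ∑ xs (λ x → ∑ ys (f x)) ≡ ∑ ys (λ y → ∑ xs (λ x → f x y))
∑-swap []       ys f = sym (∑-zero ys (λ _ _ → refl))
∑-swap (x ∷ xs) ys f =
  trans (cong (λ s → ∑ ys (f x) + s) (∑-swap xs ys f)) (sym (∑-+ ys (f x) (λ y → ∑ xs (λ x → f x y))))

∑-++ : (xs ys : List A) (f : A → ℤ) → ∑ (xs ++ ys) f ≡ ∑ xs f + ∑ ys f
∑-++ []       ys f = sym (ℤₚ.+-identityˡ _)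
∑-++ (x ∷ xs) ys f = trans (cong (λ s → f x + s) (∑-++ xs ys f)) (sym (ℤₚ.+-assoc (f x) _ _))

∑-map : (g : A → B) (xs : List A) (f : B → ℤ) → ∑ (map g xs) f ≡ ∑ xs (f ∘ g)
∑-map g []       f = refl
∑-map g (x ∷ xs) f = cong (λ s → f (g x) + s) (∑-map g xs f)

∑-cartesianProductWith : {C : Set} (h : A → B → C) (xs : List A) (ys : List B) (f : C → ℤ) →
  ∑ (cartesianProductWith h xs ys) f ≡ ∑ xs (λ x → ∑ ys (λ y → f (h x y)))
∑-cartesianProductWith h []       ys f = refl
∑-cartesianProductWith h (x ∷ xs) ys f =
  trans (∑-++ (map (h x) ys) _ f) (cong₂ _+_ (∑-map (h x) ys f) (∑-cartesianProductWith h xs ys f))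

module _ {P : A → Set} (P? : ∀ x → Dec (P x)) where

  ∑-filter : (xs : List A) (f : A → ℤ) → ∑ (filter P? xs) f ≡ ∑ xs (λ x → ⟦ P? x ⟧ * f x)
  ∑-filter []       f = refl
  ∑-filter (x ∷ xs) f with P? x
  ... | yes _ = cong₂ _+_ (sym (ℤₚ.*-identityˡ (f x))) (∑-filter xs f)
  ... | no  _ = trans (∑-filter xs f) (sym (ℤₚ.+-identityˡ _))

  length-filter-∑ : (xs : List A) → + length (filter P? xs) ≡ ∑ xs (λ x → ⟦ P? x ⟧)
  length-filter-∑ []       = refl
  length-filter-∑ (x ∷ xs) with P? x
  ... | yes _ = cong (λ s → 1ℤ + s) (length-filter-∑ xs)
  ... | no  _ = trans (length-filter-∑ xs) (sym (ℤₚ.+-identityˡ _))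

∑-δ : (_≟_ : DecidableEquality A) {xs : List A} → Unique xs → {a : A} → a ∈ xs → (f : A → ℤ) →
      ∑ xs (λ x → ⟦ a ≟ x ⟧ * f x) ≡ f a
∑-δ _≟_ {x ∷ xs} (x∉xs ∷ _) {a} (here refl) f = begin
  ⟦ a ≟ a ⟧ * f a + ∑ xs (λ x → ⟦ a ≟ x ⟧ * f x)
    ≡⟨ cong₂ (λ u v → u * f a + v) (⟦⟧-yes (a ≟ a) refl)
         (∑-zero xs (λ y y∈xs → cong (_* f y) (⟦⟧-no (a ≟ y) (All.lookup x∉xs y∈xs)))) ⟩
  1ℤ * f a + 0ℤ  ≡⟨ ℤₚ.+-identityʳ _ ⟩
  1ℤ * f a       ≡⟨ ℤₚ.*-identityˡ _ ⟩
  f a            ∎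
  where open ≡-Reasoning
∑-δ _≟_ {x ∷ xs} (x∉xs ∷ u) {a} (there a∈xs) f =
  trans (cong₂ (λ u v → u * f x + v) (⟦⟧-no (a ≟ x) (λ a≡x → All.lookup x∉xs a∈xs (sym a≡x))) (∑-δ _≟_ u a∈xs f))
        (ℤₚ.+-identityˡ _)

-- Enumerated types and counting by bijection

record Enumeration (A : Set) : Set where
  field
    elems    : List A
    unique   : Unique elems
    complete : ∀ a → a ∈ elems
    _≟_      : DecidableEquality A

  ∑-single : (a : A) (f : A → ℤ) → ∑ elems (λ x → ⟦ a ≟ x ⟧ * f x) ≡ f a
  ∑-single a = ∑-δ _≟_ unique (complete a)

open Enumeration using (elems)

module _ (E : Enumeration A) (F : Enumeration B) {P : A → Set} {Q : B → Set}
         (P? : ∀ a → Dec (P a)) (Q? : ∀ b → Dec (Q b)) (f : A → B) (g : B → A)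
         (P⇒Q : ∀ {a} → P a → Q (f a)) (Q⇒P : ∀ {b} → Q b → P (g b))
         (g∘f : ∀ {a} → P a → g (f a) ≡ a) (f∘g : ∀ {b} → Q b → f (g b) ≡ b) where

  open ≡-Reasoning
  private
    module E = Enumeration E
    module F = Enumeration F

  -- Double counting: both sides count the pairs `(a, b)` with `P a` and `f a ≡ b`, which are the
  -- pairs with `Q b` and `g b ≡ a`. Outside `P` and `Q` the two maps may take any values.
  ∑-bij : ∑ (elems E) (λ a → ⟦ P? a ⟧) ≡ ∑ (elems F) (λ b → ⟦ Q? b ⟧)
  ∑-bij = begin
    ∑ (elems E) (λ a → ⟦ P? a ⟧)
      ≡⟨ ∑-cong (elems E) (λ a → sym (F.∑-single (f a) (λ _ → ⟦ P? a ⟧))) ⟩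
    ∑ (elems E) (λ a → ∑ (elems F) (λ b → ⟦ f a F.≟ b ⟧ * ⟦ P? a ⟧))
      ≡⟨ ∑-swap (elems E) (elems F) (λ a b → ⟦ f a F.≟ b ⟧ * ⟦ P? a ⟧) ⟩
    ∑ (elems F) (λ b → ∑ (elems E) (λ a → ⟦ f a F.≟ b ⟧ * ⟦ P? a ⟧))
      ≡⟨ ∑-cong (elems F) (λ b → ∑-cong (elems E) (λ a → same a b)) ⟩
    ∑ (elems F) (λ b → ∑ (elems E) (λ a → ⟦ g b E.≟ a ⟧ * ⟦ Q? b ⟧))
      ≡⟨ ∑-cong (elems F) (λ b → E.∑-single (g b) (λ _ → ⟦ Q? b ⟧)) ⟩
    ∑ (elems F) (λ b → ⟦ Q? b ⟧)  ∎
    where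
    same : ∀ a b → ⟦ f a F.≟ b ⟧ * ⟦ P? a ⟧ ≡ ⟦ g b E.≟ a ⟧ * ⟦ Q? b ⟧
    same a b = begin
      ⟦ f a F.≟ b ⟧ * ⟦ P? a ⟧     ≡⟨ ⟦⟧-× (f a F.≟ b) (P? a) ⟨
      ⟦ (f a F.≟ b) ×-dec P? a ⟧   ≡⟨ ⟦⟧-cong ((f a F.≟ b) ×-dec P? a) ((g b E.≟ a) ×-dec Q? b)
                                       (λ { (refl , p) → g∘f p , P⇒Q p }) (λ { (refl , q) → f∘g q , Q⇒P q }) ⟩
      ⟦ (g b E.≟ a) ×-dec Q? b ⟧   ≡⟨ ⟦⟧-× (g b E.≟ a) (Q? b) ⟩
      ⟦ g b E.≟ a ⟧ * ⟦ Q? b ⟧     ∎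

finEnum : ∀ n → Enumeration (Fin n)
finEnum n = record
  { elems = allFin n ; unique = Uniqueₚ.allFin⁺ n ; complete = ∈ₚ.∈-allFin ; _≟_ = Finₚ._≟_ }

words : ∀ R n → List (Vec (Fin R) n)
words R zero    = [] ∷ []
words R (suc n) = cartesianProductWith _∷_ (allFin R) (words R n)

wordEnum : ∀ R n → Enumeration (Vec (Fin R) n)
wordEnum R n = record
  { elems = words R n ; unique = unique n ; complete = complete ; _≟_ = Vecₚ.≡-dec Finₚ._≟_ }
  where
  unique : ∀ n → Unique (words R n)
  unique zero    = [] ∷ []
  unique (suc n) = Uniqueₚ.cartesianProductWith⁺ _∷_ Vecₚ.∷-injective (Uniqueₚ.allFin⁺ R) (unique n)
  complete : ∀ {n} (w : Vec (Fin R) n) → w ∈ words R n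
  complete []      = here refl
  complete (b ∷ w) = ∈ₚ.∈-cartesianProductWith⁺ _∷_ (∈ₚ.∈-allFin b) (complete w)

allFin-suc : ∀ n → allFin (suc n) ≡ zero ∷ map suc (allFin n)
allFin-suc n = cong (zero ∷_) (sym (Listₚ.map-tabulate id suc))

∑-allFin-suc : ∀ n (f : Fin (suc n) → ℤ) → ∑ (allFin (suc n)) f ≡ f zero + ∑ (allFin n) (f ∘ suc)
∑-allFin-suc n f = trans (cong (λ xs → ∑ xs f) (allFin-suc n)) (cong (λ s → f zero + s) (∑-map suc (allFin n) f))

-- Counting in Fin n

# : ∀ {n} {P : Fin n → Set} → (∀ i → Dec (P i)) → ℕ
# {zero}  P? = 0
# {suc n} P? = bit (P? zero) ℕ.+ # (P? ∘ suc)

#-∑ : ∀ {n} {P : Fin n → Set} (P? : ∀ i → Dec (P i)) → + # P? ≡ ∑ (allFin n) (λ i → ⟦ P? i ⟧)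
#-∑ {zero}  P? = refl
#-∑ {suc n} P? = trans (cong (λ s → ⟦ P? zero ⟧ + s) (#-∑ (P? ∘ suc))) (sym (∑-allFin-suc n (λ i → ⟦ P? i ⟧)))

module _ {n} {P Q : Fin n → Set} where

  #-cong : (P? : ∀ i → Dec (P i)) (Q? : ∀ i → Dec (Q i)) → (∀ i → P i → Q i) → (∀ i → Q i → P i) → # P? ≡ # Q?
  #-cong P? Q? f g = ℤₚ.+-injective (begin
    + # P?                           ≡⟨ #-∑ P? ⟩
    ∑ (allFin n) (λ i → ⟦ P? i ⟧)    ≡⟨ ∑-cong (allFin n) (λ i → ⟦⟧-cong (P? i) (Q? i) (f i) (g i)) ⟩
    ∑ (allFin n) (λ i → ⟦ Q? i ⟧)    ≡⟨ #-∑ Q? ⟨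
    + # Q?                           ∎)
    where open ≡-Reasoning

bit-mono : {P Q : Set} (p : Dec P) (q : Dec Q) → (P → Q) → bit p ≤ bit q
bit-mono (yes p) (yes _) f = ℕₚ.≤-refl
bit-mono (yes p) (no ¬q) f = contradiction (f p) ¬q
bit-mono (no _)  q       f = z≤n

#-mono : ∀ {n} {P Q : Fin n → Set} (P? : ∀ i → Dec (P i)) (Q? : ∀ i → Dec (Q i)) → (∀ i → P i → Q i) → # P? ≤ # Q?
#-mono {zero}  P? Q? f = z≤n
#-mono {suc n} P? Q? f = ℕₚ.+-mono-≤ (bit-mono (P? zero) (Q? zero) (f zero)) (#-mono (P? ∘ suc) (Q? ∘ suc) (f ∘ suc))

#-strict : ∀ {n} {P Q : Fin n → Set} (P? : ∀ i → Dec (P i)) (Q? : ∀ i → Dec (Q i)) → (∀ i → P i → Q i) →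
           ∀ j → ¬ P j → Q j → # P? < # Q?
#-strict {suc n} P? Q? f zero ¬p q =
  ℕₚ.+-mono-<-≤ (subst₂ _<_ (sym (cong (if_then 1 else 0) (dec-false (P? zero) ¬p)))
                            (sym (cong (if_then 1 else 0) (dec-true (Q? zero) q))) ℕₚ.≤-refl)
                (#-mono (P? ∘ suc) (Q? ∘ suc) (f ∘ suc))
#-strict {suc n} P? Q? f (suc j) ¬p q =
  ℕₚ.+-mono-≤-< (bit-mono (P? zero) (Q? zero) (f zero)) (#-strict (P? ∘ suc) (Q? ∘ suc) (f ∘ suc) j ¬p q)

#-all : ∀ {n} {P : Fin n → Set} (P? : ∀ i → Dec (P i)) → (∀ i → P i) → # P? ≡ n
#-all {zero}  P? p = refl
#-all {suc n} P? p = cong₂ ℕ._+_ (cong (if_then 1 else 0) (dec-true (P? zero) (p zero))) (#-all (P? ∘ suc) (p ∘ suc))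

#-none : ∀ {n} {P : Fin n → Set} (P? : ∀ i → Dec (P i)) → (∀ i → ¬ P i) → # P? ≡ 0
#-none {zero}  P? ¬p = refl
#-none {suc n} P? ¬p = cong₂ ℕ._+_ (cong (if_then 1 else 0) (dec-false (P? zero) (¬p zero))) (#-none (P? ∘ suc) (¬p ∘ suc))

#-toℕ< : ∀ {n} k → k ≤ n → # {n} (λ i → toℕ i ℕₚ.<? k) ≡ k
#-toℕ< {n}     zero    _         = #-none {n} (λ i → toℕ i ℕₚ.<? 0) (λ _ ())
#-toℕ< {suc n} (suc k) (s≤s k≤n) =
  cong suc (trans (#-cong (λ i → suc (toℕ i) ℕₚ.<? suc k) (λ i → toℕ i ℕₚ.<? k) (λ (i : Fin n) → ℕ.s≤s⁻¹) (λ _ → s≤s)) (#-toℕ< k k≤n))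

-- Rotations of words

next : ∀ {m} → Fin (suc m) → Fin (suc m)
next {m} i = suc (toℕ i) mod suc m

-- Iteration of `next` rather than addition modulo `n`, so that a cycle notation can be followed by
-- recursion on the number of steps.
shift : ∀ {m} → ℕ → Fin (suc m) → Fin (suc m)
shift zero    i = i
shift (suc s) i = next (shift s i)

toℕ-mod : ∀ t m → toℕ (t mod suc m) ≡ t % suc m
toℕ-mod t m = toℕ-fromℕ< (m%n<n t (suc m))

toℕ-shift : ∀ {m} s (i : Fin (suc m)) → toℕ (shift s i) ≡ (s ℕ.+ toℕ i) % suc m
toℕ-shift {m} zero    i = sym (m<n⇒m%n≡m (toℕ<n i))
toℕ-shift {m} (suc s) i = begin
  toℕ (next (shift s i))                     ≡⟨ toℕ-mod (suc (toℕ (shift s i))) m ⟩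
  suc (toℕ (shift s i)) % suc m              ≡⟨ cong (λ x → suc x % suc m) (toℕ-shift s i) ⟩
  suc ((s ℕ.+ toℕ i) % suc m) % suc m        ≡⟨ suc-% (s ℕ.+ toℕ i) ⟩
  suc (s ℕ.+ toℕ i) % suc m                  ∎
  where
  open ≡-Reasoning
  suc-% : ∀ t → suc (t % suc m) % suc m ≡ suc t % suc m
  suc-% t = trans (%-distribˡ-+ 1 (t % suc m) (suc m))
           (trans (cong (λ x → (1 % suc m ℕ.+ x) % suc m) (m%n%n≡m%n t (suc m)))
                  (sym (%-distribˡ-+ 1 t (suc m))))

shift-unique : ∀ {m} s (i j : Fin (suc m)) → (s ℕ.+ toℕ i) % suc m ≡ toℕ j → shift s i ≡ j
shift-unique s i j eq = toℕ-injective (trans (toℕ-shift s i) eq)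

shift-full : ∀ {m} (i : Fin (suc m)) → shift (suc m) i ≡ i
shift-full {m} i = shift-unique (suc m) i i
  (trans (cong (_% suc m) (ℕₚ.+-comm (suc m) (toℕ i)))
  (trans ([m+n]%n≡m%n (toℕ i) (suc m)) (m<n⇒m%n≡m (toℕ<n i))))

shift-+ : ∀ {m} s t (i : Fin (suc m)) → shift s (shift t i) ≡ shift (s ℕ.+ t) i
shift-+ zero    t i = refl
shift-+ (suc s) t i = cong next (shift-+ s t i)

shift-comm : ∀ {m} s t (i : Fin (suc m)) → shift s (shift t i) ≡ shift t (shift s i)
shift-comm s t i = trans (shift-+ s t i) (trans (cong (λ x → shift x i) (ℕₚ.+-comm s t)) (sym (shift-+ t s i)))

shift-≤ : ∀ {m} {i j : Fin (suc m)} → i Fin.≤ j → shift (toℕ j ∸ toℕ i) i ≡ j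
shift-≤ {m} {i} {j} i≤j = shift-unique (toℕ j ∸ toℕ i) i j
  (trans (cong (_% suc m) (ℕₚ.m∸n+n≡m i≤j)) (m<n⇒m%n≡m (toℕ<n j)))

shift-transitive : ∀ {m} (i j : Fin (suc m)) → ∃ λ t → t < suc m × shift t i ≡ j
shift-transitive {m} i j with ℕₚ.≤-total (toℕ i) (toℕ j)
... | inj₁ i≤j = toℕ j ∸ toℕ i , ℕₚ.≤-<-trans (ℕₚ.m∸n≤m (toℕ j) (toℕ i)) (toℕ<n j) , shift-≤ i≤j
... | inj₂ j≤i with toℕ i ∸ toℕ j in eq
...   | zero  = 0 , s≤s z≤n , toℕ-injective (ℕₚ.≤-antisym (ℕₚ.m∸n≡0⇒m≤n eq) j≤i)
-- Here `i` lies `suc k` steps after `j`, so the rest of a full turn leads from `i` back to `j`.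
...   | suc k = suc m ∸ suc k , ℕₚ.∸-monoʳ-< {suc m} {suc k} {0} (s≤s z≤n) k<n , (begin
  shift (suc m ∸ suc k) i                      ≡⟨ cong (shift (suc m ∸ suc k)) (trans (cong (λ x → shift x j) (sym eq)) (shift-≤ j≤i)) ⟨
  shift (suc m ∸ suc k) (shift (suc k) j)      ≡⟨ shift-+ (suc m ∸ suc k) (suc k) j ⟩
  shift (suc m ∸ suc k ℕ.+ suc k) j            ≡⟨ cong (λ x → shift x j) (ℕₚ.m∸n+n≡m k<n) ⟩
  shift (suc m) j                              ≡⟨ shift-full j ⟩
  j                                            ∎)
  where
  open ≡-Reasoning
  k<n : suc k ≤ suc m
  k<n = subst (_≤ suc m) eq (ℕₚ.≤-trans (ℕₚ.m∸n≤m (toℕ i) (toℕ j)) (ℕₚ.<⇒≤ (toℕ<n i)))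

-- Injections and letter contents

Injective : ∀ {n R} → (Fin n → Fin R) → Set
Injective f = ∀ i j → f i ≡ f j → i ≡ j

injective? : ∀ {n R} (f : Fin n → Fin R) → Dec (Injective f)
injective? f = all? λ i → all? λ j → (f i Finₚ.≟ f j) →-dec (i Finₚ.≟ j)

-- If `a` were missed, punching it out would map `suc m` points injectively into `m`, against the
-- pigeonhole principle.
injective⇒surjective : ∀ {n} {f : Fin n → Fin n} → Injective f → ∀ a → ∃ λ i → f i ≡ a
injective⇒surjective {suc m} {f} inj a with any? (λ i → f i Finₚ.≟ a)
... | yes p = p
... | no ¬p = contradiction (inj _ _ (Finₚ.punchOut-injective (a≢ i) (a≢ j) eq)) (ℕₚ.<⇒≢ i<j ∘ cong toℕ)
  where
  a≢ : ∀ i → a ≢ f i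
  a≢ i eq = ¬p (i , sym eq)
  ph : ∃ λ i → ∃ λ j → i Fin.< j × Fin.punchOut (a≢ i) ≡ Fin.punchOut (a≢ j)
  ph = Finₚ.pigeonhole (ℕₚ.n<1+n m) (λ i → Fin.punchOut (a≢ i))
  i = proj₁ ph
  j = proj₁ (proj₂ ph)
  i<j = proj₁ (proj₂ (proj₂ ph))
  eq = proj₂ (proj₂ (proj₂ ph))

#-reindex : ∀ {n} {f : Fin n → Fin n} → Injective f → {P : Fin n → Set} (P? : ∀ a → Dec (P a)) →
            # (λ i → P? (f i)) ≡ # P?
#-reindex {n} {f} inj {P} P? = ℤₚ.+-injective (begin
  + # (λ i → P? (f i))                    ≡⟨ #-∑ (λ i → P? (f i)) ⟩
  ∑ (allFin n) (λ i → ⟦ P? (f i) ⟧)       ≡⟨ ∑-bij (finEnum n) (finEnum n) (λ i → P? (f i)) P? f f⁻¹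
                                               id (λ {b} → subst P (sym (f∘f⁻¹ b))) (λ {a} _ → inj _ _ (f∘f⁻¹ (f a))) (λ {b} _ → f∘f⁻¹ b) ⟩
  ∑ (allFin n) (λ a → ⟦ P? a ⟧)           ≡⟨ #-∑ P? ⟨
  + # P?                                  ∎)
  where
  open ≡-Reasoning
  f⁻¹ : Fin n → Fin n
  f⁻¹ a = proj₁ (injective⇒surjective inj a)
  f∘f⁻¹ : ∀ a → f (f⁻¹ a) ≡ a
  f∘f⁻¹ a = proj₂ (injective⇒surjective inj a)

SameContent : ∀ {n R} → (f g : Fin n → Fin R) → Set
SameContent f g = ∀ b → # (λ i → f i Finₚ.≟ b) ≡ # (λ i → g i Finₚ.≟ b)

sameContent? : ∀ {n R} (f g : Fin n → Fin R) → Dec (SameContent f g)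
sameContent? f g = all? λ b → # (λ i → f i Finₚ.≟ b) ℕₚ.≟ # (λ i → g i Finₚ.≟ b)

#-content : ∀ {n R} (f : Fin n → Fin R) {P : Fin R → Set} (P? : ∀ b → Dec (P b)) →
            + # (λ i → P? (f i)) ≡ ∑ (allFin R) (λ b → ⟦ P? b ⟧ * + # (λ i → f i Finₚ.≟ b))
#-content {n} {R} f P? = begin
  + # (λ i → P? (f i))
    ≡⟨ #-∑ (λ i → P? (f i)) ⟩
  ∑ (allFin n) (λ i → ⟦ P? (f i) ⟧)
    ≡⟨ ∑-cong (allFin n) (λ i → sym (Enumeration.∑-single (finEnum R) (f i) (λ b → ⟦ P? b ⟧))) ⟩
  ∑ (allFin n) (λ i → ∑ (allFin R) (λ b → ⟦ f i Finₚ.≟ b ⟧ * ⟦ P? b ⟧))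
    ≡⟨ ∑-swap (allFin n) (allFin R) (λ i b → ⟦ f i Finₚ.≟ b ⟧ * ⟦ P? b ⟧) ⟩
  ∑ (allFin R) (λ b → ∑ (allFin n) (λ i → ⟦ f i Finₚ.≟ b ⟧ * ⟦ P? b ⟧))
    ≡⟨ ∑-cong (allFin R) (λ b → begin
         ∑ (allFin n) (λ i → ⟦ f i Finₚ.≟ b ⟧ * ⟦ P? b ⟧)
           ≡⟨ ∑-cong (allFin n) (λ i → ℤₚ.*-comm ⟦ f i Finₚ.≟ b ⟧ ⟦ P? b ⟧) ⟩
         ∑ (allFin n) (λ i → ⟦ P? b ⟧ * ⟦ f i Finₚ.≟ b ⟧)
           ≡⟨ ∑-* (allFin n) ⟦ P? b ⟧ (λ i → ⟦ f i Finₚ.≟ b ⟧) ⟨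
         ⟦ P? b ⟧ * ∑ (allFin n) (λ i → ⟦ f i Finₚ.≟ b ⟧)
           ≡⟨ cong (λ x → ⟦ P? b ⟧ * x) (#-∑ (λ i → f i Finₚ.≟ b)) ⟨
         ⟦ P? b ⟧ * + # (λ i → f i Finₚ.≟ b)
           ∎) ⟩
  ∑ (allFin R) (λ b → ⟦ P? b ⟧ * + # (λ i → f i Finₚ.≟ b))  ∎
  where open ≡-Reasoning

-- Used for the letters below a given one: a word and `blk` then have equally many smaller letters,
-- which is all that ranks need.
sameContent-# : ∀ {n R} {f g : Fin n → Fin R} → SameContent f g → {P : Fin R → Set} (P? : ∀ b → Dec (P b)) →
                # (λ i → P? (f i)) ≡ # (λ i → P? (g i))
sameContent-# {n} {R} {f} {g} sc P? = ℤₚ.+-injective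
  (trans (#-content f P?) (trans (∑-cong (allFin R) (λ b → cong (λ x → ⟦ P? b ⟧ * + x) (sc b))) (sym (#-content g P?))))

-- Periods, primitive words and the order of rotations

Period : ∀ {m} {A : Set} → (Fin (suc m) → A) → ℕ → Set
Period w s = ∀ i → w (shift s i) ≡ w i

period? : ∀ {m R} (w : Fin (suc m) → Fin R) s → Dec (Period w s)
period? w s = all? λ i → w (shift s i) Finₚ.≟ w i

-- Periods are cyclic, and all `s` strictly between 0 and `n` are excluded, divisors of `n` or not;
-- the least period later reduces this to divisors.
Primitive : ∀ {m R} → (Fin (suc m) → Fin R) → Set
Primitive {m} w = ∀ (s : Fin (suc m)) → toℕ s ≢ 0 → ¬ Period w (toℕ s)

primitive? : ∀ {m R} (w : Fin (suc m) → Fin R) → Dec (Primitive w)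
primitive? w = all? λ s → ¬? (toℕ s ℕₚ.≟ 0) →-dec ¬? (period? w (toℕ s))

-- Lt f compares the first f letters of the rotations of w starting at i and at j.
module Lex {m R} (w : Fin (suc m) → Fin R) where

  Lt : ℕ → Fin (suc m) → Fin (suc m) → Set
  Lt zero    i j = ⊥
  Lt (suc f) i j = w i Fin.< w j ⊎ (w i ≡ w j × Lt f (next i) (next j))

  lt? : ∀ f i j → Dec (Lt f i j)
  lt? zero    i j = no id
  lt? (suc f) i j = (w i Finₚ.<? w j) ⊎-dec ((w i Finₚ.≟ w j) ×-dec lt? f (next i) (next j))

  Lt-irrefl : ∀ f i → ¬ Lt f i i
  Lt-irrefl (suc f) i (inj₁ lt)       = ℕₚ.<-irrefl refl lt
  Lt-irrefl (suc f) i (inj₂ (_ , lt)) = Lt-irrefl f (next i) lt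

  Lt-trans : ∀ f {i j k} → Lt f i j → Lt f j k → Lt f i k
  Lt-trans (suc f) (inj₁ p)        (inj₁ q)        = inj₁ (ℕₚ.<-trans p q)
  Lt-trans (suc f) (inj₁ p)        (inj₂ (eq , _)) = inj₁ (ℕₚ.<-≤-trans p (ℕₚ.≤-reflexive (cong toℕ eq)))
  Lt-trans (suc f) (inj₂ (eq , _)) (inj₁ q)        = inj₁ (ℕₚ.≤-<-trans (ℕₚ.≤-reflexive (cong toℕ eq)) q)
  Lt-trans (suc f) (inj₂ (e₁ , p)) (inj₂ (e₂ , q)) = inj₂ (trans e₁ e₂ , Lt-trans f p q)

  -- Deleting the common first letter of two rotations leaves a comparison of `m` letters; this
  -- brings it back to the full length `suc m`.
  Lt-suc : ∀ f {i j} → Lt f i j → Lt (suc f) i j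
  Lt-suc (suc f) (inj₁ p)        = inj₁ p
  Lt-suc (suc f) (inj₂ (eq , p)) = inj₂ (eq , Lt-suc f p)

  Lt⇒≤ : ∀ f {i j} → Lt f i j → w i Fin.≤ w j
  Lt⇒≤ (suc f) (inj₁ p)        = ℕₚ.<⇒≤ p
  Lt⇒≤ (suc f) (inj₂ (eq , _)) = ℕₚ.≤-reflexive (cong toℕ eq)

  Lt-compare : ∀ f i j → Lt f i j ⊎ Lt f j i ⊎ (∀ t → t < f → w (shift t i) ≡ w (shift t j))
  Lt-compare zero    i j = inj₂ (inj₂ (λ _ ()))
  Lt-compare (suc f) i j with Finₚ.<-cmp (w i) (w j)
  ... | tri< lt _ _ = inj₁ (inj₁ lt)
  ... | tri> _ _ gt = inj₂ (inj₁ (inj₁ gt))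
  ... | tri≈ _ eq _ with Lt-compare f (next i) (next j)
  ...   | inj₁ p        = inj₁ (inj₂ (eq , p))
  ...   | inj₂ (inj₁ p) = inj₂ (inj₁ (inj₂ (sym eq , p)))
  ...   | inj₂ (inj₂ h) = inj₂ (inj₂ λ where
            zero    _         → eq
            (suc t) (s≤s t<f) → subst₂ (λ x y → w x ≡ w y) (shift-comm t 1 i) (shift-comm t 1 j) (h t t<f))

  module _ (prim : Primitive w) where

    -- Every `x` is `shift t i` for some `t < suc m`, and moving it on by `s = toℕ j ∸ toℕ i` gives
    -- `shift t j`. Agreement of the two rotations thus makes `s` a period, and `0 < s < suc m`.
    agree⇒period : ∀ {i j} → i Fin.< j → ¬ (∀ t → t < suc m → w (shift t i) ≡ w (shift t j))
    agree⇒period {i} {j} i<j agree = prim (fromℕ< s<n) (s≢0 ∘ trans (sym (toℕ-fromℕ< s<n))) λ x →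
      let t , t<n , eq = shift-transitive i x in begin
        w (shift (toℕ (fromℕ< s<n)) x)  ≡⟨ cong (λ r → w (shift r x)) (toℕ-fromℕ< s<n) ⟩
        w (shift s x)                   ≡⟨ cong (λ y → w (shift s y)) eq ⟨
        w (shift s (shift t i))         ≡⟨ cong w (shift-comm s t i) ⟩
        w (shift t (shift s i))         ≡⟨ cong (λ y → w (shift t y)) (shift-≤ (ℕₚ.<⇒≤ i<j)) ⟩
        w (shift t j)                   ≡⟨ agree t t<n ⟨
        w (shift t i)                   ≡⟨ cong w eq ⟩
        w x                             ∎
      where
      open ≡-Reasoning
      s = toℕ j ∸ toℕ i
      s<n : s < suc m
      s<n = ℕₚ.≤-<-trans (ℕₚ.m∸n≤m (toℕ j) (toℕ i)) (toℕ<n j)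
      s≢0 : s ≢ 0
      s≢0 eq = ℕₚ.<⇒≱ i<j (ℕₚ.m∸n≡0⇒m≤n eq)

    Lt-total : ∀ {i j} → i ≢ j → Lt (suc m) i j ⊎ Lt (suc m) j i
    Lt-total {i} {j} i≢j with Lt-compare (suc m) i j
    ... | inj₁ p        = inj₁ p
    ... | inj₂ (inj₁ p) = inj₂ p
    ... | inj₂ (inj₂ h) with Finₚ.<-cmp i j
    ...   | tri< i<j _ _ = ⊥-elim (agree⇒period i<j h)
    ...   | tri≈ _ i≡j _ = contradiction i≡j i≢j
    ...   | tri> _ _ j<i = ⊥-elim (agree⇒period j<i (λ t t<n → sym (h t t<n)))

  rank# : Fin (suc m) → ℕ
  rank# i = # (λ i′ → lt? (suc m) i′ i)

  rank#<n : ∀ i → rank# i < suc m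
  rank#<n i = subst (rank# i <_) (#-all {suc m} (λ _ → yes tt) (λ _ → tt))
    (#-strict (λ i′ → lt? (suc m) i′ i) (λ _ → yes tt) (λ _ _ → tt) i (Lt-irrefl (suc m) i) tt)

  rank : Fin (suc m) → Fin (suc m)
  rank i = fromℕ< (rank#<n i)

  toℕ-rank : ∀ i → toℕ (rank i) ≡ rank# i
  toℕ-rank i = toℕ-fromℕ< (rank#<n i)

  rank-mono : ∀ {i j} → Lt (suc m) i j → rank i Fin.< rank j
  rank-mono {i} {j} p = subst₂ _<_ (sym (toℕ-rank i)) (sym (toℕ-rank j))
    (#-strict (λ i′ → lt? (suc m) i′ i) (λ i′ → lt? (suc m) i′ j) (λ _ q → Lt-trans (suc m) q p) i (Lt-irrefl (suc m) i) p)

-- The map c ↦ blk ∘ c from cycle notations to words is inverted by ranking the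
-- rotations of a primitive word lexicographically: a cyclic permutation that is
-- increasing on the blocks satisfies c i < c j as soon as the letters of i and j
-- agree and c (i + 1) < c (j + 1).
module GesselReutenauer {m R} (blk : Fin (suc m) → Fin R) (blk-mono : ∀ {a b} → a Fin.≤ b → blk a Fin.≤ blk b) where

  private
    n = suc m

  -- For a bijective `c`, this says that the cycle sending `c i` to `c (next i)` increases on each
  -- block. The form without an inverse makes sense for every function `c`.
  BlockIncreasing : (Fin n → Fin n) → Set
  BlockIncreasing c = ∀ i j → c i Fin.< c j → blk (c i) ≡ blk (c j) → c (next i) Fin.< c (next j)

  blockIncreasing? : ∀ c → Dec (BlockIncreasing c)
  blockIncreasing? c = all? λ i → all? λ j →
    (c i Finₚ.<? c j) →-dec ((blk (c i) Finₚ.≟ blk (c j)) →-dec (c (next i) Finₚ.<? c (next j)))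

  -- `c` is kept apart from the rank because it will be the `lookup` of a tabulated vector, which
  -- equals the rank only pointwise.
  module Ranking (w : Fin n → Fin R) (sc : SameContent w blk) (prim : Primitive w)
                 (c : Fin n → Fin n) (c≗rank : ∀ i → c i ≡ Lex.rank w i) where

    open Lex w

    c-mono : ∀ {i j} → Lt n i j → c i Fin.< c j
    c-mono {i} {j} p = subst₂ Fin._<_ (sym (c≗rank i)) (sym (c≗rank j)) (rank-mono p)

    toℕ-c : ∀ i → toℕ (c i) ≡ rank# i
    toℕ-c i = trans (cong toℕ (c≗rank i)) (toℕ-rank i)

    c-injective : Injective c
    c-injective i j eq with i Finₚ.≟ j
    ... | yes i≡j = i≡j
    ... | no  i≢j with Lt-total prim i≢j
    ...   | inj₁ p = contradiction (cong toℕ eq) (ℕₚ.<⇒≢ (c-mono p))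
    ...   | inj₂ p = contradiction (cong toℕ (sym eq)) (ℕₚ.<⇒≢ (c-mono p))

    #-< : (a : Fin n) → # {n} (λ a′ → toℕ a′ ℕₚ.<? toℕ a) ≡ toℕ a
    #-< a = #-toℕ< (toℕ a) (ℕₚ.<⇒≤ (toℕ<n a))

    sc-< : (b : Fin R) → # (λ i → w i Finₚ.<? b) ≡ # (λ a → blk a Finₚ.<? b)
    sc-< b = sameContent-# {n} {R} {w} {blk} sc (λ b′ → b′ Finₚ.<? b)

    -- If `blk (c i)` were below `w i`, then all points up to and including `c i` would have blocks
    -- below `w i`. By equal content, more than `toℕ (c i)` positions would carry letters below
    -- `w i`; their rotations are all smaller, yet the rank of `i` is `toℕ (c i)`.
    w≤blk∘c : ∀ i → w i Fin.≤ blk (c i)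
    w≤blk∘c i = ℕₚ.≮⇒≥ λ lt → ℕₚ.<-irrefl refl (begin-strict
      toℕ (c i)                                    ≡⟨ #-< (c i) ⟨
      # {n} (λ a → toℕ a ℕₚ.<? toℕ (c i))              <⟨ #-strict {n} (λ a → toℕ a ℕₚ.<? toℕ (c i)) (λ a → blk a Finₚ.<? w i)
                                                        (λ a a<ci → ℕₚ.≤-<-trans (blk-mono (ℕₚ.<⇒≤ a<ci)) lt)
                                                        (c i) (ℕₚ.<-irrefl refl) lt ⟩
      # (λ a → blk a Finₚ.<? w i)                  ≡⟨ sc-< (w i) ⟨
      # (λ i′ → w i′ Finₚ.<? w i)                  ≤⟨ #-mono (λ i′ → w i′ Finₚ.<? w i) (λ i′ → lt? n i′ i) (λ _ → inj₁) ⟩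
      rank# i                                      ≡⟨ toℕ-c i ⟨
      toℕ (c i)                                    ∎)
      where open ℕₚ.≤-Reasoning

    -- If `w i` were below `blk (c i)`, then `i` and all positions ranked before it would carry
    -- letters below `blk (c i)`. By equal content there are at most `toℕ (c i)` such positions, one
    -- too few.
    blk∘c≤w : ∀ i → blk (c i) Fin.≤ w i
    blk∘c≤w i = ℕₚ.≮⇒≥ λ lt → ℕₚ.<-irrefl refl (begin-strict
      toℕ (c i)                                    ≡⟨ toℕ-c i ⟩
      rank# i                                      <⟨ #-strict (λ i′ → lt? n i′ i) (λ i′ → w i′ Finₚ.<? blk (c i))
                                                        (λ i′ p → ℕₚ.≤-<-trans (Lt⇒≤ n p) lt) i (Lt-irrefl n i) lt ⟩
      # (λ i′ → w i′ Finₚ.<? blk (c i))            ≡⟨ sc-< (blk (c i)) ⟩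
      # (λ a → blk a Finₚ.<? blk (c i))            ≤⟨ #-mono (λ a → blk a Finₚ.<? blk (c i)) (λ a → toℕ a ℕₚ.<? toℕ (c i))
                                                        (λ a p → ℕₚ.≰⇒> (λ ci≤a → ℕₚ.<⇒≱ p (blk-mono ci≤a))) ⟩
      # {n} (λ a → toℕ a ℕₚ.<? toℕ (c i))              ≡⟨ #-< (c i) ⟩
      toℕ (c i)                                    ∎)
      where open ℕₚ.≤-Reasoning

    blk∘c≗w : ∀ i → blk (c i) ≡ w i
    blk∘c≗w i = toℕ-injective (ℕₚ.≤-antisym (blk∘c≤w i) (w≤blk∘c i))

    -- The order of `c i` and `c j` is that of the rotations; when the first letters agree, the
    -- order is decided by the rest, which begins at `next i` and `next j`.
    c-blockIncreasing : BlockIncreasing c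
    c-blockIncreasing i j ci<cj eq with Lt-total prim (λ i≡j → ℕₚ.<⇒≢ ci<cj (cong (toℕ ∘ c) i≡j))
    ... | inj₂ p = contradiction (c-mono p) (ℕₚ.<⇒≯ ci<cj)
    ... | inj₁ (inj₁ lt) = contradiction (cong toℕ (trans (sym (blk∘c≗w i)) (trans eq (blk∘c≗w j)))) (ℕₚ.<⇒≢ lt)
    ... | inj₁ (inj₂ (_ , p)) = c-mono (Lt-suc m p)

  module Reading (c : Fin n → Fin n) (inj : Injective c) (incr : BlockIncreasing c)
                 (w : Fin n → Fin R) (w≗blk∘c : ∀ i → w i ≡ blk (c i)) where

    open Lex w

    w-sameContent : SameContent w blk
    w-sameContent b = trans (#-cong (λ i → w i Finₚ.≟ b) (λ i → blk (c i) Finₚ.≟ b)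
                              (λ i → trans (sym (w≗blk∘c i))) (λ i → trans (w≗blk∘c i)))
                            (#-reindex inj (λ a → blk a Finₚ.≟ b))

    step : ∀ {i j} → w i ≡ w j → c i Fin.< c j → c (next i) Fin.< c (next j)
    step {i} {j} eq lt = incr i j lt (trans (sym (w≗blk∘c i)) (trans eq (w≗blk∘c j)))

    -- The opposite order of `c i` and `c j` would be carried forward by `step` and contradict the
    -- order of their successors.
    step⁻¹ : ∀ {i j} → w i ≡ w j → c (next i) Fin.< c (next j) → c i Fin.< c j
    step⁻¹ {i} {j} eq lt with Finₚ.<-cmp (c i) (c j)
    ... | tri< p _ _ = p
    ... | tri≈ _ p _ = contradiction (cong (toℕ ∘ c ∘ next) (inj i j p)) (ℕₚ.<⇒≢ lt)
    ... | tri> _ _ p = contradiction (step (sym eq) p) (ℕₚ.<⇒≯ lt)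

    -- At the first differing letter the order holds because `blk` is monotone; `step⁻¹` carries it
    -- back over the equal letters.
    Lt⇒< : ∀ f {i j} → Lt f i j → c i Fin.< c j
    Lt⇒< (suc f) {i} {j} (inj₁ lt) = ℕₚ.≰⇒> λ cj≤ci → ℕₚ.<⇒≱ lt
      (subst₂ Fin._≤_ (sym (w≗blk∘c j)) (sym (w≗blk∘c i)) (blk-mono cj≤ci))
    Lt⇒< (suc f) (inj₂ (eq , p)) = step⁻¹ eq (Lt⇒< f p)

    steps : ∀ {i j} → (∀ t → w (shift t i) ≡ w (shift t j)) → c i Fin.< c j → ∀ t → c (shift t i) Fin.< c (shift t j)
    steps h lt zero    = lt
    steps h lt (suc t) = step (h t) (steps h lt t)

    -- Let `s` be a period and compare `c zero` with `c` at `s`. A strict inequality propagates by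
    -- `steps` all round the cycle, because the letters agree; but `c x < c (shift s x)` fails where
    -- `c` is largest, and the reverse inequality fails where `c` is smallest. Equality gives
    -- `s = 0` by injectivity.
    w-primitive : Primitive w
    w-primitive s s≢0 per with Finₚ.<-cmp (c zero) (c (shift (toℕ s) zero))
    ... | tri≈ _ eq _ = s≢0 (begin
      toℕ s                        ≡⟨ m<n⇒m%n≡m (toℕ<n s) ⟨
      toℕ s % n                    ≡⟨ cong (_% n) (ℕₚ.+-identityʳ (toℕ s)) ⟨
      (toℕ s ℕ.+ 0) % n            ≡⟨ toℕ-shift {m} (toℕ s) zero ⟨
      toℕ (shift (toℕ s) zero)     ≡⟨ cong toℕ (inj _ _ eq) ⟨
      0                            ∎)
      where open ≡-Reasoning
    ... | tri< lt _ _ = ℕₚ.<⇒≱ (subst (λ x → x Fin.< c (shift (toℕ s) top)) (proj₂ max) (up top)) (Finₚ.≤fromℕ _)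
      where
      max = injective⇒surjective inj (Fin.fromℕ m)
      top = proj₁ max
      up : ∀ x → c x Fin.< c (shift (toℕ s) x)
      up x = let t , _ , eq = shift-transitive zero x in
        subst₂ (λ y z → c y Fin.< c z) eq (trans (shift-comm t (toℕ s) zero) (cong (shift (toℕ s)) eq))
          (steps (λ t → sym (trans (cong w (shift-comm t (toℕ s) zero)) (per (shift t zero)))) lt t)
    ... | tri> _ _ gt = ℕₚ.n≮0 (subst (λ x → c (shift (toℕ s) bot) Fin.< x) (proj₂ min) (down bot))
      where
      min = injective⇒surjective inj zero
      bot = proj₁ min
      down : ∀ x → c (shift (toℕ s) x) Fin.< c x
      down x = let t , _ , eq = shift-transitive zero x in
        subst₂ (λ y z → c z Fin.< c y) eq (trans (shift-comm t (toℕ s) zero) (cong (shift (toℕ s)) eq))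
          (steps (λ t → trans (cong w (shift-comm t (toℕ s) zero)) (per (shift t zero))) gt t)

    <⇒Lt : ∀ {i j} → c i Fin.< c j → Lt n i j
    <⇒Lt {i} {j} lt with Lt-total w-primitive (λ i≡j → ℕₚ.<⇒≢ lt (cong (toℕ ∘ c) i≡j))
    ... | inj₁ p = p
    ... | inj₂ p = contradiction (Lt⇒< n p) (ℕₚ.<⇒≯ lt)

    -- The order of rotations is the order of the values of `c`, and as `c` is a bijection, exactly
    -- `toℕ (c i)` values lie below `c i`.
    rank≗c : ∀ i → rank i ≡ c i
    rank≗c i = toℕ-injective (begin
      toℕ (rank i)                              ≡⟨ toℕ-rank i ⟩
      rank# i                                   ≡⟨ #-cong (λ i′ → lt? n i′ i) (λ i′ → c i′ Finₚ.<? c i) (λ _ → Lt⇒< n) (λ _ → <⇒Lt) ⟩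
      # (λ i′ → c i′ Finₚ.<? c i)               ≡⟨ #-reindex inj (λ a → a Finₚ.<? c i) ⟩
      # {n} (λ a → a Finₚ.<? c i)                   ≡⟨ #-toℕ< (toℕ (c i)) (ℕₚ.<⇒≤ (toℕ<n (c i))) ⟩
      toℕ (c i)                                 ∎)
      where open ≡-Reasoning

  cycles≡primitiveWords :
    ∑ (words n n) (λ c → ⟦ injective? (lookup c) ×-dec blockIncreasing? (lookup c) ⟧) ≡
    ∑ (words R n) (λ w → ⟦ sameContent? (lookup w) blk ×-dec primitive? (lookup w) ⟧)
  cycles≡primitiveWords = ∑-bij (wordEnum n n) (wordEnum R n)
    (λ c → injective? (lookup c) ×-dec blockIncreasing? (lookup c))
    (λ w → sameContent? (lookup w) blk ×-dec primitive? (lookup w))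
    read notate
    (λ { {c} (inj , incr) → let open Reading (lookup c) inj incr (lookup (read c)) (read≗ c) in
         w-sameContent , w-primitive })
    (λ { {w} (sc , prim) → let open Ranking (lookup w) sc prim (lookup (notate w)) (notate≗ w) in
         c-injective , c-blockIncreasing })
    (λ { {c} (inj , incr) → let open Reading (lookup c) inj incr (lookup (read c)) (read≗ c) in
         trans (Vecₚ.tabulate-cong rank≗c) (Vecₚ.tabulate∘lookup c) })
    (λ { {w} (sc , prim) → let open Ranking (lookup w) sc prim (lookup (notate w)) (notate≗ w) in
         trans (Vecₚ.tabulate-cong blk∘c≗w) (Vecₚ.tabulate∘lookup w) })
    where
    read : Vec (Fin n) n → Vec (Fin R) n
    read c = tabulate (blk ∘ lookup c)
    notate : Vec (Fin R) n → Vec (Fin n) n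
    notate w = tabulate (Lex.rank (lookup w))
    read≗ : ∀ c i → lookup (read c) i ≡ blk (lookup c i)
    read≗ c = Vecₚ.lookup∘tabulate (blk ∘ lookup c)
    notate≗ : ∀ w i → lookup (notate w) i ≡ Lex.rank (lookup w) i
    notate≗ w = Vecₚ.lookup∘tabulate (Lex.rank (lookup w))

-- The Möbius function

-- The body of `μ` with the prime factors as an argument, so that `μ` can be evaluated on any
-- factorisation and not only on the one that `factorise` returns.
squarefreeSign : List ℕ → ℤ
squarefreeSign ps = if does (unique? ps) then -1ℤ ^ length ps else 0ℤ

squarefreeSign-unique : ∀ {ps} → Unique ps → squarefreeSign ps ≡ -1ℤ ^ length ps
squarefreeSign-unique {ps} u = cong (if_then -1ℤ ^ length ps else 0ℤ) (dec-true (unique? ps) u)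

squarefreeSign-repeated : ∀ {ps} → ¬ Unique ps → squarefreeSign ps ≡ 0ℤ
squarefreeSign-repeated {ps} ¬u = cong (if_then -1ℤ ^ length ps else 0ℤ) (dec-false (unique? ps) ¬u)

squarefreeSign-↭ : ∀ {ps qs} → ps ↭ qs → squarefreeSign ps ≡ squarefreeSign qs
squarefreeSign-↭ {ps} {qs} ps↭qs with unique? ps
... | yes u = sym (trans (squarefreeSign-unique (unique-↭ ps↭qs u)) (cong (-1ℤ ^_) (sym (↭-length ps↭qs))))
  where
  unique-↭ : ∀ {ps qs} → ps ↭ qs → Unique ps → Unique qs
  unique-↭ p = ↭ₛ.Unique-resp-↭ (setoid ℕ) (↭⇒↭ₛ p)
... | no ¬u = sym (squarefreeSign-repeated (¬u ∘ ↭ₛ.Unique-resp-↭ (setoid ℕ) (↭⇒↭ₛ (↭-sym ps↭qs))))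

squarefreeSign-∷-∈ : ∀ {p ps} → p ∈ ps → squarefreeSign (p ∷ ps) ≡ 0ℤ
squarefreeSign-∷-∈ {p} {ps} p∈ps = squarefreeSign-repeated {p ∷ ps} λ { (p∉ps ∷ _) → All.lookup p∉ps p∈ps refl }

squarefreeSign-∷-∉ : ∀ {p ps} → p ∉ ps → squarefreeSign (p ∷ ps) ≡ - squarefreeSign ps
squarefreeSign-∷-∉ {p} {ps} p∉ps = cases (unique? ps)
  where
  cases : Dec (Unique ps) → squarefreeSign (p ∷ ps) ≡ - squarefreeSign ps
  cases (yes u) = trans (squarefreeSign-unique (All.tabulate (λ { q∈ps refl → p∉ps q∈ps }) ∷ u))
    (trans (ℤₚ.-1*i≡-i (-1ℤ ^ length ps)) (cong -_ (sym (squarefreeSign-unique u))))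
  cases (no ¬u) = trans (squarefreeSign-repeated {p ∷ ps} λ { (_ ∷ u) → ¬u u })
    (cong -_ (sym (squarefreeSign-repeated ¬u)))

-- Extended by 0 at 0, the Möbius function can be summed over `upTo` without evidence that the
-- argument is non-zero.
μ₀ : ℕ → ℤ
μ₀ zero    = 0ℤ
μ₀ (suc d) = μ (suc d)

module _ {p} (pr : Prime p) where

  private instance _ = prime⇒nonZero pr

  μ₀-prime-* : ∀ d → .{{_ : NonZero d}} → μ₀ (p ℕ.* d) ≡ squarefreeSign (p ∷ factors (factorise d))
  μ₀-prime-* d = trans (μ₀-factors (p ℕ.* d) {{ℕₚ.m*n≢0 p d}})
    (squarefreeSign-↭ (factorisationUnique (factorise (p ℕ.* d) {{ℕₚ.m*n≢0 p d}}) (record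
      { factors         = p ∷ factors (factorise d)
      ; isFactorisation = cong (p ℕ.*_) (PrimeFactorisation.isFactorisation (factorise d))
      ; factorsPrime    = pr ∷ PrimeFactorisation.factorsPrime (factorise d)
      })))
    where
    μ₀-factors : ∀ d → .{{_ : NonZero d}} → μ₀ d ≡ squarefreeSign (factors (factorise d))
    μ₀-factors (suc d) = refl

  μ₀-prime-*-∣ : ∀ {d} → p ∣ d → μ₀ (p ℕ.* d) ≡ 0ℤ
  μ₀-prime-*-∣ {zero}  _   = cong μ₀ (ℕₚ.*-zeroʳ p)
  μ₀-prime-*-∣ {suc d} p∣d = trans (μ₀-prime-* (suc d)) (squarefreeSign-∷-∈ {ps = factors f}
    (factorisationHasAllPrimeFactors pr (subst (p ∣_) (PrimeFactorisation.isFactorisation f) p∣d) (PrimeFactorisation.factorsPrime f)))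
    where f = factorise (suc d)

  μ₀-prime-*-∤ : ∀ {d} → ¬ p ∣ d → μ₀ (p ℕ.* d) ≡ - μ₀ d
  μ₀-prime-*-∤ {zero}  _   = cong μ₀ (ℕₚ.*-zeroʳ p)
  μ₀-prime-*-∤ {suc d} p∤d = trans (μ₀-prime-* (suc d)) (squarefreeSign-∷-∉ {ps = factors f} λ p∈ →
    p∤d (subst (p ∣_) (sym (PrimeFactorisation.isFactorisation f)) (∈⇒∣product {ns = factors f} p∈)))
    where f = factorise (suc d)

  ∤⇒coprime : ∀ {d} → ¬ p ∣ d → Coprime d p
  ∤⇒coprime p∤d (i∣d , i∣p) with prime⇒irreducible pr i∣p
  ... | inj₁ i≡1 = i≡1
  ... | inj₂ refl = contradiction i∣d p∤d

∑-upTo-δ : ∀ {N x} → x < N → (f : ℕ → ℤ) → ∑ (upTo N) (λ d → ⟦ x ℕₚ.≟ d ⟧ * f d) ≡ f x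
∑-upTo-δ {N} x<N f = ∑-δ ℕₚ._≟_ (Uniqueₚ.upTo⁺ N) (∈ₚ.∈-upTo⁺ x<N) f

-- Substitution of `p * q` for `d`. Letting `q` run over the same range adds only values of `F`
-- beyond `N`, which vanish.
∑-multiples : ∀ p .{{_ : NonZero p}} N (F : ℕ → ℤ) → (∀ x → N < x → F x ≡ 0ℤ) →
  ∑ (upTo (suc N)) (λ d → ⟦ p ∣? d ⟧ * F d) ≡ ∑ (upTo (suc N)) (λ q → F (p ℕ.* q))
∑-multiples p N F F≡0 = begin
  ∑ U (λ d → ⟦ p ∣? d ⟧ * F d)
    ≡⟨ ∑-cong-∈ U (λ d d∈U → cofactor d (ℕ.s≤s⁻¹ (∈ₚ.∈-upTo⁻ d∈U))) ⟩
  ∑ U (λ d → ∑ U (λ q → ⟦ p ℕ.* q ℕₚ.≟ d ⟧ * F d))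
    ≡⟨ ∑-swap U U (λ d q → ⟦ p ℕ.* q ℕₚ.≟ d ⟧ * F d) ⟩
  ∑ U (λ q → ∑ U (λ d → ⟦ p ℕ.* q ℕₚ.≟ d ⟧ * F d))
    ≡⟨ ∑-cong U multiple ⟩
  ∑ U (λ q → F (p ℕ.* q))  ∎
  where
  open ≡-Reasoning
  U = upTo (suc N)
  cofactor : ∀ d → d ≤ N → ⟦ p ∣? d ⟧ * F d ≡ ∑ U (λ q → ⟦ p ℕ.* q ℕₚ.≟ d ⟧ * F d)
  cofactor d d≤N with p ∣? d
  ... | no p∤d = sym (∑-zero U (λ q _ →
          cong (_* F d) (⟦⟧-no (p ℕ.* q ℕₚ.≟ d) (λ eq → p∤d (divides q (trans (sym eq) (ℕₚ.*-comm p q)))))))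
  ... | yes (divides r eq) = begin
    1ℤ * F d                                      ≡⟨ ℤₚ.*-identityˡ (F d) ⟩
    F d                                           ≡⟨ ∑-upTo-δ (s≤s (ℕₚ.≤-trans r≤d d≤N)) (λ _ → F d) ⟨
    ∑ U (λ q → ⟦ r ℕₚ.≟ q ⟧ * F d)                ≡⟨ ∑-cong U (λ q → cong (_* F d) (⟦⟧-cong (r ℕₚ.≟ q) (p ℕ.* q ℕₚ.≟ d)
                                                      (λ r≡q → trans (cong (p ℕ.*_) (sym r≡q)) (trans (ℕₚ.*-comm p r) (sym eq)))
                                                      (λ eq′ → sym (ℕₚ.*-cancelˡ-≡ q r p (trans eq′ (trans eq (ℕₚ.*-comm r p))))))) ⟩
    ∑ U (λ q → ⟦ p ℕ.* q ℕₚ.≟ d ⟧ * F d)          ∎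
    where
    r≤d : r ≤ d
    r≤d = subst (r ≤_) (sym eq) (ℕₚ.m≤m*n r p)
  multiple : ∀ q → ∑ U (λ d → ⟦ p ℕ.* q ℕₚ.≟ d ⟧ * F d) ≡ F (p ℕ.* q)
  multiple q with p ℕ.* q ℕₚ.<? suc N
  ... | yes lt = ∑-upTo-δ lt F
  ... | no ¬lt = trans
    (∑-zero U (λ d d∈U → cong (_* F d) (⟦⟧-no (p ℕ.* q ℕₚ.≟ d) (λ eq → ¬lt (subst (_< suc N) (sym eq) (∈ₚ.∈-upTo⁻ d∈U))))))
    (sym (F≡0 (p ℕ.* q) (ℕₚ.≮⇒≥ ¬lt)))

-- The terms at multiples of `p` cancel the others: with `d = p * q`, the term at `p * q` is 0 if
-- `p` divides `q`, and otherwise the negative of the term at `q`, because then `q` divides `p * e′`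
-- only if it divides `e′`.
∑-μ₀-prime : ∀ {p} → Prime p → ∀ e′ .{{_ : NonZero (p ℕ.* e′)}} {N} → p ℕ.* e′ ≤ N →
  ∑ (upTo (suc N)) (λ d → ⟦ d ∣? (p ℕ.* e′) ⟧ * μ₀ d) ≡ 0ℤ
∑-μ₀-prime {p} pr e′ {N} e≤N = begin
  ∑ U T                                                               ≡⟨ ∑-cong U (λ d → ⟦⟧-split (p ∣? d) (T d)) ⟩
  ∑ U (λ d → ⟦ p ∣? d ⟧ * T d + ⟦ ¬? (p ∣? d) ⟧ * T d)                ≡⟨ ∑-+ U (λ d → ⟦ p ∣? d ⟧ * T d) (λ d → ⟦ ¬? (p ∣? d) ⟧ * T d) ⟩
  ∑ U (λ d → ⟦ p ∣? d ⟧ * T d) + ∑ U (λ d → ⟦ ¬? (p ∣? d) ⟧ * T d)    ≡⟨ cong (_+ S) (∑-multiples p N T T≡0) ⟩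
  ∑ U (λ q → T (p ℕ.* q)) + S                                         ≡⟨ cong (_+ S) (∑-cong U T-p*) ⟩
  ∑ U (λ q → -1ℤ * (⟦ ¬? (p ∣? q) ⟧ * T q)) + S                       ≡⟨ cong (_+ S) (∑-* U -1ℤ (λ q → ⟦ ¬? (p ∣? q) ⟧ * T q)) ⟨
  -1ℤ * S + S                                                         ≡⟨ cancel S ⟩
  0ℤ                                                                  ∎
  where
  open ≡-Reasoning
  instance _ = prime⇒nonZero pr
  e = p ℕ.* e′
  U = upTo (suc N)
  T : ℕ → ℤ
  T d = ⟦ d ∣? e ⟧ * μ₀ d
  S = ∑ U (λ d → ⟦ ¬? (p ∣? d) ⟧ * T d)
  cancel : ∀ s → -1ℤ * s + s ≡ 0ℤ
  cancel = solve-∀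
  T≡0 : ∀ x → N < x → T x ≡ 0ℤ
  T≡0 x N<x = cong (_* μ₀ x) (⟦⟧-no (x ∣? e) (λ x∣e → ℕₚ.<⇒≱ N<x (ℕₚ.≤-trans (∣⇒≤ x∣e) e≤N)))
  T-p* : ∀ q → T (p ℕ.* q) ≡ -1ℤ * (⟦ ¬? (p ∣? q) ⟧ * T q)
  T-p* q with p ∣? q
  ... | yes p∣q = trans (cong (⟦ p ℕ.* q ∣? e ⟧ *_) (μ₀-prime-*-∣ pr p∣q)) (ℤₚ.*-zeroʳ ⟦ p ℕ.* q ∣? e ⟧)
  ... | no  p∤q = trans (cong₂ _*_ (⟦⟧-cong (p ℕ.* q ∣? e) (q ∣? e) to from) (μ₀-prime-*-∤ pr p∤q)) (sign ⟦ q ∣? e ⟧ (μ₀ q))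
    where
    to : p ℕ.* q ∣ e → q ∣ e
    to = ∣ₚ.m*n∣⇒n∣ p q
    from : q ∣ e → p ℕ.* q ∣ e
    from q∣e = ∣ₚ.*-monoʳ-∣ p (coprime-divisor (∤⇒coprime pr p∤q) q∣e)
    sign : ∀ x y → x * - y ≡ -1ℤ * (1ℤ * (x * y))
    sign = solve-∀

-- The bound `N` is free so that the sum may run up to the length of the word, while `e` is only a
-- divisor of that length.
∑-μ₀ : ∀ e .{{_ : NonZero e}} {N} → e ≤ N → ∑ (upTo (suc N)) (λ d → ⟦ d ∣? e ⟧ * μ₀ d) ≡ ⟦ e ℕₚ.≟ 1 ⟧
∑-μ₀ e {N} e≤N with factorise e
... | record { factors = [] ; isFactorisation = refl } =
  trans (∑-cong (upTo (suc N)) (λ d → trans (cong (_* μ₀ d) (⟦⟧-cong (d ∣? 1) (1 ℕₚ.≟ d) (sym ∘ ∣ₚ.∣1⇒≡1) (∣ₚ.∣-reflexive ∘ sym))) refl))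
        (∑-upTo-δ (s≤s e≤N) μ₀)
... | record { factors = p ∷ ps ; isFactorisation = refl ; factorsPrime = pr ∷ _ } =
  trans (∑-μ₀-prime pr (product ps) e≤N)
        (sym (⟦⟧-no (p ℕ.* product ps ℕₚ.≟ 1) (λ eq → ¬prime[1] (subst Prime (ℕₚ.m*n≡1⇒m≡1 p (product ps) eq) pr))))

sumOverDivisors-∑ : ∀ n .{{_ : NonZero n}} (f : (d : ℕ) → .{{NonZero d}} → ℤ) →
  sumOverDivisors n f ≡ ∑ (upTo n) (λ k → ⟦ suc k ∣? n ⟧ * f (suc k))
sumOverDivisors-∑ n f = trans (∑-map (λ k → f (suc k)) (filter (λ k → suc k ∣? n) (upTo n)) id)
  (∑-filter (λ k → suc k ∣? n) (upTo n) (λ k → f (suc k)))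

-- Least periods and Möbius inversion

least : {P : ℕ → Set} → (∀ s → Dec (P s)) → ∀ {s} → P s → ∃ λ s₀ → P s₀ × (∀ {t} → t < s₀ → ¬ P t)
least {P} P? {s} = <-rec (λ s → P s → ∃ λ s₀ → P s₀ × (∀ {t} → t < s₀ → ¬ P t)) step s
  where
  step : ∀ s → (∀ {t} → t < s → P t → ∃ λ s₀ → P s₀ × (∀ {t} → t < s₀ → ¬ P t)) → P s → ∃ λ s₀ → P s₀ × (∀ {t} → t < s₀ → ¬ P t)
  step s rec p with ℕₚ.anyUpTo? P? s
  ... | yes (t , t<s , q) = rec t<s q
  ... | no none           = s , p , λ t<s q → none (_ , t<s , q)

-- The periods of w are the multiples of the least one, s₀, so w is a d-th power
-- exactly for the divisors d of n / s₀.
module _ {m R} (w : Fin (suc m) → Fin R) where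

  private
    n = suc m

  period-+ : ∀ {s t} → Period w s → Period w t → Period w (s ℕ.+ t)
  period-+ {s} {t} p q i = trans (cong w (sym (shift-+ s t i))) (trans (p (shift t i)) (q i))

  period-cancel : ∀ {s t} → Period w s → Period w (s ℕ.+ t) → Period w t
  period-cancel {s} {t} p q i = trans (sym (p (shift t i))) (trans (cong w (shift-+ s t i)) (q i))

  period-* : ∀ {s} k → Period w s → Period w (k ℕ.* s)
  period-* zero    p i = refl
  period-* {s} (suc k) p = period-+ {s} {k ℕ.* s} p (period-* {s} k p)

  private
    leastPeriod : ∃ λ s₀ → (0 < s₀ × Period w s₀) × (∀ {t} → t < s₀ → ¬ (0 < t × Period w t))
    -- The search ends because `n` itself is a period, a full turn.
    leastPeriod = least (λ s → (0 ℕₚ.<? s) ×-dec period? w s) {n} (s≤s z≤n , λ i → cong w (shift-full i))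

    s₀ = proj₁ leastPeriod
    s₀-period = proj₂ (proj₁ (proj₂ leastPeriod))
    instance
      s₀-nonZero : NonZero s₀
      s₀-nonZero = ℕ.>-nonZero (proj₁ (proj₁ (proj₂ leastPeriod)))

    -- The remainder of `s` modulo `s₀` is again a period and smaller than `s₀`, hence 0.
    period⇒∣ : ∀ {s} → Period w s → s₀ ∣ s
    period⇒∣ {s} p = ∣ₚ.m%n≡0⇒n∣m s s₀ (ℕₚ.n≤0⇒n≡0 (ℕₚ.≮⇒≥ λ lt → proj₂ (proj₂ leastPeriod) (m%n<n s s₀) (lt , per)))
      where
      per : Period w (s % s₀)
      per = period-cancel {s ℕ./ s₀ ℕ.* s₀} {s % s₀} (period-* {s₀} (s ℕ./ s₀) s₀-period)
        (subst (Period w) (trans (DivMod.m≡m%n+[m/n]*n s s₀) (ℕₚ.+-comm (s % s₀) (s ℕ./ s₀ ℕ.* s₀))) p)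

    ∣⇒period : ∀ {s} → s₀ ∣ s → Period w s
    ∣⇒period (divides k refl) = period-* {s₀} k s₀-period

    s₀∣n : s₀ ∣ n
    s₀∣n = period⇒∣ {n} (λ i → cong w (shift-full i))

    -- The exponent of `w`: the word is the e-th power of its prefix of length `s₀`.
    e = ∣ₚ.quotient s₀∣n
    n≡e*s₀ : n ≡ e ℕ.* s₀
    n≡e*s₀ = ∣ₚ.m∣n⇒n≡quotient*m s₀∣n

    primitive⇒e≡1 : Primitive w → e ≡ 1
    primitive⇒e≡1 prim with ℕₚ.m≤n⇒m<n∨m≡n (∣⇒≤ s₀∣n)
    ... | inj₂ s₀≡n = ℕₚ.*-cancelʳ-≡ e 1 s₀ (trans (sym n≡e*s₀) (trans (sym s₀≡n) (sym (ℕₚ.*-identityˡ s₀))))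
    ... | inj₁ s₀<n = ⊥-elim (prim (fromℕ< s₀<n) (ℕ.≢-nonZero⁻¹ s₀ ∘ trans (sym (toℕ-fromℕ< s₀<n)))
                        (subst (Period w) (sym (toℕ-fromℕ< s₀<n)) s₀-period))

    e≡1⇒primitive : e ≡ 1 → Primitive w
    e≡1⇒primitive e≡1 s s≢0 p = ℕₚ.<⇒≱ (toℕ<n s)
      (subst (_≤ toℕ s) (trans (sym (ℕₚ.*-identityˡ s₀)) (trans (cong (ℕ._* s₀) (sym e≡1)) (sym n≡e*s₀)))
        (∣⇒≤ {{ℕ.≢-nonZero s≢0}} (period⇒∣ {toℕ s} p)))

    ∣e⇒ : ∀ d .{{_ : NonZero d}} → d ∣ e → d ∣ n × Period w (n ℕ./ d)
    ∣e⇒ d (divides x eq) = divides (x ℕ.* s₀) n≡ , ∣⇒period {n ℕ./ d} (divides x (trans (cong (ℕ._/ d) n≡) (DivMod.m*n/n≡m (x ℕ.* s₀) d)))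
      where
      n≡ : n ≡ x ℕ.* s₀ ℕ.* d
      n≡ = trans n≡e*s₀ (trans (cong (ℕ._* s₀) eq) (trans (ℕₚ.*-assoc x d s₀)
             (trans (cong (x ℕ.*_) (ℕₚ.*-comm d s₀)) (sym (ℕₚ.*-assoc x s₀ d)))))

    ∣e⇐ : ∀ d .{{_ : NonZero d}} → d ∣ n → Period w (n ℕ./ d) → d ∣ e
    ∣e⇐ d d∣n p with period⇒∣ {n ℕ./ d} p
    ... | divides x eq = divides x (ℕₚ.*-cancelʳ-≡ e (x ℕ.* d) s₀ (begin
      e ℕ.* s₀           ≡⟨ n≡e*s₀ ⟨
      n                  ≡⟨ DivMod.m/n*n≡m d∣n ⟨
      n ℕ./ d ℕ.* d        ≡⟨ cong (ℕ._* d) eq ⟩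
      x ℕ.* s₀ ℕ.* d     ≡⟨ ℕₚ.*-assoc x s₀ d ⟩
      x ℕ.* (s₀ ℕ.* d)   ≡⟨ cong (x ℕ.*_) (ℕₚ.*-comm s₀ d) ⟩
      x ℕ.* (d ℕ.* s₀)   ≡⟨ ℕₚ.*-assoc x d s₀ ⟨
      x ℕ.* d ℕ.* s₀     ∎))
      where open ≡-Reasoning

  primitive-möbius : ⟦ primitive? w ⟧ ≡ sumOverDivisors n (λ d → μ d * ⟦ period? w (n ℕ./ d) ⟧)
  primitive-möbius = begin
    ⟦ primitive? w ⟧
      ≡⟨ ⟦⟧-cong (primitive? w) (e ℕₚ.≟ 1) primitive⇒e≡1 e≡1⇒primitive ⟩
    ⟦ e ℕₚ.≟ 1 ⟧
      ≡⟨ ∑-μ₀ e {{∣ₚ.quotient≢0 s₀∣n}} (∣⇒≤ (∣ₚ.quotient-∣ s₀∣n)) ⟨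
    ∑ (upTo (suc n)) (λ d → ⟦ d ∣? e ⟧ * μ₀ d)
      -- The term `d = 0` is split off; it vanishes since `μ₀ 0` is 0.
      ≡⟨ cong (λ xs → ∑ (0 ∷ xs) (λ d → ⟦ d ∣? e ⟧ * μ₀ d)) (sym (Listₚ.map-upTo suc n)) ⟩
    ⟦ 0 ∣? e ⟧ * 0ℤ + ∑ (map suc (upTo n)) (λ d → ⟦ d ∣? e ⟧ * μ₀ d)
      ≡⟨ cong₂ _+_ (ℤₚ.*-zeroʳ ⟦ 0 ∣? e ⟧) (∑-map suc (upTo n) (λ d → ⟦ d ∣? e ⟧ * μ₀ d)) ⟩
    0ℤ + ∑ (upTo n) (λ k → ⟦ suc k ∣? e ⟧ * μ (suc k))
      ≡⟨ ℤₚ.+-identityˡ _ ⟩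
    ∑ (upTo n) (λ k → ⟦ suc k ∣? e ⟧ * μ (suc k))
      ≡⟨ ∑-cong (upTo n) term ⟩
    ∑ (upTo n) (λ k → ⟦ suc k ∣? n ⟧ * (μ (suc k) * ⟦ period? w (n ℕ./ suc k) ⟧))
      ≡⟨ sumOverDivisors-∑ n (λ d → μ d * ⟦ period? w (n ℕ./ d) ⟧) ⟨
    sumOverDivisors n (λ d → μ d * ⟦ period? w (n ℕ./ d) ⟧)  ∎
    where
    open ≡-Reasoning
    reassoc : ∀ x y z → x * y * z ≡ x * (z * y)
    reassoc = solve-∀
    term : ∀ k → ⟦ suc k ∣? e ⟧ * μ (suc k) ≡ ⟦ suc k ∣? n ⟧ * (μ (suc k) * ⟦ period? w (n ℕ./ suc k) ⟧)
    term k = begin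
      ⟦ suc k ∣? e ⟧ * μ (suc k)
        ≡⟨ cong (_* μ (suc k)) (⟦⟧-cong (suc k ∣? e) ((suc k ∣? n) ×-dec period? w (n ℕ./ suc k))
             (∣e⇒ (suc k)) (λ { (d∣n , p) → ∣e⇐ (suc k) d∣n p })) ⟩
      ⟦ (suc k ∣? n) ×-dec period? w (n ℕ./ suc k) ⟧ * μ (suc k)
        ≡⟨ cong (_* μ (suc k)) (⟦⟧-× (suc k ∣? n) (period? w (n ℕ./ suc k))) ⟩
      ⟦ suc k ∣? n ⟧ * ⟦ period? w (n ℕ./ suc k) ⟧ * μ (suc k)
        ≡⟨ reassoc ⟦ suc k ∣? n ⟧ ⟦ period? w (n ℕ./ suc k) ⟧ (μ (suc k)) ⟩
      ⟦ suc k ∣? n ⟧ * (μ (suc k) * ⟦ period? w (n ℕ./ suc k) ⟧)  ∎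

-- Words of given content

HasContent : ∀ {R n} → Vec (Fin R) n → Vec ℕ R → Set
HasContent u v = ∀ b → # (λ i → lookup u i Finₚ.≟ b) ≡ lookup v b

hasContent? : ∀ {R n} (u : Vec (Fin R) n) (v : Vec ℕ R) → Dec (HasContent u v)
hasContent? u v = all? λ b → # (λ i → lookup u i Finₚ.≟ b) ℕₚ.≟ lookup v b

multinomial : ∀ {R} → Vec ℕ R → ℕ
multinomial []      = 1
multinomial (x ∷ v) = ((x ℕ.+ Vec.sum v) C x) ℕ.* multinomial v

decrement : ∀ {R} → Fin R → Vec ℕ R → Vec ℕ R
decrement b v = Vec.updateAt v b pred

sum-decrement : ∀ {R} (b : Fin R) (v : Vec ℕ R) → lookup v b ≢ 0 → suc (Vec.sum (decrement b v)) ≡ Vec.sum v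
sum-decrement zero    (zero  ∷ v) ≢0 = contradiction refl ≢0
sum-decrement zero    (suc x ∷ v) ≢0 = refl
sum-decrement (suc b) (x ∷ v)     ≢0 = trans (sym (ℕₚ.+-suc x _)) (cong (x ℕ.+_) (sum-decrement b v ≢0))

sum≡0⇒lookup≡0 : ∀ {R} (v : Vec ℕ R) → Vec.sum v ≡ 0 → ∀ b → lookup v b ≡ 0
sum≡0⇒lookup≡0 (x ∷ v) eq zero    = ℕₚ.m+n≡0⇒m≡0 x eq
sum≡0⇒lookup≡0 (x ∷ v) eq (suc b) = sum≡0⇒lookup≡0 v (ℕₚ.m+n≡0⇒n≡0 x eq) b

lookup≡0⇒sum≡0 : ∀ {R} (v : Vec ℕ R) → (∀ b → lookup v b ≡ 0) → Vec.sum v ≡ 0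
lookup≡0⇒sum≡0 []      eq = refl
lookup≡0⇒sum≡0 (x ∷ v) eq = cong₂ ℕ._+_ (eq zero) (lookup≡0⇒sum≡0 v (eq ∘ suc))

nC0≡1 : ∀ n → n C 0 ≡ 1
nC0≡1 n = refl

multinomial-zero : ∀ {R} (v : Vec ℕ R) → Vec.sum v ≡ 0 → multinomial v ≡ 1
multinomial-zero []      eq = refl
multinomial-zero (x ∷ v) eq with ℕₚ.m+n≡0⇒m≡0 x eq
... | refl = trans (cong (ℕ._* multinomial v) (nC0≡1 (Vec.sum v))) (trans (ℕₚ.*-identityˡ (multinomial v)) (multinomial-zero v eq))

nonzero? : ∀ x → Dec (x ≢ 0)
nonzero? x = ¬? (x ℕₚ.≟ 0)

-- Pascal's rule times `M`. The indicators switch off the summands in which `pred` would truncate at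
-- 0.
pascal : ∀ x s M →
  ⟦ nonzero? x ⟧ * + (((pred x ℕ.+ s) C pred x) ℕ.* M) + + ((x ℕ.+ pred s) C x) * (⟦ nonzero? s ⟧ * + M) ≡
  ⟦ nonzero? (x ℕ.+ s) ⟧ * + (((x ℕ.+ s) C x) ℕ.* M)
pascal zero    zero    M = refl
pascal zero    (suc s) M = begin
  0ℤ + + (s C 0) * (1ℤ * + M)       ≡⟨ ℤₚ.+-identityˡ _ ⟩
  + (s C 0) * (1ℤ * + M)            ≡⟨ cong₂ (λ a b → + a * b) (nC0≡1 s) (ℤₚ.*-identityˡ (+ M)) ⟩
  1ℤ * + M                          ≡⟨ cong (λ a → 1ℤ * + a) (ℕₚ.*-identityˡ M) ⟨
  1ℤ * + (1 ℕ.* M)                  ≡⟨ cong (λ a → 1ℤ * + (a ℕ.* M)) (nC0≡1 (suc s)) ⟨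
  1ℤ * + ((suc s C 0) ℕ.* M)          ∎
  where open ≡-Reasoning
pascal (suc x) zero    M = begin
  1ℤ * + (((x ℕ.+ 0) C x) ℕ.* M) + + ((suc x ℕ.+ 0) C suc x) * 0ℤ
    ≡⟨ cong₂ (λ a b → 1ℤ * + (a ℕ.* M) + b) (diag x) (ℤₚ.*-zeroʳ (+ ((suc x ℕ.+ 0) C suc x))) ⟩
  1ℤ * + (1 ℕ.* M) + 0ℤ                  ≡⟨ ℤₚ.+-identityʳ _ ⟩
  1ℤ * + (1 ℕ.* M)                       ≡⟨ cong (λ a → 1ℤ * + (a ℕ.* M)) (diag (suc x)) ⟨
  1ℤ * + (((suc x ℕ.+ 0) C suc x) ℕ.* M)   ∎
  where
  open ≡-Reasoning
  diag : ∀ x → (x ℕ.+ 0) C x ≡ 1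
  diag x = trans (cong (_C x) (ℕₚ.+-identityʳ x)) (nCn≡1 x)
pascal (suc x) (suc s) M = begin
  1ℤ * + (a ℕ.* M) + + ((suc x ℕ.+ s) C suc x) * (1ℤ * + M)
    ≡⟨ cong₂ (λ a b → 1ℤ * a + + b * (1ℤ * + M)) (ℤₚ.pos-* a M) (cong (_C suc x) (sym (ℕₚ.+-suc x s))) ⟩
  1ℤ * (+ a * + M) + + b * (1ℤ * + M)
    ≡⟨ distrib (+ a) (+ b) (+ M) ⟩
  1ℤ * (+ (a ℕ.+ b) * + M)
    ≡⟨ cong (1ℤ *_) (ℤₚ.pos-* (a ℕ.+ b) M) ⟨
  1ℤ * + ((a ℕ.+ b) ℕ.* M)
    ≡⟨ cong (λ c → 1ℤ * + (c ℕ.* M)) (nCk+nC[k+1]≡[n+1]C[k+1] (x ℕ.+ suc s) x) ⟩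
  1ℤ * + (((suc x ℕ.+ suc s) C suc x) ℕ.* M)  ∎
  where
  open ≡-Reasoning
  a = (x ℕ.+ suc s) C x
  b = (x ℕ.+ suc s) C suc x
  distrib : ∀ a b M → 1ℤ * (a * M) + b * (1ℤ * M) ≡ 1ℤ * ((a + b) * M)
  distrib = solve-∀

-- Pascal's rule for multinomial coefficients. The summands beyond the first share the binomial
-- factor `c`, since each lowers the sum of `v` by one; what remains of them is the same sum for
-- `v`.
multinomial-step : ∀ {R} (v : Vec ℕ R) →
  ∑ (allFin R) (λ b → ⟦ nonzero? (lookup v b) ⟧ * + multinomial (decrement b v)) ≡ ⟦ nonzero? (Vec.sum v) ⟧ * + multinomial v
multinomial-step []            = refl
multinomial-step {suc R} (x ∷ v) = begin
  ∑ (allFin (suc R)) (λ b → ⟦ nonzero? (lookup (x ∷ v) b) ⟧ * + multinomial (decrement b (x ∷ v)))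
    ≡⟨ ∑-allFin-suc R (λ b → ⟦ nonzero? (lookup (x ∷ v) b) ⟧ * + multinomial (decrement b (x ∷ v))) ⟩
  head + ∑ (allFin R) (λ b → ⟦ nonzero? (lookup v b) ⟧ * + (((x ℕ.+ Vec.sum (decrement b v)) C x) ℕ.* multinomial (decrement b v)))
    ≡⟨ cong (λ y → head + y) (∑-cong (allFin R) λ b → begin
         ⟦ nonzero? (lookup v b) ⟧ * + (((x ℕ.+ Vec.sum (decrement b v)) C x) ℕ.* multinomial (decrement b v))
           ≡⟨ ⟦⟧-*-cong (nonzero? (lookup v b)) (λ ≢0 → trans
                (cong (λ s → + (((x ℕ.+ s) C x) ℕ.* multinomial (decrement b v))) (cong pred (sum-decrement b v ≢0)))
                (ℤₚ.pos-* c (multinomial (decrement b v)))) ⟩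
         ⟦ nonzero? (lookup v b) ⟧ * (+ c * + multinomial (decrement b v))
           ≡⟨ swap ⟦ nonzero? (lookup v b) ⟧ (+ c) (+ multinomial (decrement b v)) ⟩
         + c * (⟦ nonzero? (lookup v b) ⟧ * + multinomial (decrement b v))  ∎) ⟩
  head + ∑ (allFin R) (λ b → + c * (⟦ nonzero? (lookup v b) ⟧ * + multinomial (decrement b v)))
    ≡⟨ cong (λ y → head + y) (∑-* (allFin R) (+ c) (λ b → ⟦ nonzero? (lookup v b) ⟧ * + multinomial (decrement b v))) ⟨
  head + + c * ∑ (allFin R) (λ b → ⟦ nonzero? (lookup v b) ⟧ * + multinomial (decrement b v))
    ≡⟨ cong (λ y → head + + c * y) (multinomial-step v) ⟩
  head + + c * (⟦ nonzero? (Vec.sum v) ⟧ * + multinomial v)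
    ≡⟨ pascal x (Vec.sum v) (multinomial v) ⟩
  ⟦ nonzero? (x ℕ.+ Vec.sum v) ⟧ * + (((x ℕ.+ Vec.sum v) C x) ℕ.* multinomial v)  ∎
  where
  open ≡-Reasoning
  c = (x ℕ.+ pred (Vec.sum v)) C x
  head = ⟦ nonzero? x ⟧ * + (((pred x ℕ.+ Vec.sum v) C pred x) ℕ.* multinomial v)
  swap : ∀ a b c → a * (b * c) ≡ b * (a * c)
  swap = solve-∀

hasContent-∷ : ∀ {R n} b (u : Vec (Fin R) n) v → HasContent (b ∷ u) v → lookup v b ≢ 0 × HasContent u (decrement b v)
hasContent-∷ b u v h = nz , tail
  where
  nz : lookup v b ≢ 0
  nz eq with b Finₚ.≟ b | h b
  ... | yes _ | h = ℕₚ.1+n≢0 (trans h eq)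
  ... | no ¬p | _ = ¬p refl
  tail : HasContent u (decrement b v)
  tail b′ with b Finₚ.≟ b′ | h b′
  ... | yes refl | h = trans (cong pred h) (sym (Vecₚ.lookup∘updateAt b v))
  ... | no b≢b′  | h = trans h (sym (Vecₚ.lookup∘updateAt′ b′ b (b≢b′ ∘ sym) v))

hasContent-∷⁻ : ∀ {R n} b (u : Vec (Fin R) n) v → lookup v b ≢ 0 → HasContent u (decrement b v) → HasContent (b ∷ u) v
hasContent-∷⁻ b u v nz h b′ with b Finₚ.≟ b′ | h b′
... | yes refl | h = trans (cong suc (trans h (Vecₚ.lookup∘updateAt b v))) (ℕₚ.suc-pred (lookup v b) {{ℕ.≢-nonZero nz}})
... | no b≢b′  | h = trans h (Vecₚ.lookup∘updateAt′ b′ b (b≢b′ ∘ sym) v)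

-- Splitting off the first letter `b` leaves a word whose content is decremented at `b`, which is
-- the recursion of `multinomial-step`.
words-of-content : ∀ {R} n (v : Vec ℕ R) →
  ∑ (words R n) (λ u → ⟦ hasContent? u v ⟧) ≡ ⟦ Vec.sum v ℕₚ.≟ n ⟧ * + multinomial v
words-of-content {R} zero v = begin
  ⟦ hasContent? [] v ⟧ + 0ℤ                  ≡⟨ ℤₚ.+-identityʳ _ ⟩
  ⟦ hasContent? [] v ⟧                       ≡⟨ ⟦⟧-cong (hasContent? [] v) (Vec.sum v ℕₚ.≟ 0)
                                                 (λ h → lookup≡0⇒sum≡0 v (sym ∘ h)) (λ eq → sym ∘ sum≡0⇒lookup≡0 v eq) ⟩
  ⟦ Vec.sum v ℕₚ.≟ 0 ⟧                       ≡⟨ ℤₚ.*-identityʳ _ ⟨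
  ⟦ Vec.sum v ℕₚ.≟ 0 ⟧ * 1ℤ                  ≡⟨ ⟦⟧-*-cong (Vec.sum v ℕₚ.≟ 0) (λ eq → cong +_ (sym (multinomial-zero v eq))) ⟩
  ⟦ Vec.sum v ℕₚ.≟ 0 ⟧ * + multinomial v     ∎
  where open ≡-Reasoning
words-of-content {R} (suc n) v = begin
  ∑ (words R (suc n)) (λ u → ⟦ hasContent? u v ⟧)
    ≡⟨ ∑-cartesianProductWith _∷_ (allFin R) (words R n) (λ u → ⟦ hasContent? u v ⟧) ⟩
  ∑ (allFin R) (λ b → ∑ (words R n) (λ u → ⟦ hasContent? (b ∷ u) v ⟧))
    ≡⟨ ∑-cong (allFin R) (λ b → begin
         ∑ (words R n) (λ u → ⟦ hasContent? (b ∷ u) v ⟧)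
           ≡⟨ ∑-cong (words R n) (λ u → trans
                (⟦⟧-cong (hasContent? (b ∷ u) v) (nonzero? (lookup v b) ×-dec hasContent? u (decrement b v))
                  (hasContent-∷ b u v) (λ { (nz , h) → hasContent-∷⁻ b u v nz h }))
                (⟦⟧-× (nonzero? (lookup v b)) (hasContent? u (decrement b v)))) ⟩
         ∑ (words R n) (λ u → ⟦ nonzero? (lookup v b) ⟧ * ⟦ hasContent? u (decrement b v) ⟧)
           ≡⟨ ∑-* (words R n) ⟦ nonzero? (lookup v b) ⟧ (λ u → ⟦ hasContent? u (decrement b v) ⟧) ⟨
         ⟦ nonzero? (lookup v b) ⟧ * ∑ (words R n) (λ u → ⟦ hasContent? u (decrement b v) ⟧)
           ≡⟨ cong (⟦ nonzero? (lookup v b) ⟧ *_) (words-of-content n (decrement b v)) ⟩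
         ⟦ nonzero? (lookup v b) ⟧ * (⟦ Vec.sum (decrement b v) ℕₚ.≟ n ⟧ * + multinomial (decrement b v))
           ≡⟨ ⟦⟧-*-cong (nonzero? (lookup v b)) (λ nz → cong (_* + multinomial (decrement b v))
                (⟦⟧-cong (Vec.sum (decrement b v) ℕₚ.≟ n) (Vec.sum v ℕₚ.≟ suc n)
                  (λ eq → trans (sym (sum-decrement b v nz)) (cong suc eq))
                  (λ eq → ℕₚ.suc-injective (trans (sum-decrement b v nz) eq)))) ⟩
         ⟦ nonzero? (lookup v b) ⟧ * (⟦ Vec.sum v ℕₚ.≟ suc n ⟧ * + multinomial (decrement b v))
           ≡⟨ swap ⟦ nonzero? (lookup v b) ⟧ ⟦ Vec.sum v ℕₚ.≟ suc n ⟧ (+ multinomial (decrement b v)) ⟩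
         ⟦ Vec.sum v ℕₚ.≟ suc n ⟧ * (⟦ nonzero? (lookup v b) ⟧ * + multinomial (decrement b v))  ∎) ⟩
  ∑ (allFin R) (λ b → ⟦ Vec.sum v ℕₚ.≟ suc n ⟧ * (⟦ nonzero? (lookup v b) ⟧ * + multinomial (decrement b v)))
    ≡⟨ ∑-* (allFin R) ⟦ Vec.sum v ℕₚ.≟ suc n ⟧ (λ b → ⟦ nonzero? (lookup v b) ⟧ * + multinomial (decrement b v)) ⟨
  ⟦ Vec.sum v ℕₚ.≟ suc n ⟧ * ∑ (allFin R) (λ b → ⟦ nonzero? (lookup v b) ⟧ * + multinomial (decrement b v))
    ≡⟨ cong (⟦ Vec.sum v ℕₚ.≟ suc n ⟧ *_) (multinomial-step v) ⟩
  ⟦ Vec.sum v ℕₚ.≟ suc n ⟧ * (⟦ nonzero? (Vec.sum v) ⟧ * + multinomial v)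
    ≡⟨ ⟦⟧-*-cong (Vec.sum v ℕₚ.≟ suc n) (λ eq → trans
         (cong (_* + multinomial v) (⟦⟧-yes (nonzero? (Vec.sum v)) (λ eq₀ → ℕₚ.1+n≢0 (trans (sym eq) eq₀))))
         (ℤₚ.*-identityˡ (+ multinomial v))) ⟩
  ⟦ Vec.sum v ℕₚ.≟ suc n ⟧ * + multinomial v  ∎
  where
  open ≡-Reasoning
  swap : ∀ a b c → a * (b * c) ≡ b * (a * c)
  swap = solve-∀

-- The number of d-th powers of words whose content is v.
powerMultinomial : ∀ {R} d .{{_ : NonZero d}} → Vec ℕ R → ℤ
powerMultinomial d []      = 1ℤ
powerMultinomial d (x ∷ v) = ⟦ d ∣? x ⟧ * (+ (((x ℕ.+ Vec.sum v) ℕ./ d) C (x ℕ./ d)) * powerMultinomial d v)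

module _ (d : ℕ) .{{_ : NonZero d}} where

  sum-/ : ∀ {R} (v : Vec ℕ R) → (∀ b → d ∣ lookup v b) → Vec.sum v ≡ Vec.sum (Vec.map (ℕ._/ d) v) ℕ.* d
  sum-/ []      h = refl
  sum-/ (x ∷ v) h = trans (cong₂ ℕ._+_ (sym (DivMod.m/n*n≡m (h zero))) (sum-/ v (h ∘ suc)))
                          (sym (ℕₚ.*-distribʳ-+ d (x ℕ./ d) (Vec.sum (Vec.map (ℕ._/ d) v))))

  powerMultinomial-∣ : ∀ {R} (v : Vec ℕ R) → (∀ b → d ∣ lookup v b) → powerMultinomial d v ≡ + multinomial (Vec.map (ℕ._/ d) v)
  powerMultinomial-∣ []      h = refl
  powerMultinomial-∣ (x ∷ v) h = begin
    ⟦ d ∣? x ⟧ * (+ (((x ℕ.+ Vec.sum v) ℕ./ d) C (x ℕ./ d)) * powerMultinomial d v)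
      ≡⟨ trans (cong (_* (+ (((x ℕ.+ Vec.sum v) ℕ./ d) C (x ℕ./ d)) * powerMultinomial d v)) (⟦⟧-yes (d ∣? x) (h zero)))
               (ℤₚ.*-identityˡ _) ⟩
    + (((x ℕ.+ Vec.sum v) ℕ./ d) C (x ℕ./ d)) * powerMultinomial d v
      ≡⟨ cong₂ (λ a b → + (a C (x ℕ./ d)) * b) total (powerMultinomial-∣ v (h ∘ suc)) ⟩
    + ((x ℕ./ d ℕ.+ Vec.sum (Vec.map (ℕ._/ d) v)) C (x ℕ./ d)) * + multinomial (Vec.map (ℕ._/ d) v)
      ≡⟨ ℤₚ.pos-* ((x ℕ./ d ℕ.+ Vec.sum (Vec.map (ℕ._/ d) v)) C (x ℕ./ d)) (multinomial (Vec.map (ℕ._/ d) v)) ⟨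
    + multinomial (Vec.map (ℕ._/ d) (x ∷ v))  ∎
    where
    open ≡-Reasoning
    total : (x ℕ.+ Vec.sum v) ℕ./ d ≡ x ℕ./ d ℕ.+ Vec.sum (Vec.map (ℕ._/ d) v)
    total = trans (DivMod.+-distrib-/-∣ˡ (Vec.sum v) (h zero))
      (cong (x ℕ./ d ℕ.+_) (trans (cong (ℕ._/ d) (sum-/ v (h ∘ suc))) (DivMod.m*n/n≡m (Vec.sum (Vec.map (ℕ._/ d) v)) d)))

  powerMultinomial-∤ : ∀ {R} (v : Vec ℕ R) b → ¬ d ∣ lookup v b → powerMultinomial d v ≡ 0ℤ
  powerMultinomial-∤ (x ∷ v) zero    ∤ = cong (_* (+ (((x ℕ.+ Vec.sum v) ℕ./ d) C (x ℕ./ d)) * powerMultinomial d v)) (⟦⟧-no (d ∣? x) ∤)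
  powerMultinomial-∤ (x ∷ v) (suc b) ∤ =
    trans (cong (λ y → ⟦ d ∣? x ⟧ * (+ c * y)) (powerMultinomial-∤ v b ∤))
    (trans (cong (⟦ d ∣? x ⟧ *_) (ℤₚ.*-zeroʳ (+ c))) (ℤₚ.*-zeroʳ ⟦ d ∣? x ⟧))
    where c = ((x ℕ.+ Vec.sum v) ℕ./ d) C (x ℕ./ d)

  -- The content of a root is multiplied by `d` instead of dividing `v`, so the condition is
  -- meaningful, and unsatisfiable, when some entry is not divisible.
  HasScaledContent : ∀ {R n} → Vec (Fin R) n → Vec ℕ R → Set
  HasScaledContent u v = ∀ b → d ℕ.* # (λ i → lookup u i Finₚ.≟ b) ≡ lookup v b

  hasScaledContent? : ∀ {R n} (u : Vec (Fin R) n) (v : Vec ℕ R) → Dec (HasScaledContent u v)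
  hasScaledContent? u v = all? λ b → d ℕ.* # (λ i → lookup u i Finₚ.≟ b) ℕₚ.≟ lookup v b

  words-of-scaledContent : ∀ {R} q (v : Vec ℕ R) → Vec.sum v ≡ q ℕ.* d →
    ∑ (words R q) (λ u → ⟦ hasScaledContent? u v ⟧) ≡ powerMultinomial d v
  words-of-scaledContent {R} q v sum≡ with all? (λ b → d ∣? lookup v b)
  ... | no ¬h = trans
    (∑-zero (words R q) (λ u _ → ⟦⟧-no (hasScaledContent? u v) (λ h →
      ∤ (divides (# (λ i → lookup u i Finₚ.≟ b)) (trans (sym (h b)) (ℕₚ.*-comm d (# (λ i → lookup u i Finₚ.≟ b))))))))
    (sym (powerMultinomial-∤ v b ∤))
    where
    ex = Finₚ.¬∀⟶∃¬ R (λ b → d ∣ lookup v b) (λ b → d ∣? lookup v b) ¬h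
    b = proj₁ ex
    ∤ = proj₂ ex
  ... | yes h = begin
    ∑ (words R q) (λ u → ⟦ hasScaledContent? u v ⟧)       ≡⟨ ∑-cong (words R q) (λ u → ⟦⟧-cong (hasScaledContent? u v) (hasContent? u ν)
                                                              (λ h b → ℕₚ.*-cancelˡ-≡ _ _ d (trans (h b) (v≡ b))) (λ h b → trans (cong (d ℕ.*_) (h b)) (sym (v≡ b)))) ⟩
    ∑ (words R q) (λ u → ⟦ hasContent? u ν ⟧)             ≡⟨ words-of-content q ν ⟩
    ⟦ Vec.sum ν ℕₚ.≟ q ⟧ * + multinomial ν                ≡⟨ cong (_* + multinomial ν) (⟦⟧-yes (Vec.sum ν ℕₚ.≟ q)
                                                              (ℕₚ.*-cancelʳ-≡ _ _ d (trans (sym (sum-/ v h)) sum≡))) ⟩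
    1ℤ * + multinomial ν                                  ≡⟨ ℤₚ.*-identityˡ _ ⟩
    + multinomial ν                                       ≡⟨ powerMultinomial-∣ v h ⟨
    powerMultinomial d v                                  ∎
    where
    open ≡-Reasoning
    ν = Vec.map (ℕ._/ d) v
    v≡ : ∀ b → lookup v b ≡ d ℕ.* lookup ν b
    v≡ b = trans (sym (DivMod.m*[n/m]≡n (h b))) (cong (d ℕ.*_) (sym (Vecₚ.lookup-map b (ℕ._/ d) v)))

#-+ : ∀ a {b} {P : ℕ → Set} (P? : ∀ t → Dec (P t)) →
      # {a ℕ.+ b} (λ i → P? (toℕ i)) ≡ # {a} (λ i → P? (toℕ i)) ℕ.+ # {b} (λ i → P? (a ℕ.+ toℕ i))
#-+ zero    P? = refl
#-+ (suc a) P? = trans (cong (bit (P? 0) ℕ.+_) (#-+ a (P? ∘ suc))) (sym (ℕₚ.+-assoc (bit (P? 0)) _ _))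

#-periodic : ∀ d {q} {P : ℕ → Set} (P? : ∀ t → Dec (P t)) → (∀ t → P (q ℕ.+ t) → P t) → (∀ t → P t → P (q ℕ.+ t)) →
             # {d ℕ.* q} (λ i → P? (toℕ i)) ≡ d ℕ.* # {q} (λ i → P? (toℕ i))
#-periodic zero        P? f g = refl
#-periodic (suc d) {q} P? f g = trans (#-+ q P?) (cong (# {q} (λ i → P? (toℕ i)) ℕ.+_)
  (trans (#-cong {d ℕ.* q} (λ i → P? (q ℕ.+ toℕ i)) (λ i → P? (toℕ i)) (λ i → f (toℕ i)) (λ i → g (toℕ i))) (#-periodic d P? f g)))

-- Powers of words

-- A word of length `d * suc q` with period `suc q` is the d-th power of its prefix of length
-- `suc q`, and each letter occurs `d` times as often in the power as in the prefix.
periodic-words : ∀ {m R} d .{{_ : NonZero d}} q → suc m ≡ d ℕ.* suc q → (v : Vec ℕ R) →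
  ∑ (words R (suc m)) (λ w → ⟦ hasContent? w v ×-dec period? (lookup w) (suc q) ⟧) ≡
  ∑ (words R (suc q)) (λ u → ⟦ hasScaledContent? d u v ⟧)
periodic-words {m} {R} d q n≡ v = ∑-bij (wordEnum R n) (wordEnum R Q)
  (λ w → hasContent? w v ×-dec period? (lookup w) Q) (λ u → hasScaledContent? d u v)
  root power
  (λ { {w} (h , p) b → trans (sym (#-power (root w) b))
         (trans (cong (λ w → # (λ i → lookup w i Finₚ.≟ b)) (power-root w p)) (h b)) })
  (λ {u} h → (λ b → trans (#-power u b) (h b)) , power-period u)
  (λ { {w} (h , p) → power-root w p })
  (λ {u} _ → root-power u)
  where
  n = suc m
  Q = suc q
  -- In `root`, `mod n` is a mere coercion because `Q ≤ n`; in `power`, `mod Q` really wraps around.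
  root : Vec (Fin R) n → Vec (Fin R) Q
  root w = tabulate (λ j → lookup w (toℕ j mod n))
  power : Vec (Fin R) Q → Vec (Fin R) n
  power u = tabulate (λ i → lookup u (toℕ i mod Q))
  Q≤n : Q ≤ n
  Q≤n = subst (Q ≤_) (sym n≡) (ℕₚ.m≤n*m Q d)
  Q∣n : Q ∣ n
  Q∣n = divides d n≡
  open ≡-Reasoning
  -- Position `i` is its residue modulo `Q`, moved on by a multiple of the period `Q`.
  power-root : ∀ w → Period (lookup w) Q → power (root w) ≡ w
  power-root w p = trans (Vecₚ.tabulate-cong λ i → begin
    lookup (root w) (toℕ i mod Q)       ≡⟨ Vecₚ.lookup∘tabulate (λ j → lookup w (toℕ j mod n)) (toℕ i mod Q) ⟩
    lookup w (toℕ (toℕ i mod Q) mod n)  ≡⟨ period-* (lookup w) {Q} (toℕ i ℕ./ Q) p (toℕ (toℕ i mod Q) mod n) ⟨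
    lookup w (shift (toℕ i ℕ./ Q ℕ.* Q) (toℕ (toℕ i mod Q) mod n))
      ≡⟨ cong (lookup w) (shift-unique (toℕ i ℕ./ Q ℕ.* Q) (toℕ (toℕ i mod Q) mod n) i (begin
           (toℕ i ℕ./ Q ℕ.* Q ℕ.+ toℕ (toℕ (toℕ i mod Q) mod n)) % n
             ≡⟨ cong (λ x → (toℕ i ℕ./ Q ℕ.* Q ℕ.+ x) % n) (trans (toℕ-mod (toℕ (toℕ i mod Q)) m)
                  (m<n⇒m%n≡m (ℕₚ.<-≤-trans (toℕ<n (toℕ i mod Q)) Q≤n))) ⟩
           (toℕ i ℕ./ Q ℕ.* Q ℕ.+ toℕ (toℕ i mod Q)) % n
             ≡⟨ cong (λ x → (toℕ i ℕ./ Q ℕ.* Q ℕ.+ x) % n) (toℕ-mod (toℕ i) q) ⟩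
           (toℕ i ℕ./ Q ℕ.* Q ℕ.+ toℕ i % Q) % n
             ≡⟨ cong (_% n) (trans (ℕₚ.+-comm (toℕ i ℕ./ Q ℕ.* Q) (toℕ i % Q)) (sym (DivMod.m≡m%n+[m/n]*n (toℕ i) Q))) ⟩
           toℕ i % n
             ≡⟨ m<n⇒m%n≡m (toℕ<n i) ⟩
           toℕ i  ∎)) ⟩
    lookup w i  ∎) (Vecₚ.tabulate∘lookup w)
  root-power : ∀ u → root (power u) ≡ u
  root-power u = trans (Vecₚ.tabulate-cong λ j → begin
    lookup (power u) (toℕ j mod n)       ≡⟨ Vecₚ.lookup∘tabulate (λ i → lookup u (toℕ i mod Q)) (toℕ j mod n) ⟩
    lookup u (toℕ (toℕ j mod n) mod Q)   ≡⟨ cong (lookup u) (toℕ-injective (begin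
         toℕ (toℕ (toℕ j mod n) mod Q)    ≡⟨ toℕ-mod (toℕ (toℕ j mod n)) q ⟩
         toℕ (toℕ j mod n) % Q            ≡⟨ cong (_% Q) (trans (toℕ-mod (toℕ j) m) (m<n⇒m%n≡m (ℕₚ.<-≤-trans (toℕ<n j) Q≤n))) ⟩
         toℕ j % Q                        ≡⟨ m<n⇒m%n≡m (toℕ<n j) ⟩
         toℕ j                            ∎)) ⟩
    lookup u j  ∎) (Vecₚ.tabulate∘lookup u)
  power-period : ∀ u → Period (lookup (power u)) Q
  power-period u i = begin
    lookup (power u) (shift Q i)         ≡⟨ Vecₚ.lookup∘tabulate (λ i → lookup u (toℕ i mod Q)) (shift Q i) ⟩
    lookup u (toℕ (shift Q i) mod Q)     ≡⟨ cong (lookup u) (toℕ-injective (begin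
         toℕ (toℕ (shift Q i) mod Q)      ≡⟨ toℕ-mod (toℕ (shift Q i)) q ⟩
         toℕ (shift Q i) % Q              ≡⟨ cong (_% Q) (toℕ-shift Q i) ⟩
         (Q ℕ.+ toℕ i) % n % Q            ≡⟨ DivMod.m∣n⇒o%n%m≡o%m Q n (Q ℕ.+ toℕ i) Q∣n ⟩
         (Q ℕ.+ toℕ i) % Q                ≡⟨ cong (_% Q) (ℕₚ.+-comm Q (toℕ i)) ⟩
         (toℕ i ℕ.+ Q) % Q                ≡⟨ [m+n]%n≡m%n (toℕ i) Q ⟩
         toℕ i % Q                        ≡⟨ toℕ-mod (toℕ i) q ⟨
         toℕ (toℕ i mod Q)                ∎)) ⟩
    lookup u (toℕ i mod Q)               ≡⟨ Vecₚ.lookup∘tabulate (λ i → lookup u (toℕ i mod Q)) i ⟨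
    lookup (power u) i                   ∎
  mod-+ : ∀ t → (Q ℕ.+ t) mod Q ≡ t mod Q
  mod-+ t = toℕ-injective (trans (toℕ-mod (Q ℕ.+ t) q)
    (trans (cong (_% Q) (ℕₚ.+-comm Q t)) (trans ([m+n]%n≡m%n t Q) (sym (toℕ-mod t q)))))
  mod-toℕ : ∀ (j : Fin Q) → toℕ j mod Q ≡ j
  mod-toℕ j = toℕ-injective (trans (toℕ-mod (toℕ j) q) (m<n⇒m%n≡m (toℕ<n j)))
  #-power : ∀ u b → # (λ i → lookup (power u) i Finₚ.≟ b) ≡ d ℕ.* # (λ j → lookup u j Finₚ.≟ b)
  #-power u b = begin
    # (λ i → lookup (power u) i Finₚ.≟ b)
      ≡⟨ #-cong (λ i → lookup (power u) i Finₚ.≟ b) (λ i → P? (toℕ i))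
           (λ i → trans (sym (Vecₚ.lookup∘tabulate (λ i → lookup u (toℕ i mod Q)) i)))
           (λ i → trans (Vecₚ.lookup∘tabulate (λ i → lookup u (toℕ i mod Q)) i)) ⟩
    # {n} (λ i → P? (toℕ i))
      ≡⟨ cong (λ n → # {n} (λ i → P? (toℕ i))) n≡ ⟩
    # {d ℕ.* Q} (λ i → P? (toℕ i))
      ≡⟨ #-periodic d P? (λ t → trans (cong (lookup u) (sym (mod-+ t)))) (λ t → trans (cong (lookup u) (mod-+ t))) ⟩
    d ℕ.* # {Q} (λ j → P? (toℕ j))
      ≡⟨ cong (d ℕ.*_) (#-cong (λ j → P? (toℕ j)) (λ j → lookup u j Finₚ.≟ b)
           (λ j → trans (cong (lookup u) (sym (mod-toℕ j)))) (λ j → trans (cong (lookup u) (mod-toℕ j)))) ⟩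
    d ℕ.* # (λ j → lookup u j Finₚ.≟ b)  ∎
    where
    P? : ∀ t → Dec (lookup u (t mod Q) ≡ b)
    P? t = lookup u (t mod Q) Finₚ.≟ b

periodic-words-of-content : ∀ {m R} d .{{_ : NonZero d}} → d ∣ suc m → (v : Vec ℕ R) → Vec.sum v ≡ suc m →
  ∑ (words R (suc m)) (λ w → ⟦ hasContent? w v ×-dec period? (lookup w) (suc m ℕ./ d) ⟧) ≡ powerMultinomial d v
periodic-words-of-content {m} d d∣n v sum≡ with suc m ℕ./ d | DivMod.m/n*n≡m d∣n
... | suc q | n≡ = trans (periodic-words d q (trans (sym n≡) (ℕₚ.*-comm (suc q) d)) v)
                         (words-of-scaledContent d (suc q) v (trans sum≡ (sym n≡)))

-- Inclusion–exclusion over the sublists of a list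

-- The sum of (-1)^(|js| - |K|) `F K` over all sublists `K` of `js`, unfolded on whether the head is
-- kept.
alternate : List ℕ → (List ℕ → ℤ) → ℤ
alternate []       F = F []
alternate (j ∷ js) F = alternate js (F ∘ (j ∷_)) + -1ℤ * alternate js F

alternate-* : ∀ js c F → alternate js (λ K → c * F K) ≡ c * alternate js F
alternate-* []       c F = refl
alternate-* (j ∷ js) c F = trans
  (cong₂ (λ x y → x + -1ℤ * y) (alternate-* js c (F ∘ (j ∷_))) (alternate-* js c F))
  (distrib c (alternate js (F ∘ (j ∷_))) (alternate js F))
  where
  distrib : ∀ c x y → c * x + -1ℤ * (c * y) ≡ c * (x + -1ℤ * y)
  distrib = solve-∀

alternate-∑ : ∀ {A : Set} js (xs : List A) (F : A → List ℕ → ℤ) →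
              alternate js (λ K → ∑ xs (λ x → F x K)) ≡ ∑ xs (λ x → alternate js (F x))
alternate-∑ []       xs F = refl
alternate-∑ (j ∷ js) xs F = begin
  alternate js (λ K → ∑ xs (λ x → F x (j ∷ K))) + -1ℤ * alternate js (λ K → ∑ xs (λ x → F x K))
    ≡⟨ cong₂ (λ a b → a + -1ℤ * b) (alternate-∑ js xs (λ x → F x ∘ (j ∷_))) (alternate-∑ js xs F) ⟩
  ∑ xs (λ x → alternate js (F x ∘ (j ∷_))) + -1ℤ * ∑ xs (λ x → alternate js (F x))
    ≡⟨ cong (λ b → ∑ xs (λ x → alternate js (F x ∘ (j ∷_))) + b) (∑-* xs -1ℤ (λ x → alternate js (F x))) ⟩
  ∑ xs (λ x → alternate js (F x ∘ (j ∷_))) + ∑ xs (λ x → -1ℤ * alternate js (F x))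
    ≡⟨ ∑-+ xs (λ x → alternate js (F x ∘ (j ∷_))) (λ x → -1ℤ * alternate js (F x)) ⟨
  ∑ xs (λ x → alternate (j ∷ js) (F x))  ∎
  where open ≡-Reasoning

-- Increasing lists of cuts, their gaps and blocks

module _ (n : ℕ) where

  -- The lower bound `j₀` stands for the preceding cut and moves along the list just as it does in
  -- `gaps`.
  Increasing : ℕ → List ℕ → Set
  Increasing j₀ []      = j₀ ≤ n
  Increasing j₀ (k ∷ K) = j₀ < k × Increasing k K

  increasing-≤ : ∀ {j₀} K → Increasing j₀ K → j₀ ≤ n
  increasing-≤ []      j₀≤n         = j₀≤n
  increasing-≤ (k ∷ K) (j₀<k , inc) = ℕₚ.≤-trans (ℕₚ.<⇒≤ j₀<k) (increasing-≤ K inc)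

  increasing-lower : ∀ {i j} K → i ≤ j → Increasing j K → Increasing i K
  increasing-lower []      i≤j j≤n         = ℕₚ.≤-trans i≤j j≤n
  increasing-lower (k ∷ K) i≤j (j<k , inc) = ℕₚ.≤-<-trans i≤j j<k , inc

  increasing-drop : ∀ {j₀ j} K → Increasing j₀ (j ∷ K) → Increasing j₀ K
  increasing-drop K (j₀<j , inc) = increasing-lower K (ℕₚ.<⇒≤ j₀<j) inc

  increasing-∈ : ∀ {j₀ x} K → Increasing j₀ K → x ∈ K → j₀ < x
  increasing-∈ (k ∷ K) (j₀<k , inc) (here refl) = j₀<k
  increasing-∈ (k ∷ K) (j₀<k , inc) (there x∈K) = ℕₚ.<-trans j₀<k (increasing-∈ K inc x∈K)

  increasing-filter : ∀ {P : ℕ → Set} (P? : ∀ x → Dec (P x)) {j₀} K → Increasing j₀ K → Increasing j₀ (filter P? K)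
  increasing-filter P? []      inc = inc
  increasing-filter P? (k ∷ K) (j₀<k , inc) with P? k
  ... | yes _ = j₀<k , increasing-filter P? K inc
  ... | no  _ = increasing-filter P? K (increasing-lower K (ℕₚ.<⇒≤ j₀<k) inc)

  -- All sublists of an increasing list are increasing, so the two functions need only agree on such
  -- lists.
  alternate-cong : ∀ {F G j₀} js → Increasing j₀ js → (∀ K → Increasing j₀ K → F K ≡ G K) → alternate js F ≡ alternate js G
  alternate-cong []       inc eq = eq [] inc
  alternate-cong (j ∷ js) inc@(j₀<j , inc′) eq = cong₂ (λ x y → x + -1ℤ * y)
    (alternate-cong js inc′ (λ K incK → eq (j ∷ K) (j₀<j , incK)))
    (alternate-cong js (increasing-drop js inc) eq)

  -- The composition of `n ∸ j₀` cut out by `K`; for `j₀ = 0` these are the block sizes.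
  gaps : ℕ → (K : List ℕ) → Vec ℕ (suc (length K))
  gaps j₀ []      = n ∸ j₀ ∷ []
  gaps j₀ (k ∷ K) = k ∸ j₀ ∷ gaps k K

  sum-gaps : ∀ {j₀} K → Increasing j₀ K → Vec.sum (gaps j₀ K) ≡ n ∸ j₀
  sum-gaps          []      _            = ℕₚ.+-identityʳ _
  sum-gaps {j₀} (k ∷ K) (j₀<k , inc) = begin
    k ∸ j₀ ℕ.+ Vec.sum (gaps k K)  ≡⟨ cong (k ∸ j₀ ℕ.+_) (sum-gaps K inc) ⟩
    k ∸ j₀ ℕ.+ (n ∸ k)             ≡⟨ ℕₚ.+-∸-comm (n ∸ k) (ℕₚ.<⇒≤ j₀<k) ⟨
    k ℕ.+ (n ∸ k) ∸ j₀             ≡⟨ cong (_∸ j₀) (ℕₚ.m+[n∸m]≡n (increasing-≤ K inc)) ⟩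
    n ∸ j₀                         ∎
    where open ≡-Reasoning

-- The number of elements k ≤ a of K, when K is increasing.
block : (K : List ℕ) → ℕ → Fin (suc (length K))
block []      a = zero
block (k ∷ K) a with a ℕₚ.<? k
... | yes _ = zero
... | no  _ = suc (block K a)

block-mono : ∀ K {a b} → a ≤ b → block K a Fin.≤ block K b
block-mono []      a≤b = z≤n
block-mono (k ∷ K) {a} {b} a≤b with a ℕₚ.<? k | b ℕₚ.<? k
... | yes _  | _       = z≤n
... | no a≮k | yes b<k = contradiction (ℕₚ.≤-<-trans a≤b b<k) a≮k
... | no _   | no _    = s≤s (block-mono K a≤b)

block-≢⇒∈ : ∀ K {a} → block K a ≢ block K (suc a) → suc a ∈ K
block-≢⇒∈ []      ≢ = contradiction refl ≢
block-≢⇒∈ (k ∷ K) {a} ≢ with a ℕₚ.<? k | suc a ℕₚ.<? k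
... | yes _   | yes _     = contradiction refl ≢
... | yes a<k | no  sa≮k  = here (ℕₚ.≤-antisym a<k (ℕₚ.≮⇒≥ sa≮k))
... | no a≮k  | yes sa<k  = contradiction (ℕₚ.<-trans (ℕₚ.n<1+n a) sa<k) a≮k
... | no _    | no _      = there (block-≢⇒∈ K (≢ ∘ cong suc))

block-∈⇒≢ : ∀ n {j₀} K {a} → Increasing n j₀ K → suc a ∈ K → block K a ≢ block K (suc a)
block-∈⇒≢ n (k ∷ K) {a} (_ , inc) sa∈ eq with a ℕₚ.<? k | suc a ℕₚ.<? k | sa∈
... | yes _   | yes sa<k | here refl  = ℕₚ.<-irrefl refl sa<k
... | yes _   | yes sa<k | there sa∈K = ℕₚ.<⇒≯ sa<k (increasing-∈ n K inc sa∈K)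
... | no a≮k  | no _     | here refl  = a≮k (ℕₚ.n<1+n a)
... | no _    | no _     | there sa∈K = block-∈⇒≢ n K inc sa∈K (Finₚ.suc-injective eq)

#-interval : ∀ n l u → u ≤ n → # {n} (λ a → (l ℕₚ.≤? toℕ a) ×-dec (toℕ a ℕₚ.<? u)) ≡ u ∸ l
#-interval n       l       zero    _         = trans (#-none {n} (λ a → (l ℕₚ.≤? toℕ a) ×-dec (toℕ a ℕₚ.<? 0)) (λ _ ())) (sym (ℕₚ.0∸n≡0 l))
#-interval (suc n) zero    (suc u) (s≤s u≤n) = cong suc (trans
  (#-cong {n} (λ a → (0 ℕₚ.≤? suc (toℕ a)) ×-dec (suc (toℕ a) ℕₚ.<? suc u)) (λ a → (0 ℕₚ.≤? toℕ a) ×-dec (toℕ a ℕₚ.<? u))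
    (λ { _ (_ , s≤s q) → z≤n , q }) (λ { _ (_ , q) → z≤n , s≤s q }))
  (#-interval n 0 u u≤n))
#-interval (suc n) (suc l) (suc u) (s≤s u≤n) = trans
  (#-cong {n} (λ a → (suc l ℕₚ.≤? suc (toℕ a)) ×-dec (suc (toℕ a) ℕₚ.<? suc u)) (λ a → (l ℕₚ.≤? toℕ a) ×-dec (toℕ a ℕₚ.<? u))
    (λ { _ (s≤s p , s≤s q) → p , q }) (λ { _ (p , q) → s≤s p , s≤s q }))
  (#-interval n l u u≤n)

-- Generalised to the points from `j₀` on, because behind the first cut `k` the induction sees only
-- the points from `k` on.
block-content-from : ∀ n {j₀} K → Increasing n j₀ K → ∀ b →
  # {n} (λ a → (j₀ ℕₚ.≤? toℕ a) ×-dec (block K (toℕ a) Finₚ.≟ b)) ≡ lookup (gaps n j₀ K) b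
block-content-from n {j₀} [] j₀≤n zero = trans
  (#-cong {n} (λ a → (j₀ ℕₚ.≤? toℕ a) ×-dec (zero Finₚ.≟ zero)) (λ a → (j₀ ℕₚ.≤? toℕ a) ×-dec (toℕ a ℕₚ.<? n))
    (λ a (p , _) → p , toℕ<n a) (λ _ (p , _) → p , refl))
  (#-interval n j₀ n ℕₚ.≤-refl)
block-content-from n {j₀} (k ∷ K) (j₀<k , inc) zero = trans
  (#-cong {n} (λ a → (j₀ ℕₚ.≤? toℕ a) ×-dec (block (k ∷ K) (toℕ a) Finₚ.≟ zero)) (λ a → (j₀ ℕₚ.≤? toℕ a) ×-dec (toℕ a ℕₚ.<? k))
    (λ a (p , eq) → p , to a eq) (λ a (p , lt) → p , from a lt))
  (#-interval n j₀ k (increasing-≤ n K inc))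
  where
  to : ∀ a → block (k ∷ K) (toℕ a) ≡ zero → toℕ a < k
  to a eq with toℕ a ℕₚ.<? k
  ... | yes lt = lt
  from : ∀ a → toℕ a < k → block (k ∷ K) (toℕ a) ≡ zero
  from a lt with toℕ a ℕₚ.<? k
  ... | yes _  = refl
  ... | no ¬lt = contradiction lt ¬lt
block-content-from n {j₀} (k ∷ K) (j₀<k , inc) (suc b) = trans
  (#-cong {n} (λ a → (j₀ ℕₚ.≤? toℕ a) ×-dec (block (k ∷ K) (toℕ a) Finₚ.≟ suc b)) (λ a → (k ℕₚ.≤? toℕ a) ×-dec (block K (toℕ a) Finₚ.≟ b))
    (λ a (_ , eq) → to a eq) (λ a (p , eq) → ℕₚ.≤-trans (ℕₚ.<⇒≤ j₀<k) p , from a p eq))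
  (block-content-from n K inc b)
  where
  to : ∀ a → block (k ∷ K) (toℕ a) ≡ suc b → k ≤ toℕ a × block K (toℕ a) ≡ b
  to a eq with toℕ a ℕₚ.<? k
  ... | no ¬lt = ℕₚ.≮⇒≥ ¬lt , Finₚ.suc-injective eq
  from : ∀ a → k ≤ toℕ a → block K (toℕ a) ≡ b → block (k ∷ K) (toℕ a) ≡ suc b
  from a k≤a eq with toℕ a ℕₚ.<? k
  ... | yes lt = contradiction lt (ℕₚ.≤⇒≯ k≤a)
  ... | no _   = cong suc eq

block-content : ∀ n K → Increasing n 0 K → ∀ b → # {n} (λ a → block K (toℕ a) Finₚ.≟ b) ≡ lookup (gaps n 0 K) b
block-content n K inc b = trans
  (#-cong {n} (λ a → block K (toℕ a) Finₚ.≟ b) (λ a → (0 ℕₚ.≤? toℕ a) ×-dec (block K (toℕ a) Finₚ.≟ b))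
    (λ _ eq → z≤n , eq) (λ _ → proj₂))
  (block-content-from n K inc b)

-- The determinant

det-cong : ∀ {k} {M N : Fin k → Fin k → ℤ} → (∀ i j → M i j ≡ N i j) → det M ≡ det N
det-cong {zero}  eq = refl
det-cong {suc k} eq = sum-cong-≗ λ i → cong₂ (λ x y → -1ℤ ^ toℕ i * x * y) (eq i zero) (det-cong (λ a b → eq (punchIn i a) (suc b)))

sum-zero : ∀ {k} {f : Fin k → ℤ} → (∀ i → f i ≡ 0ℤ) → sum f ≡ 0ℤ
sum-zero {zero}  eq = refl
sum-zero {suc k} eq = cong₂ _+_ (eq zero) (sum-zero (eq ∘ suc))

module _ (n d : ℕ) .{{_ : NonZero d}} where

  entry : ℕ → ℕ → ℤ
  entry x y = binomial (n ℕ./ d ∸ x ℕ./ d) (y ℕ./ d ⊖ x ℕ./ d)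

  -- Rows belong to left endpoints, columns to right endpoints. Keeping the first left endpoint `x`
  -- apart makes both minors of the expansion matrices of the same kind.
  hessenberg : ∀ {k} → ℕ → Vec ℕ k → Fin (suc k) → Fin (suc k) → ℤ
  hessenberg x ys l r = entry (lookup (x ∷ ys) l) (lookup (ys Vec.∷ʳ n) r)

  entry-≤ : ∀ {x y} → x ≤ y → entry x y ≡ + ((n ℕ./ d ∸ x ℕ./ d) C (y ℕ./ d ∸ x ℕ./ d))
  entry-≤ {x} {y} x≤y = cong (binomial (n ℕ./ d ∸ x ℕ./ d)) (ℤₚ.⊖-≥ (DivMod./-monoˡ-≤ d x≤y))

  entry-self : ∀ y → entry y y ≡ 1ℤ
  entry-self y = trans (entry-≤ {y} ℕₚ.≤-refl) (cong (λ z → + ((n ℕ./ d ∸ y ℕ./ d) C z)) (ℕₚ.n∸n≡0 (y ℕ./ d)))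

  -- Divisibility keeps the inequality strict after division by `d`, so the lower index is negative;
  -- with equal quotients the entry would be 1.
  entry-> : ∀ {x y} → d ∣ x → d ∣ y → y < x → entry x y ≡ 0ℤ
  entry-> {x} {y} d∣x d∣y y<x = begin
    binomial N (y ℕ./ d ⊖ x ℕ./ d)        ≡⟨ cong (binomial N) (ℤₚ.⊖-< quotients) ⟩
    -- Writing the difference as a successor lets the negation compute to the negative case of
    -- `binomial`.
    binomial N (- + (x ℕ./ d ∸ y ℕ./ d))  ≡⟨ cong (λ k → binomial N (- + k)) (ℕₚ.suc-pred (x ℕ./ d ∸ y ℕ./ d) {{ℕ.≢-nonZero (ℕₚ.m>n⇒m∸n≢0 quotients)}}) ⟨
    0ℤ                                ∎
    where
    open ≡-Reasoning
    N = n ℕ./ d ∸ x ℕ./ d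
    quotients : y ℕ./ d < x ℕ./ d
    quotients = ℕₚ.*-cancelʳ-< d (y ℕ./ d) (x ℕ./ d) (subst₂ _<_ (sym (DivMod.m/n*n≡m d∣y)) (sym (DivMod.m/n*n≡m d∣x)) y<x)

  det-hessenberg-[] : ∀ x → x ≤ n → det (hessenberg x []) ≡ 1ℤ
  det-hessenberg-[] x x≤n = begin
    1ℤ * entry x n * 1ℤ + 0ℤ  ≡⟨ simplify (entry x n) ⟩
    entry x n                 ≡⟨ entry-≤ x≤n ⟩
    + ((n ℕ./ d ∸ x ℕ./ d) C (n ℕ./ d ∸ x ℕ./ d)) ≡⟨ cong +_ (nCn≡1 (n ℕ./ d ∸ x ℕ./ d)) ⟩
    1ℤ                        ∎
    where
    open ≡-Reasoning
    simplify : ∀ a → 1ℤ * a * 1ℤ + 0ℤ ≡ a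
    simplify = solve-∀

  -- Deleting the row of `x` leaves `hessenberg y ys`. Deleting the row of `y`, whose first entry is
  -- 1, leaves `hessenberg x ys` with sign -1. The rows of `ys` begin with 0 by `entry->`.
  det-hessenberg-∷ : ∀ {k} x y (ys : Vec ℕ k) → d ∣ y → (∀ i → d ∣ lookup ys i) → (∀ i → y < lookup ys i) →
    det (hessenberg x (y ∷ ys)) ≡ entry x y * det (hessenberg y ys) + -1ℤ * det (hessenberg x ys)
  det-hessenberg-∷ {k} x y ys d∣y d∣ys y<ys = begin
    1ℤ * entry x y * det (hessenberg y ys) + (-1ℤ * 1ℤ * entry y y * det minor + rest)
      ≡⟨ cong₂ (λ a b → 1ℤ * entry x y * det (hessenberg y ys) + (-1ℤ * 1ℤ * a * det minor + b)) (entry-self y) rest≡0 ⟩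
    1ℤ * entry x y * det (hessenberg y ys) + (-1ℤ * 1ℤ * 1ℤ * det minor + 0ℤ)
      ≡⟨ cong (λ b → 1ℤ * entry x y * det (hessenberg y ys) + (-1ℤ * 1ℤ * 1ℤ * b + 0ℤ)) (det-cong minor≡) ⟩
    1ℤ * entry x y * det (hessenberg y ys) + (-1ℤ * 1ℤ * 1ℤ * det (hessenberg x ys) + 0ℤ)
      ≡⟨ simplify (entry x y) (det (hessenberg y ys)) (det (hessenberg x ys)) ⟩
    entry x y * det (hessenberg y ys) + -1ℤ * det (hessenberg x ys)  ∎
    where
    open ≡-Reasoning
    M = hessenberg x (y ∷ ys)
    minor : Fin (suc k) → Fin (suc k) → ℤ
    minor a b = M (punchIn (suc zero) a) (suc b)
    minor≡ : ∀ a b → minor a b ≡ hessenberg x ys a b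
    minor≡ zero    b = refl
    minor≡ (suc a) b = refl
    term : Fin k → ℤ
    term i = -1ℤ ^ toℕ (suc (suc i)) * entry (lookup ys i) y * det (λ a b → M (punchIn (suc (suc i)) a) (suc b))
    rest = sum term
    rest≡0 : rest ≡ 0ℤ
    rest≡0 = sum-zero λ i → trans
      (cong (λ e → -1ℤ ^ toℕ (suc (suc i)) * e * det (λ a b → M (punchIn (suc (suc i)) a) (suc b))) (entry-> (d∣ys i) d∣y (y<ys i)))
      (annihilate (-1ℤ ^ toℕ (suc (suc i))) _)
      where
      annihilate : ∀ a b → a * 0ℤ * b ≡ 0ℤ
      annihilate = solve-∀
    simplify : ∀ a b c → 1ℤ * a * b + (-1ℤ * 1ℤ * 1ℤ * c + 0ℤ) ≡ a * b + -1ℤ * c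
    simplify = solve-∀

  /-∸ : ∀ {x y} → d ∣ y → y ≤ x → (x ∸ y) ℕ./ d ≡ x ℕ./ d ∸ y ℕ./ d
  /-∸ {x} {y} d∣y y≤x = trans (cong (λ z → (x ∸ z) ℕ./ d) (sym (DivMod.m/n*n≡m d∣y))) (DivMod.[m∸n*o]/o≡m/o∸n x (y ℕ./ d) d)

  ∣-∸ : ∀ {x y} → d ∣ x → d ∣ y → d ∣ x ∸ y
  ∣-∸ (divides p refl) (divides q refl) = divides (p ∸ q) (sym (ℕₚ.*-distribʳ-∸ d p q))

  -- The gaps from `j₀` on always add up to `n ∸ j₀`, so the factor of the first gap does not depend
  -- on the later cuts and leaves the alternating sum.
  alternate-gaps-∷ : ∀ {j₀ j} js → j₀ < j → Increasing n j js →
    alternate js (λ K → powerMultinomial d (gaps n j₀ (j ∷ K))) ≡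
    ⟦ d ∣? (j ∸ j₀) ⟧ * + (((n ∸ j₀) ℕ./ d) C ((j ∸ j₀) ℕ./ d)) * alternate js (λ K → powerMultinomial d (gaps n j K))
  alternate-gaps-∷ {j₀} {j} js j₀<j inc = trans
    (alternate-cong n js inc λ K incK → trans
      (cong (λ s → ⟦ d ∣? (j ∸ j₀) ⟧ * (+ ((s ℕ./ d) C ((j ∸ j₀) ℕ./ d)) * powerMultinomial d (gaps n j K))) (sum-gaps n (j ∷ K) (j₀<j , incK)))
      (sym (ℤₚ.*-assoc ⟦ d ∣? (j ∸ j₀) ⟧ (+ (((n ∸ j₀) ℕ./ d) C ((j ∸ j₀) ℕ./ d))) (powerMultinomial d (gaps n j K)))))
    (alternate-* js (⟦ d ∣? (j ∸ j₀) ⟧ * + (((n ∸ j₀) ℕ./ d) C ((j ∸ j₀) ℕ./ d))) (λ K → powerMultinomial d (gaps n j K)))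

  -- Expanding the determinant along its first column, whose only non-zero entries are the
  -- first two, is the recursion of inclusion–exclusion on whether the first cut is kept.
  alternate-powerMultinomial : d ∣ n → ∀ {j₀} js → d ∣ j₀ → Increasing n j₀ js →
    alternate js (λ K → powerMultinomial d (gaps n j₀ K)) ≡
    -1ℤ ^ (length js ∸ length (filter (d ∣?_) js)) * det (hessenberg j₀ (Vec.fromList (filter (d ∣?_) js)))
  alternate-powerMultinomial d∣n {j₀} [] d∣j₀ j₀≤n = begin
    ⟦ d ∣? (n ∸ j₀) ⟧ * (+ (((n ∸ j₀ ℕ.+ 0) ℕ./ d) C ((n ∸ j₀) ℕ./ d)) * 1ℤ)
      ≡⟨ cong₂ (λ a b → a * (+ ((b ℕ./ d) C ((n ∸ j₀) ℕ./ d)) * 1ℤ)) (⟦⟧-yes (d ∣? (n ∸ j₀)) (∣-∸ d∣n d∣j₀)) (ℕₚ.+-identityʳ (n ∸ j₀)) ⟩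
    1ℤ * (+ (((n ∸ j₀) ℕ./ d) C ((n ∸ j₀) ℕ./ d)) * 1ℤ)
      ≡⟨ cong (λ a → 1ℤ * (+ a * 1ℤ)) (nCn≡1 ((n ∸ j₀) ℕ./ d)) ⟩
    1ℤ
      ≡⟨ cong (1ℤ *_) (det-hessenberg-[] j₀ j₀≤n) ⟨
    1ℤ * det (hessenberg j₀ [])  ∎
    where open ≡-Reasoning
  alternate-powerMultinomial d∣n {j₀} (j ∷ js) d∣j₀ inc@(j₀<j , inc′) with d ∣? j
  -- Keeping `j` makes the first gap indivisible by `d`, as `d` divides `j₀`. Only the lists without
  -- `j` survive, and their factor -1 goes into the sign.
  ... | no d∤j = begin
    alternate js (λ K → powerMultinomial d (gaps n j₀ (j ∷ K))) + -1ℤ * alternate js (λ K → powerMultinomial d (gaps n j₀ K))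
      ≡⟨ cong₂ (λ a b → a + -1ℤ * b) (alternate-gaps-∷ js j₀<j inc′) (alternate-powerMultinomial d∣n js d∣j₀ (increasing-drop n js inc)) ⟩
    ⟦ d ∣? (j ∸ j₀) ⟧ * + c * rest + -1ℤ * (sign * D)
      ≡⟨ cong (λ a → a * + c * rest + -1ℤ * (sign * D)) (⟦⟧-no (d ∣? (j ∸ j₀)) (λ h → d∤j (∣ₚ.∣m∸n∣n⇒∣m d (ℕₚ.<⇒≤ j₀<j) h d∣j₀))) ⟩
    0ℤ * + c * rest + -1ℤ * (sign * D)
      ≡⟨ simplify (+ c) rest sign D ⟩
    -1ℤ * sign * D
      ≡⟨ cong (λ k → -1ℤ ^ k * D) (ℕₚ.+-∸-assoc 1 (Listₚ.length-filter (d ∣?_) js)) ⟨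
    -1ℤ ^ (suc (length js) ∸ length (filter (d ∣?_) js)) * D  ∎
    where
    open ≡-Reasoning
    c = ((n ∸ j₀) ℕ./ d) C ((j ∸ j₀) ℕ./ d)
    rest = alternate js (λ K → powerMultinomial d (gaps n j K))
    sign = -1ℤ ^ (length js ∸ length (filter (d ∣?_) js))
    D = det (hessenberg j₀ (Vec.fromList (filter (d ∣?_) js)))
    simplify : ∀ c r s D → 0ℤ * c * r + -1ℤ * (s * D) ≡ -1ℤ * s * D
    simplify = solve-∀
  -- Both choices survive: with `j` kept, the recursion restarts at `j`; with `j` dropped, it
  -- continues from `j₀`. The sign is common to both.
  ... | yes d∣j = begin
    alternate js (λ K → powerMultinomial d (gaps n j₀ (j ∷ K))) + -1ℤ * alternate js (λ K → powerMultinomial d (gaps n j₀ K))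
      ≡⟨ cong₂ (λ a b → a + -1ℤ * b) (alternate-gaps-∷ js j₀<j inc′) (alternate-powerMultinomial d∣n js d∣j₀ (increasing-drop n js inc)) ⟩
    ⟦ d ∣? (j ∸ j₀) ⟧ * + c * alternate js (λ K → powerMultinomial d (gaps n j K)) + -1ℤ * (sign * det (hessenberg j₀ ys))
      ≡⟨ cong₂ (λ a b → a * b + -1ℤ * (sign * det (hessenberg j₀ ys))) c≡ (alternate-powerMultinomial d∣n js d∣j inc′) ⟩
    entry j₀ j * (sign * det (hessenberg j ys)) + -1ℤ * (sign * det (hessenberg j₀ ys))
      ≡⟨ factor (entry j₀ j) sign (det (hessenberg j ys)) (det (hessenberg j₀ ys)) ⟩
    sign * (entry j₀ j * det (hessenberg j ys) + -1ℤ * det (hessenberg j₀ ys))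
      ≡⟨ cong (sign *_) (det-hessenberg-∷ j₀ j ys d∣j
           (λ i → All.lookup (Allₚ.all-filter (d ∣?_) js) (lookup∈ js′ i))
           (λ i → increasing-∈ n js′ (increasing-filter n (d ∣?_) js inc′) (lookup∈ js′ i))) ⟨
    sign * det (hessenberg j₀ (j ∷ ys))  ∎
    where
    open ≡-Reasoning
    c = ((n ∸ j₀) ℕ./ d) C ((j ∸ j₀) ℕ./ d)
    js′ = filter (d ∣?_) js
    ys = Vec.fromList js′
    sign = -1ℤ ^ (length js ∸ length js′)
    lookup∈ : ∀ (K : List ℕ) i → lookup (Vec.fromList K) i ∈ K
    lookup∈ (k ∷ K) zero    = here refl
    lookup∈ (k ∷ K) (suc i) = there (lookup∈ K i)
    c≡ : ⟦ d ∣? (j ∸ j₀) ⟧ * + c ≡ entry j₀ j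
    c≡ = begin
      ⟦ d ∣? (j ∸ j₀) ⟧ * + c                          ≡⟨ cong (_* + c) (⟦⟧-yes (d ∣? (j ∸ j₀)) (∣-∸ d∣j d∣j₀)) ⟩
      1ℤ * + c                                         ≡⟨ ℤₚ.*-identityˡ (+ c) ⟩
      + c                                              ≡⟨ cong₂ (λ a b → + (a C b)) (/-∸ d∣j₀ (increasing-≤ n (j ∷ js) inc)) (/-∸ d∣j₀ (ℕₚ.<⇒≤ j₀<j)) ⟩
      + ((n ℕ./ d ∸ j₀ ℕ./ d) C (j ℕ./ d ∸ j₀ ℕ./ d))          ≡⟨ entry-≤ (ℕₚ.<⇒≤ j₀<j) ⟨
      entry j₀ j                                       ∎
    factor : ∀ e s x y → e * (s * x) + -1ℤ * (s * y) ≡ s * (e * x + -1ℤ * y)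
    factor = solve-∀

-- Descents

module _ {m} {P : Fin m → Set} (P? : ∀ x → Dec (P x)) where

  -- Unfolds to `elements J` when the predicate is membership in `J`, so the same lemmas serve `J`
  -- and the descents of a cycle.
  positions : List ℕ
  positions = map (suc ∘ toℕ) (filter P? (allFin m))

  ∈-positions⁺ : ∀ {x} → P x → suc (toℕ x) ∈ positions
  ∈-positions⁺ {x} p = ∈ₚ.∈-map⁺ (suc ∘ toℕ) (∈ₚ.∈-filter⁺ P? (∈ₚ.∈-allFin x) p)

  ∈-positions : ∀ {k} → k ∈ positions → ∃ λ x → k ≡ suc (toℕ x) × P x
  ∈-positions k∈ with ∈ₚ.∈-map⁻ (suc ∘ toℕ) k∈
  ... | x , x∈ , eq = x , eq , proj₂ (∈ₚ.∈-filter⁻ P? {xs = allFin m} x∈)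

  ∈-positions⁻ : ∀ {x} → suc (toℕ x) ∈ positions → P x
  ∈-positions⁻ sx∈ with ∈-positions sx∈
  ... | y , eq , p = subst P (sym (toℕ-injective (ℕₚ.suc-injective eq))) p

  positions-sorted : AllPairs _<_ positions
  positions-sorted = AllPairsₚ.map⁺ (AllPairsₚ.filter⁺ P? (AllPairsₚ.tabulate⁺-< s≤s))

  positions-increasing : Increasing (suc m) 0 positions
  positions-increasing = increasing positions
    (λ k∈ → let x , eq , _ = ∈-positions k∈ in subst (0 <_) (sym eq) (s≤s z≤n))
    (λ k∈ → let x , eq , _ = ∈-positions k∈ in subst (_≤ suc m) (sym eq) (ℕₚ.<⇒≤ (s≤s (toℕ<n x))))
    z≤n positions-sorted
    where
    increasing : ∀ {j₀} K → (∀ {k} → k ∈ K → j₀ < k) → (∀ {k} → k ∈ K → k ≤ suc m) → j₀ ≤ suc m →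
                 AllPairs _<_ K → Increasing (suc m) j₀ K
    increasing []      lo hi j₀≤ _          = j₀≤
    increasing (k ∷ K) lo hi j₀≤ (k< ∷ srt) = lo (here refl) , increasing K (All.lookup k<) (hi ∘ there) (hi (here refl)) srt

length-elements : ∀ {m} (J : Subset m) → length (elements J) ≡ ∣ J ∣
length-elements {m} J = trans (Listₚ.length-map (suc ∘ toℕ) (filter (Subₚ._∈? J) (allFin m)))
  (trans (ℤₚ.+-injective (trans (length-filter-∑ (Subₚ._∈? J) (allFin m)) (sym (#-∑ (Subₚ._∈? J))))) (#-∈ J))
  where
  #-∈ : ∀ {m} (J : Subset m) → # (Subₚ._∈? J) ≡ ∣ J ∣
  #-∈ []            = refl
  #-∈ (inside ∷ J)  = cong suc (trans (#-cong (λ i → suc i Subₚ.∈? (inside ∷ J)) (Subₚ._∈? J) (λ _ → drop-there) (λ _ → Vec.there)) (#-∈ J))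
  #-∈ (outside ∷ J) = trans (#-cong (λ i → suc i Subₚ.∈? (outside ∷ J)) (Subₚ._∈? J) (λ _ → drop-there) (λ _ → Vec.there)) (#-∈ J)

_⊆?_ : (ds K : List ℕ) → Dec (All (_∈ K) ds)
ds ⊆? K = All.all? (_∈? K) ds

-- The signs of the lists between `ds` and `js` cancel unless the two agree as sets. When `j` is
-- kept it may be erased from `ds`. If `j` occurs in `ds`, the lists without `j` contribute nothing;
-- otherwise the two halves cancel.
alternate-⊆ : ∀ js → Unique js → ∀ ds → alternate js (λ K → ⟦ ds ⊆? K ⟧) ≡ ⟦ (ds ⊆? js) ×-dec (js ⊆? ds) ⟧
alternate-⊆ []       _          ds = ⟦⟧-cong (ds ⊆? []) ((ds ⊆? []) ×-dec ([] ⊆? ds)) (_, []) proj₁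
alternate-⊆ (j ∷ js) (j∉js ∷ u) ds = begin
  alternate js (λ K → ⟦ ds ⊆? (j ∷ K) ⟧) + -1ℤ * alternate js (λ K → ⟦ ds ⊆? K ⟧)
    ≡⟨ cong₂ (λ a b → a + -1ℤ * b) (trans (alternate-≗ js (λ K → ⟦⟧-cong (ds ⊆? (j ∷ K)) (ds′ ⊆? K) (removed K) (restored K)))
               (alternate-⊆ js u ds′)) (alternate-⊆ js u ds) ⟩
  ⟦ (ds′ ⊆? js) ×-dec (js ⊆? ds′) ⟧ + -1ℤ * ⟦ (ds ⊆? js) ×-dec (js ⊆? ds) ⟧
    ≡⟨ difference (j ∈? ds) ⟩
  ⟦ (ds ⊆? (j ∷ js)) ×-dec ((j ∷ js) ⊆? ds) ⟧  ∎
  where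
  open ≡-Reasoning
  ≢j? : ∀ d → Dec (d ≢ j)
  ≢j? d = ¬? (d ℕₚ.≟ j)
  ds′ = filter ≢j? ds
  alternate-≗ : ∀ js {F G} → (∀ K → F K ≡ G K) → alternate js F ≡ alternate js G
  alternate-≗ []       eq = eq []
  alternate-≗ (j ∷ js) eq = cong₂ (λ a b → a + -1ℤ * b) (alternate-≗ js (λ K → eq (j ∷ K))) (alternate-≗ js eq)
  removed : ∀ K → All (_∈ j ∷ K) ds → All (_∈ K) ds′
  removed K ds⊆ = All.tabulate λ d∈ → let d∈ds , d≢j = ∈ₚ.∈-filter⁻ ≢j? {xs = ds} d∈ in
    case All.lookup ds⊆ d∈ds of λ { (here d≡j) → contradiction d≡j d≢j ; (there d∈K) → d∈K }
  restored : ∀ K → All (_∈ K) ds′ → All (_∈ j ∷ K) ds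
  restored K ds′⊆ = All.tabulate λ {d} d∈ds → case ≢j? d of λ where
    (yes d≢j) → there (All.lookup ds′⊆ (∈ₚ.∈-filter⁺ ≢j? d∈ds d≢j))
    (no ¬d≢j) → case d ℕₚ.≟ j of λ { (yes d≡j) → here d≡j ; (no d≢j) → contradiction d≢j ¬d≢j }
  js⊆ds′ : All (_∈ ds) js → All (_∈ ds′) js
  js⊆ds′ js⊆ = All.tabulate λ x∈ → ∈ₚ.∈-filter⁺ ≢j? (All.lookup js⊆ x∈) (All.lookup j∉js x∈ ∘ sym)
  js⊆ds : All (_∈ ds′) js → All (_∈ ds) js
  js⊆ds = All.map (λ x∈ → proj₁ (∈ₚ.∈-filter⁻ ≢j? {xs = ds} x∈))
  difference : Dec (j ∈ ds) → ⟦ (ds′ ⊆? js) ×-dec (js ⊆? ds′) ⟧ + -1ℤ * ⟦ (ds ⊆? js) ×-dec (js ⊆? ds) ⟧ ≡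
               ⟦ (ds ⊆? (j ∷ js)) ×-dec ((j ∷ js) ⊆? ds) ⟧
  difference (yes j∈ds) = trans
    (cong (λ b → ⟦ (ds′ ⊆? js) ×-dec (js ⊆? ds′) ⟧ + -1ℤ * b)
      (⟦⟧-no ((ds ⊆? js) ×-dec (js ⊆? ds)) (λ (ds⊆ , _) → All.lookup j∉js (All.lookup ds⊆ j∈ds) refl)))
    (trans (ℤₚ.+-identityʳ ⟦ (ds′ ⊆? js) ×-dec (js ⊆? ds′) ⟧)
      (⟦⟧-cong ((ds′ ⊆? js) ×-dec (js ⊆? ds′)) ((ds ⊆? (j ∷ js)) ×-dec ((j ∷ js) ⊆? ds))
        (λ (p , q) → restored js p , j∈ds ∷ js⊆ds q) (λ { (p , _ ∷ q) → removed js p , js⊆ds′ q })))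
  difference (no j∉ds) = trans
    (cong (λ a → a + -1ℤ * ⟦ (ds ⊆? js) ×-dec (js ⊆? ds) ⟧)
      (⟦⟧-cong ((ds′ ⊆? js) ×-dec (js ⊆? ds′)) ((ds ⊆? js) ×-dec (js ⊆? ds))
        (λ (p , q) → All.tabulate (λ d∈ → All.lookup p (∈ₚ.∈-filter⁺ ≢j? d∈ (λ { refl → j∉ds d∈ }))) , js⊆ds q)
        (λ (p , q) → removed js (All.map there p) , js⊆ds′ q)))
    (trans (cancel ⟦ (ds ⊆? js) ×-dec (js ⊆? ds) ⟧)
      (sym (⟦⟧-no ((ds ⊆? (j ∷ js)) ×-dec ((j ∷ js) ⊆? ds)) (λ { (_ , j∈ds ∷ _) → j∉ds j∈ds }))))
    where
    cancel : ∀ x → x + -1ℤ * x ≡ 0ℤ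
    cancel = solve-∀

-- Descents of a cycle read off a notation

module _ {m : ℕ} where

  private
    n = suc m

  -- A descent of the cycle sending each c i to c (next i).
  CycleDescent : (Fin n → Fin n) → Fin m → Set
  CycleDescent c x = ∃ λ i → ∃ λ j → c i ≡ inject₁ x × c j ≡ suc x × c (next j) Fin.< c (next i)

  cycleDescent? : ∀ c x → Dec (CycleDescent c x)
  cycleDescent? c x = any? λ i → any? λ j →
    (c i Finₚ.≟ inject₁ x) ×-dec ((c j Finₚ.≟ suc x) ×-dec (c (next j) Finₚ.<? c (next i)))

  descents : (Fin n → Fin n) → List ℕ
  descents c = positions (cycleDescent? c)

  module _ (K : List ℕ) where

    blk : Fin n → Fin (suc (length K))
    blk a = block K (toℕ a)

    open GesselReutenauer blk (block-mono K)

    -- Ascents between neighbouring points compose. Going down from `c j` point by point to `c i`, a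
    -- step that is not an ascent would be a descent, hence a cut in `K`, although both neighbours
    -- lie in the same block.
    descents⊆⇒blockIncreasing : Increasing n 0 K → ∀ c → Injective c → All (_∈ K) (descents c) → BlockIncreasing c
    descents⊆⇒blockIncreasing inc c inj ds⊆K i j = go (toℕ (c j)) i j refl
      where
      go : ∀ b i j → toℕ (c j) ≡ b → c i Fin.< c j → blk (c i) ≡ blk (c j) → c (next i) Fin.< c (next j)
      go zero    i j cj≡ ci<cj eq = contradiction (subst (toℕ (c i) <_) cj≡ ci<cj) ℕₚ.n≮0
      go (suc b) i j cj≡ ci<cj eq with c j in cj | cj≡
      ... | suc y | y≡b = case ℕₚ.m≤n⇒m<n∨m≡n (ℕ.s≤s⁻¹ ci<cj) of λ where
          (inj₁ ci<y) → ℕₚ.<-trans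
            (go b i i′ (trans ci′≡ (ℕₚ.suc-injective y≡b)) (subst (toℕ (c i) <_) (sym ci′≡) ci<y) (toℕ-injective (ℕₚ.≤-antisym
              (block-mono K (ℕₚ.<⇒≤ (subst (toℕ (c i) <_) (sym ci′≡) ci<y)))
              (subst (λ x → blk (c i′) Fin.≤ x) (sym eq) (ℕₚ.≤-reflexive (cong toℕ (trans (cong (block K) ci′≡) same)))))))
            step
          (inj₂ ci≡y) → subst (λ k → c (next k) Fin.< c (next j))
            (inj i′ i (toℕ-injective (trans ci′≡ (sym ci≡y)))) step
        where
        i′ = proj₁ (injective⇒surjective inj (inject₁ y))
        ci′ : c i′ ≡ inject₁ y
        ci′ = proj₂ (injective⇒surjective inj (inject₁ y))
        ci′≡ : toℕ (c i′) ≡ toℕ y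
        ci′≡ = trans (cong toℕ ci′) (toℕ-inject₁ y)
        -- Both points lie between `c i` and `c j`, whose blocks are equal, so monotonicity leaves
        -- no room for a change.
        same : block K (toℕ y) ≡ block K (suc (toℕ y))
        same = toℕ-injective (ℕₚ.≤-antisym (block-mono K (ℕₚ.n≤1+n (toℕ y)))
          (subst (λ x → toℕ x ≤ toℕ (block K (toℕ y))) eq (block-mono K (ℕ.s≤s⁻¹ ci<cj))))
        step : c (next i′) Fin.< c (next j)
        step with Finₚ.<-cmp (c (next i′)) (c (next j))
        ... | tri< lt _ _ = lt
        ... | tri> _ _ gt = contradiction same (block-∈⇒≢ n K inc
          (All.lookup ds⊆K (∈-positions⁺ (cycleDescent? c) (i′ , j , ci′ , cj , gt))))
        ... | tri≈ _ eq′ _ = contradiction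
          (trans (sym ci′≡) (trans (cong (toℕ ∘ c) (next-injective (inj _ _ eq′))) (cong toℕ cj))) (ℕₚ.<⇒≢ (ℕₚ.n<1+n (toℕ y)))
          where
          next-injective : ∀ {i j : Fin n} → next i ≡ next j → i ≡ j
          next-injective {i} {j} eq = begin
            i                   ≡⟨ shift-full i ⟨
            shift (suc m) i     ≡⟨ shift-comm 1 m i ⟩
            shift m (next i)    ≡⟨ cong (shift m) eq ⟩
            shift m (next j)    ≡⟨ shift-comm 1 m j ⟨
            shift (suc m) j     ≡⟨ shift-full j ⟩
            j                   ∎
            where open ≡-Reasoning

    -- Within one block, `incr` forbids a descent between neighbours; so the block changes at every
    -- descent, and it changes only at cuts.
    blockIncreasing⇒descents⊆ : ∀ c → BlockIncreasing c → All (_∈ K) (descents c)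
    blockIncreasing⇒descents⊆ c incr = All.tabulate λ k∈ → case ∈-positions (cycleDescent? c) k∈ of λ where
      (x , refl , i , j , ci , cj , gt) → block-≢⇒∈ K λ eq → ℕₚ.<⇒≯ gt (incr i j
        (subst₂ _<_ (sym (trans (cong toℕ ci) (toℕ-inject₁ x))) (sym (cong toℕ cj)) ℕₚ.≤-refl)
        (trans (cong (block K) (trans (cong toℕ ci) (toℕ-inject₁ x))) (trans eq (cong (block K) (sym (cong toℕ cj))))))

    ∑-descents⊆ : Increasing n 0 K →
      ∑ (words n n) (λ c → ⟦ injective? (lookup c) ×-dec (descents (lookup c) ⊆? K) ⟧) ≡
      ∑ (upTo n) (λ k → ⟦ suc k ∣? n ⟧ * (μ (suc k) * powerMultinomial (suc k) (gaps n 0 K)))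
    ∑-descents⊆ inc = begin
      ∑ (words n n) (λ c → ⟦ injective? (lookup c) ×-dec (descents (lookup c) ⊆? K) ⟧)
        ≡⟨ ∑-cong (words n n) (λ c → ⟦⟧-cong
             (injective? (lookup c) ×-dec (descents (lookup c) ⊆? K)) (injective? (lookup c) ×-dec blockIncreasing? (lookup c))
             (λ (inj , ⊆K) → inj , descents⊆⇒blockIncreasing inc (lookup c) inj ⊆K)
             (λ (inj , incr) → inj , blockIncreasing⇒descents⊆ (lookup c) incr)) ⟩
      ∑ (words n n) (λ c → ⟦ injective? (lookup c) ×-dec blockIncreasing? (lookup c) ⟧)
        ≡⟨ cycles≡primitiveWords ⟩
      ∑ W (λ w → ⟦ sameContent? (lookup w) blk ×-dec primitive? (lookup w) ⟧)
        ≡⟨ ∑-cong W (λ w → trans (⟦⟧-× (sameContent? (lookup w) blk) (primitive? (lookup w)))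
             (cong₂ _*_
               (⟦⟧-cong (sameContent? (lookup w) blk) (hasContent? w v)
                 (λ sc b → trans (sc b) (block-content n K inc b)) (λ h b → trans (h b) (sym (block-content n K inc b))))
               (trans (primitive-möbius (lookup w)) (sumOverDivisors-∑ n (λ d → μ d * ⟦ period? (lookup w) (n ℕ./ d) ⟧))))) ⟩
      ∑ W (λ w → ⟦ hasContent? w v ⟧ * ∑ (upTo n) (λ k → ⟦ suc k ∣? n ⟧ * (μ (suc k) * ⟦ period? (lookup w) (n ℕ./ suc k) ⟧)))
        ≡⟨ ∑-cong W (λ w → trans (∑-* (upTo n) ⟦ hasContent? w v ⟧ _) (∑-cong (upTo n) (λ k → trans
             (rearrange ⟦ hasContent? w v ⟧ ⟦ suc k ∣? n ⟧ (μ (suc k)) ⟦ period? (lookup w) (n ℕ./ suc k) ⟧)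
             (cong (λ x → ⟦ suc k ∣? n ⟧ * μ (suc k) * x) (sym (⟦⟧-× (hasContent? w v) (period? (lookup w) (n ℕ./ suc k)))))))) ⟩
      ∑ W (λ w → ∑ (upTo n) (λ k → ⟦ suc k ∣? n ⟧ * μ (suc k) * ⟦ hasContent? w v ×-dec period? (lookup w) (n ℕ./ suc k) ⟧))
        ≡⟨ ∑-swap W (upTo n) (λ w k → ⟦ suc k ∣? n ⟧ * μ (suc k) * ⟦ hasContent? w v ×-dec period? (lookup w) (n ℕ./ suc k) ⟧) ⟩
      ∑ (upTo n) (λ k → ∑ W (λ w → ⟦ suc k ∣? n ⟧ * μ (suc k) * ⟦ hasContent? w v ×-dec period? (lookup w) (n ℕ./ suc k) ⟧))
        ≡⟨ ∑-cong (upTo n) (λ k → begin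
             ∑ W (λ w → ⟦ suc k ∣? n ⟧ * μ (suc k) * ⟦ hasContent? w v ×-dec period? (lookup w) (n ℕ./ suc k) ⟧)
               ≡⟨ ∑-* W (⟦ suc k ∣? n ⟧ * μ (suc k)) (λ w → ⟦ hasContent? w v ×-dec period? (lookup w) (n ℕ./ suc k) ⟧) ⟨
             ⟦ suc k ∣? n ⟧ * μ (suc k) * ∑ W (λ w → ⟦ hasContent? w v ×-dec period? (lookup w) (n ℕ./ suc k) ⟧)
               ≡⟨ ℤₚ.*-assoc ⟦ suc k ∣? n ⟧ (μ (suc k)) (∑ W (λ w → ⟦ hasContent? w v ×-dec period? (lookup w) (n ℕ./ suc k) ⟧)) ⟩
             ⟦ suc k ∣? n ⟧ * (μ (suc k) * ∑ W (λ w → ⟦ hasContent? w v ×-dec period? (lookup w) (n ℕ./ suc k) ⟧))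
               -- The guard supplies the divisibility under which periodic words are powers.
               ≡⟨ ⟦⟧-*-cong (suc k ∣? n) (λ d∣n → cong (μ (suc k) *_) (periodic-words-of-content (suc k) d∣n v (sum-gaps n K inc))) ⟩
             ⟦ suc k ∣? n ⟧ * (μ (suc k) * powerMultinomial (suc k) v)  ∎) ⟩
      ∑ (upTo n) (λ k → ⟦ suc k ∣? n ⟧ * (μ (suc k) * powerMultinomial (suc k) v))  ∎
      where
      open ≡-Reasoning
      v = gaps n 0 K
      W = words (suc (length K)) n
      rearrange : ∀ h δ μ p → h * (δ * (μ * p)) ≡ δ * μ * (h * p)
      rearrange = solve-∀

  DescentsEqual : Subset m → (Fin n → Fin n) → Set
  DescentsEqual J c = ∀ x → (x Sub.∈ J → CycleDescent c x) × (CycleDescent c x → x Sub.∈ J)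

  descentsEqual? : ∀ J c → Dec (DescentsEqual J c)
  descentsEqual? J c = all? λ x → ((x Subₚ.∈? J) →-dec cycleDescent? c x) ×-dec (cycleDescent? c x →-dec (x Subₚ.∈? J))

  alternate-descents : ∀ J c → alternate (elements J) (λ K → ⟦ descents c ⊆? K ⟧) ≡ ⟦ descentsEqual? J c ⟧
  alternate-descents J c = trans (alternate-⊆ (elements J) (AllPairs.map ℕₚ.<⇒≢ (positions-sorted (Subₚ._∈? J))) (descents c))
    (⟦⟧-cong ((descents c ⊆? elements J) ×-dec (elements J ⊆? descents c)) (descentsEqual? J c)
      (λ (p , q) x → (λ x∈J → ∈-positions⁻ (cycleDescent? c) (All.lookup q (∈-positions⁺ (Subₚ._∈? J) x∈J)))
                   , (λ dx → ∈-positions⁻ (Subₚ._∈? J) (All.lookup p (∈-positions⁺ (cycleDescent? c) dx))))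
      (λ h → All.tabulate (λ k∈ → case ∈-positions (cycleDescent? c) k∈ of λ { (x , refl , dx) → ∈-positions⁺ (Subₚ._∈? J) (proj₂ (h x) dx) })
           , All.tabulate (λ k∈ → case ∈-positions (Subₚ._∈? J) k∈ of λ { (x , refl , x∈J) → ∈-positions⁺ (cycleDescent? c) (proj₁ (h x) x∈J) })))

  -- The columns agree by computation; only the rows, which index all endpoints but the last through
  -- `inject₁`, need rewriting.
  det-descentMatrix : ∀ (J : Subset m) d .{{_ : NonZero d}} → det (descentMatrix J d) ≡ det (hessenberg n d 0 (Vec.fromList (multiples J d)))
  det-descentMatrix J d = det-cong λ l r → cong
    (λ x → binomial (n ℕ./ d ∸ x ℕ./ d) ((lookup (endpoints J d) (suc r) ℕ./ d) ⊖ (x ℕ./ d)))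
    (lookup-∷ʳ (0 ∷ Vec.fromList (multiples J d)) l)
    where
    lookup-∷ʳ : ∀ {k} (xs : Vec ℕ k) i → lookup (xs Vec.∷ʳ n) (inject₁ i) ≡ lookup xs i
    lookup-∷ʳ (x ∷ xs) zero    = refl
    lookup-∷ʳ (x ∷ xs) (suc i) = lookup-∷ʳ xs i

  -- The alternating sum over `K` is moved inside the sum over divisors, where for each `d` it
  -- becomes the signed determinant.
  ∑-descentsEqual : ∀ J →
    ∑ (words n n) (λ c → ⟦ injective? (lookup c) ×-dec descentsEqual? J (lookup c) ⟧) ≡
    sumOverDivisors n (λ d → μ d * -1ℤ ^ (∣ J ∣ ∸ length (multiples J d)) * det (descentMatrix J d))
  ∑-descentsEqual J = begin
    ∑ cs (λ c → ⟦ injective? (lookup c) ×-dec descentsEqual? J (lookup c) ⟧)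
      ≡⟨ ∑-cong cs (λ c → begin
           ⟦ injective? (lookup c) ×-dec descentsEqual? J (lookup c) ⟧
             ≡⟨ ⟦⟧-× (injective? (lookup c)) (descentsEqual? J (lookup c)) ⟩
           ⟦ injective? (lookup c) ⟧ * ⟦ descentsEqual? J (lookup c) ⟧
             ≡⟨ cong (⟦ injective? (lookup c) ⟧ *_) (alternate-descents J (lookup c)) ⟨
           ⟦ injective? (lookup c) ⟧ * alternate js (λ K → ⟦ descents (lookup c) ⊆? K ⟧)
             ≡⟨ alternate-* js ⟦ injective? (lookup c) ⟧ (λ K → ⟦ descents (lookup c) ⊆? K ⟧) ⟨
           alternate js (λ K → ⟦ injective? (lookup c) ⟧ * ⟦ descents (lookup c) ⊆? K ⟧)  ∎) ⟩
    ∑ cs (λ c → alternate js (λ K → ⟦ injective? (lookup c) ⟧ * ⟦ descents (lookup c) ⊆? K ⟧))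
      ≡⟨ alternate-∑ js cs (λ c K → ⟦ injective? (lookup c) ⟧ * ⟦ descents (lookup c) ⊆? K ⟧) ⟨
    alternate js (λ K → ∑ cs (λ c → ⟦ injective? (lookup c) ⟧ * ⟦ descents (lookup c) ⊆? K ⟧))
      ≡⟨ alternate-cong n js inc (λ K incK → trans
           (∑-cong cs (λ c → sym (⟦⟧-× (injective? (lookup c)) (descents (lookup c) ⊆? K)))) (∑-descents⊆ K incK)) ⟩
    alternate js (λ K → ∑ (upTo n) (λ k → ⟦ suc k ∣? n ⟧ * (μ (suc k) * powerMultinomial (suc k) (gaps n 0 K))))
      ≡⟨ alternate-∑ js (upTo n) (λ k K → ⟦ suc k ∣? n ⟧ * (μ (suc k) * powerMultinomial (suc k) (gaps n 0 K))) ⟩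
    ∑ (upTo n) (λ k → alternate js (λ K → ⟦ suc k ∣? n ⟧ * (μ (suc k) * powerMultinomial (suc k) (gaps n 0 K))))
      ≡⟨ ∑-cong (upTo n) (λ k → begin
           alternate js (λ K → ⟦ suc k ∣? n ⟧ * (μ (suc k) * powerMultinomial (suc k) (gaps n 0 K)))
             ≡⟨ alternate-* js ⟦ suc k ∣? n ⟧ (λ K → μ (suc k) * powerMultinomial (suc k) (gaps n 0 K)) ⟩
           ⟦ suc k ∣? n ⟧ * alternate js (λ K → μ (suc k) * powerMultinomial (suc k) (gaps n 0 K))
             ≡⟨ cong (⟦ suc k ∣? n ⟧ *_) (alternate-* js (μ (suc k)) (λ K → powerMultinomial (suc k) (gaps n 0 K))) ⟩
           ⟦ suc k ∣? n ⟧ * (μ (suc k) * alternate js (λ K → powerMultinomial (suc k) (gaps n 0 K)))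
             ≡⟨ ⟦⟧-*-cong (suc k ∣? n) (term (suc k)) ⟩
           ⟦ suc k ∣? n ⟧ * (μ (suc k) * -1ℤ ^ (∣ J ∣ ∸ length (multiples J (suc k))) * det (descentMatrix J (suc k)))  ∎) ⟩
    ∑ (upTo n) (λ k → ⟦ suc k ∣? n ⟧ * (μ (suc k) * -1ℤ ^ (∣ J ∣ ∸ length (multiples J (suc k))) * det (descentMatrix J (suc k))))
      ≡⟨ sumOverDivisors-∑ n (λ d → μ d * -1ℤ ^ (∣ J ∣ ∸ length (multiples J d)) * det (descentMatrix J d)) ⟨
    sumOverDivisors n (λ d → μ d * -1ℤ ^ (∣ J ∣ ∸ length (multiples J d)) * det (descentMatrix J d))  ∎
    where
    open ≡-Reasoning
    cs = words n n
    js = elements J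
    inc = positions-increasing (Subₚ._∈? J)
    term : ∀ d .{{_ : NonZero d}} → d ∣ n → μ d * alternate js (λ K → powerMultinomial d (gaps n 0 K)) ≡
           μ d * -1ℤ ^ (∣ J ∣ ∸ length (multiples J d)) * det (descentMatrix J d)
    term d d∣n = trans
      (cong (μ d *_) (trans (alternate-powerMultinomial n d d∣n js (d ∣ₚ.∣0) inc)
        (cong₂ (λ l D → -1ℤ ^ (l ∸ length (multiples J d)) * D) (length-elements J) (sym (det-descentMatrix J d)))))
      (sym (ℤₚ.*-assoc (μ d) (-1ℤ ^ (∣ J ∣ ∸ length (multiples J d))) (det (descentMatrix J d))))

-- Cycles and their notations

lookup-injective : {A : Set} {xs : List A} → Unique xs → ∀ i j → List.lookup xs i ≡ List.lookup xs j → i ≡ j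
lookup-injective (x∉ ∷ u) zero    zero    eq = refl
lookup-injective (x∉ ∷ u) zero    (suc j) eq = contradiction eq (All.lookup x∉ (∈ₚ.∈-lookup j))
lookup-injective (x∉ ∷ u) (suc i) zero    eq = contradiction (sym eq) (All.lookup x∉ (∈ₚ.∈-lookup i))
lookup-injective (x∉ ∷ u) (suc i) (suc j) eq = cong suc (lookup-injective u i j eq)

module _ {m : ℕ} (J : Subset m) where

  private
    n = suc m

  -- The equation of `IsNCycle`, by the definition of `next`, for bare functions.
  IsNotation : (Fin n → Fin n) → (Fin n → Fin n) → Set
  IsNotation π c = ∀ i → π (c i) ≡ c (next i)

  -- Writing a cycle from the point 0 makes its notation unique.
  notation-unique : ∀ π π′ {c c′} → IsNotation π c → IsNotation π′ c′ → (∀ a → π a ≡ π′ a) → c zero ≡ c′ zero → ∀ i → c i ≡ c′ i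
  notation-unique π π′ {c} {c′} nc nc′ π≗π′ eq i =
    let t , _ , ti = shift-transitive zero i in subst (λ i → c i ≡ c′ i) ti (along t)
    where
    along : ∀ t → c (shift t zero) ≡ c′ (shift t zero)
    along zero    = eq
    along (suc t) = trans (sym (nc (shift t zero))) (trans (cong π (along t)) (trans (π≗π′ _) (nc′ (shift t zero))))

  rotate : Fin n → Vec (Fin n) n → Vec (Fin n) n
  rotate s c = tabulate (λ i → lookup c (shift (toℕ s) i))

  -- For `s` equal to 0 this shifts by the full `n`, which is the identity.
  unrotate : Fin n → Vec (Fin n) n → Vec (Fin n) n
  unrotate s c = tabulate (λ i → lookup c (shift (n ∸ toℕ s) i))

  shift-inverseˡ : ∀ (s i : Fin n) → shift (n ∸ toℕ s) (shift (toℕ s) i) ≡ i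
  shift-inverseˡ s i = trans (shift-+ (n ∸ toℕ s) (toℕ s) i)
    (trans (cong (λ t → shift t i) (ℕₚ.m∸n+n≡m (ℕₚ.<⇒≤ (toℕ<n s)))) (shift-full i))

  shift-inverseʳ : ∀ (s i : Fin n) → shift (toℕ s) (shift (n ∸ toℕ s) i) ≡ i
  shift-inverseʳ s i = trans (shift-comm (toℕ s) (n ∸ toℕ s) i) (shift-inverseˡ s i)

  shift-zero : ∀ (s : Fin n) → shift (toℕ s) zero ≡ s
  shift-zero s = shift-unique (toℕ s) zero s (trans (cong (_% n) (ℕₚ.+-identityʳ (toℕ s))) (m<n⇒m%n≡m (toℕ<n s)))

  lookup-rotate : ∀ s c i → lookup (rotate s c) i ≡ lookup c (shift (toℕ s) i)
  lookup-rotate s c = Vecₚ.lookup∘tabulate (λ i → lookup c (shift (toℕ s) i))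

  lookup-unrotate : ∀ s c i → lookup (unrotate s c) i ≡ lookup c (shift (n ∸ toℕ s) i)
  lookup-unrotate s c = Vecₚ.lookup∘tabulate (λ i → lookup c (shift (n ∸ toℕ s) i))

  unrotate-rotate : ∀ s c → unrotate s (rotate s c) ≡ c
  unrotate-rotate s c = trans (Vecₚ.tabulate-cong λ i → trans (lookup-rotate s c (shift (n ∸ toℕ s) i)) (cong (lookup c) (shift-inverseʳ s i)))
    (Vecₚ.tabulate∘lookup c)

  rotate-unrotate : ∀ s c → rotate s (unrotate s c) ≡ c
  rotate-unrotate s c = trans (Vecₚ.tabulate-cong λ i → trans (lookup-unrotate s c (shift (toℕ s) i)) (cong (lookup c) (shift-inverseˡ s i)))
    (Vecₚ.tabulate∘lookup c)

  -- Both shifts are parameters, so that `rotate` and `unrotate` are covered at once by exchanging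
  -- them.
  module _ (c : Fin n → Fin n) {c′ : Fin n → Fin n} (t t⁻¹ : ℕ) (c′≗ : ∀ i → c′ i ≡ c (shift t i))
           (inv : ∀ (i : Fin n) → shift t (shift t⁻¹ i) ≡ i) (inv′ : ∀ (i : Fin n) → shift t⁻¹ (shift t i) ≡ i) where

    injective-shift : Injective c → Injective c′
    injective-shift inj i j eq = trans (sym (inv′ i)) (trans
      (cong (shift t⁻¹) (inj _ _ (trans (sym (c′≗ i)) (trans eq (c′≗ j))))) (inv′ j))

    private
      c≗ : ∀ i → c i ≡ c′ (shift t⁻¹ i)
      c≗ i = trans (cong c (sym (inv i))) (sym (c′≗ (shift t⁻¹ i)))

      descent-shift : ∀ {c c′ : Fin n → Fin n} s → (∀ i → c′ i ≡ c (shift s i)) → ∀ {x} → CycleDescent c′ x → CycleDescent c x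
      descent-shift {c} {c′} s eq (i , j , ci , cj , gt) = shift s i , shift s j , trans (sym (eq i)) ci , trans (sym (eq j)) cj ,
        subst₂ Fin._<_ (trans (eq (next j)) (cong c (shift-comm s 1 j))) (trans (eq (next i)) (cong c (shift-comm s 1 i))) gt

    descentsEqual-shift : DescentsEqual J c → DescentsEqual J c′
    descentsEqual-shift h x = (λ x∈J → descent-shift t⁻¹ c≗ (proj₁ (h x) x∈J)) , (λ dx → proj₂ (h x) (descent-shift t c′≗ dx))

  NotationFrom : Fin n → Vec (Fin n) n → Set
  NotationFrom s c = (lookup c s ≡ zero) × (Injective (lookup c) × DescentsEqual J (lookup c))

  notation? : ∀ s c → Dec (NotationFrom s c)
  notation? s c = (lookup c s Finₚ.≟ zero) ×-dec (injective? (lookup c) ×-dec descentsEqual? J (lookup c))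

  rotate-notation : ∀ s {c} → NotationFrom s c → NotationFrom zero (rotate s c)
  rotate-notation s {c} (eq , inj , de) =
    trans (lookup-rotate s c zero) (trans (cong (lookup c) (shift-zero s)) eq) ,
    injective-shift (lookup c) (toℕ s) (n ∸ toℕ s) (lookup-rotate s c) (shift-inverseʳ s) (shift-inverseˡ s) inj ,
    descentsEqual-shift (lookup c) (toℕ s) (n ∸ toℕ s) (lookup-rotate s c) (shift-inverseʳ s) (shift-inverseˡ s) de

  unrotate-notation : ∀ s {c} → NotationFrom zero c → NotationFrom s (unrotate s c)
  unrotate-notation s {c} (eq , inj , de) =
    trans (lookup-unrotate s c s) (trans (cong (lookup c) (trans (cong (shift (n ∸ toℕ s)) (sym (shift-zero s))) (shift-inverseˡ s zero))) eq) ,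
    injective-shift (lookup c) (n ∸ toℕ s) (toℕ s) (lookup-unrotate s c) (shift-inverseˡ s) (shift-inverseʳ s) inj ,
    descentsEqual-shift (lookup c) (n ∸ toℕ s) (toℕ s) (lookup-unrotate s c) (shift-inverseˡ s) (shift-inverseʳ s) de

  notations : List (Vec (Fin n) n)
  notations = filter (notation? zero) (words n n)

  -- In each notation the point 0 stands at exactly one position `s`, and rotating by `s` moves it
  -- to the front. All `n` positions therefore contribute equally.
  ∑-notations : ∑ (words n n) (λ c → ⟦ injective? (lookup c) ×-dec descentsEqual? J (lookup c) ⟧) ≡ + n * + length notations
  ∑-notations = begin
    ∑ cs (λ c → ⟦ injective? (lookup c) ×-dec descentsEqual? J (lookup c) ⟧)
      ≡⟨ ∑-cong cs position ⟩
    ∑ cs (λ c → ∑ (allFin n) (λ s → ⟦ notation? s c ⟧))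
      ≡⟨ ∑-swap cs (allFin n) (λ c s → ⟦ notation? s c ⟧) ⟩
    ∑ (allFin n) (λ s → ∑ cs (λ c → ⟦ notation? s c ⟧))
      ≡⟨ ∑-cong (allFin n) (λ s → ∑-bij (wordEnum n n) (wordEnum n n) (notation? s) (notation? zero) (rotate s) (unrotate s)
           (λ {c} → rotate-notation s {c}) (λ {c} → unrotate-notation s {c}) (λ {c} _ → unrotate-rotate s c) (λ {c} _ → rotate-unrotate s c)) ⟩
    ∑ (allFin n) (λ _ → ∑ cs (λ c → ⟦ notation? zero c ⟧))
      ≡⟨ ∑-const (allFin n) (∑ cs (λ c → ⟦ notation? zero c ⟧)) ⟩
    + length (allFin n) * ∑ cs (λ c → ⟦ notation? zero c ⟧)
      ≡⟨ cong₂ (λ k S → + k * S) (Listₚ.length-tabulate {n = n} id) (sym (length-filter-∑ (notation? zero) cs)) ⟩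
    + n * + length notations  ∎
    where
    open ≡-Reasoning
    cs = words n n
    position : ∀ c → ⟦ injective? (lookup c) ×-dec descentsEqual? J (lookup c) ⟧ ≡ ∑ (allFin n) (λ s → ⟦ notation? s c ⟧)
    position c = cases p?
      where
      p? = injective? (lookup c) ×-dec descentsEqual? J (lookup c)
      cases : Dec (Injective (lookup c) × DescentsEqual J (lookup c)) → ⟦ p? ⟧ ≡ ∑ (allFin n) (λ s → ⟦ notation? s c ⟧)
      cases (no ¬p) = trans (⟦⟧-no p? ¬p) (sym (∑-zero (allFin n) (λ s _ → ⟦⟧-no (notation? s c) (¬p ∘ proj₂))))
      cases (yes (inj , de)) = trans (⟦⟧-yes p? (inj , de)) (sym (trans
        (∑-cong (allFin n) (λ s → trans (⟦⟧-cong (notation? s c) (s₀ Finₚ.≟ s)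
          (λ (eq , _) → inj s₀ s (trans c[s₀]≡0 (sym eq))) (λ { refl → c[s₀]≡0 , inj , de })) (sym (ℤₚ.*-identityʳ ⟦ s₀ Finₚ.≟ s ⟧))))
        (Enumeration.∑-single (finEnum n) s₀ (λ _ → 1ℤ))))
        where
        s₀ = proj₁ (injective⇒surjective inj zero)
        c[s₀]≡0 = proj₂ (injective⇒surjective inj zero)

  module _ {c : Fin n → Fin n} (inj : Injective c) where

    private
      c⁻¹ : Fin n → Fin n
      c⁻¹ a = proj₁ (injective⇒surjective inj a)
      c∘c⁻¹ : ∀ a → c (c⁻¹ a) ≡ a
      c∘c⁻¹ a = proj₂ (injective⇒surjective inj a)
      c⁻¹∘c : ∀ i → c⁻¹ (c i) ≡ i
      c⁻¹∘c i = inj _ _ (c∘c⁻¹ (c i))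

    points : Permutation′ n
    points = permutation c c⁻¹ c∘c⁻¹ c⁻¹∘c

    cycle : Permutation′ n
    -- `shift m` inverts `next`, since `suc m` steps make a full turn.
    cycle = permutation (c ∘ next ∘ c⁻¹) (c ∘ shift m ∘ c⁻¹)
      (λ a → trans (cong (c ∘ next) (c⁻¹∘c (shift m (c⁻¹ a)))) (trans (cong c (shift-full (c⁻¹ a))) (c∘c⁻¹ a)))
      (λ a → trans (cong (c ∘ shift m) (c⁻¹∘c (next (c⁻¹ a))))
        (trans (cong c (trans (shift-comm m 1 (c⁻¹ a)) (shift-full (c⁻¹ a)))) (c∘c⁻¹ a)))

    cycle-notation : IsNotation (cycle ⟨$⟩ʳ_) c
    cycle-notation i = cong (c ∘ next) (c⁻¹∘c i)

  module _ {π : Permutation′ n} {c : Fin n → Fin n} (inj : Injective c) (nc : IsNotation (π ⟨$⟩ʳ_) c) where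

    cycleDescent⇒descent : ∀ {x} → CycleDescent c x → IsDescent π x
    cycleDescent⇒descent (i , j , ci , cj , gt) = subst₂ Fin._<_
      (trans (sym (nc j)) (cong (π ⟨$⟩ʳ_) cj)) (trans (sym (nc i)) (cong (π ⟨$⟩ʳ_) ci)) gt

    descent⇒cycleDescent : ∀ {x} → IsDescent π x → CycleDescent c x
    descent⇒cycleDescent {x} gt =
      let i , ci = injective⇒surjective inj (inject₁ x)
          j , cj = injective⇒surjective inj (suc x)
      in i , j , ci , cj , subst₂ Fin._<_ (trans (cong (π ⟨$⟩ʳ_) (sym cj)) (nc j)) (trans (cong (π ⟨$⟩ʳ_) (sym ci)) (nc i)) gt

    hasDescentSet⁺ : DescentsEqual J c → HasDescentSet π J
    hasDescentSet⁺ h x = mk⇔ (cycleDescent⇒descent ∘ proj₁ (h x)) (proj₂ (h x) ∘ descent⇒cycleDescent)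

    hasDescentSet⁻ : HasDescentSet π J → DescentsEqual J c
    hasDescentSet⁻ h x = descent⇒cycleDescent ∘ Equivalence.to (h x) , Equivalence.from (h x) ∘ cycleDescent⇒descent

  Cycle : Set
  Cycle = Σ[ π ∈ Permutation′ n ] (IsNCycle π × HasDescentSet π J)

  -- The given notation is rotated by the position `s` of the point 0, which yields the
  -- representative that starts with 0.
  normalise : ∀ ((π , _) : Cycle) → ∃ λ c → c ∈ notations × IsNotation (π ⟨$⟩ʳ_) (lookup c)
  normalise (π , (c , nc) , hd) = r , ∈ₚ.∈-filter⁺ (notation? zero) (Enumeration.complete (wordEnum n n) r) (r0 , r-injective , r-descents) , nr
    where
    s = c ⟨$⟩ˡ zero
    r = tabulate (λ i → c ⟨$⟩ʳ shift (toℕ s) i)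
    r≗ : ∀ i → lookup r i ≡ c ⟨$⟩ʳ shift (toℕ s) i
    r≗ = Vecₚ.lookup∘tabulate (λ i → c ⟨$⟩ʳ shift (toℕ s) i)
    r0 : lookup r zero ≡ zero
    r0 = trans (r≗ zero) (trans (cong (c ⟨$⟩ʳ_) (shift-zero s)) (Perm.inverseʳ c))
    r-injective : Injective (lookup r)
    r-injective = injective-shift (c ⟨$⟩ʳ_) (toℕ s) (n ∸ toℕ s) r≗ (shift-inverseʳ s) (shift-inverseˡ s)
      (λ i j eq → trans (sym (Perm.inverseˡ c)) (trans (cong (c ⟨$⟩ˡ_) eq) (Perm.inverseˡ c)))
    nr : IsNotation (π ⟨$⟩ʳ_) (lookup r)
    nr i = trans (cong (π ⟨$⟩ʳ_) (r≗ i)) (trans (nc (shift (toℕ s) i)) (trans (cong (c ⟨$⟩ʳ_) (shift-comm 1 (toℕ s) i)) (sym (r≗ (next i)))))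
    r-descents : DescentsEqual J (lookup r)
    r-descents = hasDescentSet⁻ {π} {lookup r} r-injective nr hd

  notations-unique : Unique notations
  notations-unique = Uniqueₚ.filter⁺ (notation? zero) (Enumeration.unique (wordEnum n n))

  ∈-notations : ∀ {c} → c ∈ notations → NotationFrom zero c
  ∈-notations {c} c∈ = proj₂ (∈ₚ.∈-filter⁻ (notation? zero) {xs = words n n} c∈)

  cardinality : HasCardinality (NCyclesWithDescentSet J) (length notations)
  cardinality = record
    { to        = index
    ; from      = build
    ; to-cong   = λ {x} {y} → index-cong {x} {y}
    ; from-cong = λ { refl _ → refl }
    ; inverse   = (λ {k} {x} eq → trans (index-cong {x} {build k} eq) (index-build k))
                , (λ {x} {k} eq a → trans (cong (λ k → proj₁ (build k) ⟨$⟩ʳ a) eq) (build-index x a))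
    }
    where
    index : Cycle → Fin (length notations)
    index x = Any.index (proj₁ (proj₂ (normalise x)))
    lookup-index : ∀ x → List.lookup notations (index x) ≡ proj₁ (normalise x)
    lookup-index x = sym (Anyₚ.lookup-index (proj₁ (proj₂ (normalise x))))
    member : ∀ k → NotationFrom zero (List.lookup notations k)
    member k = ∈-notations {List.lookup notations k} (∈ₚ.∈-lookup k)
    inj : ∀ k → Injective (lookup (List.lookup notations k))
    inj k = proj₁ (proj₂ (member k))
    build : Fin (length notations) → Cycle
    build k = cycle (inj k) , (points (inj k) , cycle-notation (inj k)) ,
      hasDescentSet⁺ {cycle (inj k)} {lookup (List.lookup notations k)} (inj k) (cycle-notation (inj k)) (proj₂ (proj₂ (member k)))
    start : ∀ x → lookup (proj₁ (normalise x)) zero ≡ zero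
    start x = proj₁ (∈-notations {proj₁ (normalise x)} (proj₁ (proj₂ (normalise x))))
    vec-ext : ∀ {c c′ : Vec (Fin n) n} → (∀ i → lookup c i ≡ lookup c′ i) → c ≡ c′
    vec-ext {c} {c′} eq = trans (sym (Vecₚ.tabulate∘lookup c)) (trans (Vecₚ.tabulate-cong eq) (Vecₚ.tabulate∘lookup c′))
    -- The notation starting with 0 depends on the permutation alone, not on the notation supplied
    -- with it; in a list without repetitions its index is then determined too.
    index-cong : ∀ {x y : Cycle} → proj₁ x Perm.≈ proj₁ y → index x ≡ index y
    index-cong {x} {y} π≈π′ = lookup-injective notations-unique _ _ (trans (lookup-index x) (trans
      (vec-ext (notation-unique (proj₁ x ⟨$⟩ʳ_) (proj₁ y ⟨$⟩ʳ_) (proj₂ (proj₂ (normalise x))) (proj₂ (proj₂ (normalise y))) π≈π′ (trans (start x) (sym (start y)))))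
      (sym (lookup-index y))))
    index-build : ∀ k → index (build k) ≡ k
    index-build k = lookup-injective notations-unique _ _ (trans (lookup-index (build k))
      (vec-ext (notation-unique (proj₁ (build k) ⟨$⟩ʳ_) (proj₁ (build k) ⟨$⟩ʳ_) (proj₂ (proj₂ (normalise (build k)))) (cycle-notation (inj k)) (λ _ → refl)
        (trans (start (build k)) (sym (proj₁ (member k)))))))
    -- Each point is some `lookup c i`, and both permutations send it to `lookup c (next i)`.
    build-index : ∀ x a → proj₁ (build (index x)) ⟨$⟩ʳ a ≡ proj₁ x ⟨$⟩ʳ a
    build-index x a = let i , ci = injective⇒surjective (inj (index x)) a in begin
      proj₁ (build (index x)) ⟨$⟩ʳ a                        ≡⟨ cong (proj₁ (build (index x)) ⟨$⟩ʳ_) ci ⟨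
      proj₁ (build (index x)) ⟨$⟩ʳ lookup c i               ≡⟨ cycle-notation (inj (index x)) i ⟩
      lookup c (next i)                                     ≡⟨ cong (λ c → lookup c (next i)) (lookup-index x) ⟩
      lookup (proj₁ (normalise x)) (next i)                 ≡⟨ proj₂ (proj₂ (normalise x)) i ⟨
      proj₁ x ⟨$⟩ʳ lookup (proj₁ (normalise x)) i           ≡⟨ cong (λ c → proj₁ x ⟨$⟩ʳ lookup c i) (lookup-index x) ⟨
      proj₁ x ⟨$⟩ʳ lookup c i                               ≡⟨ cong (proj₁ x ⟨$⟩ʳ_) ci ⟩
      proj₁ x ⟨$⟩ʳ a                                        ∎
      where
      open ≡-Reasoning
      c = List.lookup notations (index x)

theorem4 : ∀ (m : ℕ) (J : Subset m) → let n = suc m in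
    ∃[ N ] HasCardinality (NCyclesWithDescentSet J) N
    × (+ N / 1 ≡ sumOverDivisors n (λ d → μ d * -1ℤ ^ (∣ J ∣ ∸ length (multiples J d)) * det (descentMatrix J d)) / n)
theorem4 m J = length (notations J) , cardinality J , ℚₚ.fromℚᵘ-cong {ℚᵘ.mkℚᵘ (+ length (notations J)) 0} {ℚᵘ.mkℚᵘ S m} (ℚᵘ.*≡* (begin
  -- Cross-multiplied equality of the fractions; `mkℚᵘ` stores each denominator less one, so 0 and
  -- `m` stand for 1 and `suc m`.
  + length (notations J) * + suc m  ≡⟨ ℤₚ.*-comm (+ length (notations J)) (+ suc m) ⟩
  + suc m * + length (notations J)  ≡⟨ ∑-notations J ⟨
  ∑ (words (suc m) (suc m)) (λ c → ⟦ injective? (lookup c) ×-dec descentsEqual? J (lookup c) ⟧)  ≡⟨ ∑-descentsEqual J ⟩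
  S                                 ≡⟨ ℤₚ.*-identityʳ S ⟨
  S * + 1                           ∎))
  where
  open ≡-Reasoning
  S = sumOverDivisors (suc m) (λ d → μ d * -1ℤ ^ (∣ J ∣ ∸ length (multiples J d)) * det (descentMatrix J d))
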